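{- Let $m$ be a positive integer and $a_1,\ldots,a_n$ complex numbers. Let $Q(x_1,\ldots,x_n)=\prod_{1\leqslant i<j\leqslant n}(x_j-x_i)^{2m-1}$ and $R(x_1,\ldots,x_n)=\prod_{1\leqslant i<j\leqslant n}(a_jx_j-a_ix_i)(x_j-x_i)^{2m-1}$. Then, as polynomial/rational function identities in $x$, $$Q^*(x-n+1,x-n+2,\ldots,x)=(-1)^{(m-1)\binom n2}\frac{m!(2m)!\cdots(nm)!}{(m!)^n n!}\cdot\frac{(x)_0(x)_m\cdots(x)_{(n-1)m}}{(x)_0(x)_1\cdots(x)_{n-1}}$$ (where the $i$th argument of $Q^*$ is $x-n+i$), and $$R^*(x,\ldots,x)=(-1)^{m\binom n2}\frac{m!(2m)!\cdots(nm)!}{(m!)^n n!}\operatorname{per}\big(a_j^{i-1}\big)_{1\leqslant i,j\leqslant n}\prod_{r=0}^{n-1}(x)_{rm}.$$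
   Context: Falling factorials: $(x)_0=1$ and $(x)_r=x(x-1)\cdots(x-r+1)$ for $r\geqslant 1$. For a polynomial $P=\sum c_{j_1,\ldots,j_n}x_1^{j_1}\cdots x_n^{j_n}$, define $P^*(x_1,\ldots,x_n)=\sum c_{j_1,\ldots,j_n}(x_1)_{j_1}\cdots(x_n)_{j_n}$. The permanent of $B=(b_{ij})$ is $\operatorname{per}(B)=\sum_{\sigma\in S_n}\prod_{i=1}^n b_{i,\sigma(i)}$. -}

module Defs where

open import Level using (Level)
open import Algebra.Bundles using (CommutativeRing)
open import Data.Nat as ℕ using (ℕ; zero; suc)
open import Data.Nat.Base using (_!)
open import Data.Fin as Fin using (Fin; toℕ)
open import Data.Fin.Properties using (_≟_)
open import Data.List as List using (List; []; _∷_; map; foldr; filter; allFin; cartesianProduct)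
open import Data.Product using (_×_; _,_; proj₁; proj₂)
open import Data.Vec as Vec using (Vec)
open import Function using (_∘_)
import Data.List.Relation.Unary.Unique.DecPropositional as UniqueDec

∏ℕ : List ℕ → ℕ
∏ℕ = foldr ℕ._*_ 1

numConst : ℕ → ℕ → ℕ
numConst m n = ∏ℕ (map (λ k → ((suc (toℕ k)) ℕ.* m) !) (allFin n))

denConst : ℕ → ℕ → ℕ
denConst m n = ((m !) ℕ.^ n) ℕ.* (n !)

allVecs : ∀ {n} (k : ℕ) → List (Vec (Fin n) k)
allVecs zero = Vec.[] ∷ []
allVecs {n} (suc k) =
  List.concatMap (λ v → map (λ i → i Vec.∷ v) (allFin n)) (allVecs k)

permutations : ∀ n → List (Vec (Fin n) n)
permutations n = filter (λ v → UniqueDec.unique? _≟_ (Vec.toList v)) (allVecs n)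

module Ops {c ℓ : Level} (R : CommutativeRing c ℓ) where
  open CommutativeRing R

  ι : ℕ → Carrier
  ι zero = 0#
  ι (suc k) = 1# + ι k

  pow : Carrier → ℕ → Carrier
  pow x zero = 1#
  pow x (suc k) = x * pow x k

  sgn : ℕ → Carrier
  sgn zero = 1#
  sgn (suc k) = - sgn k

  ff : Carrier → ℕ → Carrier
  ff x zero = 1#
  ff x (suc r) = ff x r * (x - ι r)

  ∏ : List Carrier → Carrier
  ∏ = foldr _*_ 1#

  ∑ : List Carrier → Carrier
  ∑ = foldr _+_ 0#

  per : ∀ {n} → (Fin n → Fin n → Carrier) → Carrier
  per {n} B = ∑ (map (λ σ → ∏ (map (λ i → B i (Vec.lookup σ i)) (allFin n))) (permutations n))

  -- Multivariate polynomials in x₀,…,x_{n-1} with coefficients in R.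
  -- Poly (suc n) is a coefficient list in the variable x₀ (lowest degree
  -- first) whose coefficients are polynomials in x₁,…,x_n.

  Poly : ℕ → Set c
  Poly zero = Carrier
  Poly (suc n) = List (Poly n)

  zeroP : ∀ n → Poly n
  zeroP zero = 0#
  zeroP (suc n) = []

  constP : ∀ n → Carrier → Poly n
  constP zero a = a
  constP (suc n) a = constP n a ∷ []

  addP : ∀ n → Poly n → Poly n → Poly n
  addP zero p q = p + q
  addP (suc n) [] q = q
  addP (suc n) (p ∷ ps) [] = p ∷ ps
  addP (suc n) (p ∷ ps) (q ∷ qs) = addP n p q ∷ addP (suc n) ps qs

  negP : ∀ n → Poly n → Poly n
  negP zero p = - p
  negP (suc n) ps = map (negP n) ps

  subP : ∀ n → Poly n → Poly n → Poly n
  subP n p q = addP n p (negP n q)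

  mulP : ∀ n → Poly n → Poly n → Poly n
  mulP zero p q = p * q
  mulP (suc n) [] qs = []
  mulP (suc n) (p ∷ ps) qs =
    addP (suc n) (map (mulP n p) qs) (zeroP n ∷ mulP (suc n) ps qs)

  powP : ∀ n → Poly n → ℕ → Poly n
  powP n p zero = constP n 1#
  powP n p (suc k) = mulP n p (powP n p k)

  prodP : ∀ n → List (Poly n) → Poly n
  prodP n = foldr (mulP n) (constP n 1#)

  varP : ∀ n → Fin n → Poly n
  varP (suc n) Fin.zero = zeroP n ∷ constP n 1# ∷ []
  varP (suc n) (Fin.suc i) = varP n i ∷ []

  -- P* evaluated at t: replace each monomial x₀^{j₀}⋯x_{n-1}^{j_{n-1}}
  -- by (t₀)_{j₀}⋯(t_{n-1})_{j_{n-1}}.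
  star : ∀ n → Poly n → (Fin n → Carrier) → Carrier
  star zero a t = a
  star (suc n) ps t = go 0 ps
    where
    go : ℕ → List (Poly n) → Carrier
    go j [] = 0#
    go j (p ∷ qs) = ff (t Fin.zero) j * star n p (t ∘ Fin.suc) + go (suc j) qs

  pairs : ∀ n → List (Fin n × Fin n)
  pairs n = filter (λ p → proj₁ p Fin.<? proj₂ p) (cartesianProduct (allFin n) (allFin n))

  Qpoly : (m n : ℕ) → Poly n
  Qpoly m n = prodP n (map (λ p → powP n (subP n (varP n (proj₂ p)) (varP n (proj₁ p))) (2 ℕ.* m ℕ.∸ 1)) (pairs n))

  Rpoly : (m n : ℕ) → (Fin n → Carrier) → Poly n
  Rpoly m n a = prodP n (map (λ p →
      mulP n (subP n (mulP n (constP n (a (proj₂ p))) (varP n (proj₂ p)))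
                     (mulP n (constP n (a (proj₁ p))) (varP n (proj₁ p))))
             (powP n (subP n (varP n (proj₂ p)) (varP n (proj₁ p))) (2 ℕ.* m ℕ.∸ 1)))
    (pairs n))

{-# OPTIONS --safe #-}
-- Let E_i raise the i-th exponent of a function on exponent vectors. Then P* at t is (P(E) g)(0)
-- with g(v) = ∏ (t_i)_{v_i}, so products of linear forms become products of commuting shift
-- operators. With h = ∏ (E_j − E_i)^{2m−1} g for t = (x,…,x), h is antisymmetric; expanding one more
-- (weighted) Vandermonde product gives R* = per · h(0,1,…,n−1) and n! h(0,1,…,n−1) = V, where
-- V = (∏ (x_j − x_i)^{2m})*(x,…,x), while ∏ (x)_r · Q* = h(n−1,…,1,0) = ± h(0,1,…,n−1).
--
-- It remains to evaluate V, a polynomial in x with integer coefficients, at large integers x = N.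
-- There K! V is a mixed difference of order (N,…,N) at 0 of any polynomial of degree nN with leading
-- form (∑ x_i)^K ∏ (x_j − x_i)^{2m}. As in the Combinatorial Nullstellensatz, the lower order terms
-- are chosen so that on the grid {0,…,N}^n the polynomial vanishes except at (0,m,2m,…,(n−1)m).
module Submission where

open import Defs
open import Level using (Level; _⊔_)
open import Algebra.Bundles using (CommutativeRing)
import Algebra.Solver.Ring as RingSolver
open import Algebra.Solver.Ring.AlmostCommutativeRing using (fromCommutativeRing; _-Raw-AlmostCommutative⟶_; Induced-equivalence)
open import Data.Bool using (true; false)
open import Data.Nat as ℕ using (ℕ; zero; suc; _!; _≤_; _∸_) renaming (_*_ to _*ℕ_)
import Data.Nat.Properties as ℕ
open import Data.Nat.Combinatorics using (_C_; nC1≡n; nCk+nC[k+1]≡[n+1]C[k+1]; k>n⇒nCk≡0)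
open import Data.Integer as ℤ using (ℤ)
import Data.Integer.Properties as ℤ
open import Data.Fin as Fin using (Fin; zero; suc; toℕ)
import Data.Fin.Properties as Fin
open import Data.List as List using (List; []; _∷_; _++_; map; allFin; filter; cartesianProduct; concatMap)
open import Data.List.Properties as List using (filter-++; map-tabulate; map-++; map-∘; length-tabulate)
open import Data.List.Membership.Propositional using (_∈_)
open import Data.List.Membership.Propositional.Properties using (∈-map⁺; ∈-map⁻; ∈-concatMap⁺; ∈-allFin; ∈-filter⁺; ∈-filter⁻; ∈-∃++; ∈-++⁺ˡ; ∈-++⁺ʳ)
open import Data.List.Membership.Propositional.Properties.WithK using (unique∧set⇒bag)
open import Data.List.Relation.Binary.BagAndSetEquality using (∼bag⇒↭)
open import Data.List.Relation.Binary.Permutation.Propositional as ↭ using (_↭_; ↭-reflexive)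
import Data.List.Relation.Binary.Permutation.Propositional.Properties as ↭
open import Data.List.Relation.Unary.All as All using (All; []; _∷_)
import Data.List.Relation.Unary.All.Properties as All
open import Data.List.Relation.Unary.AllPairs as AllPairs using ([]; _∷_)
import Data.List.Relation.Unary.AllPairs.Properties as AllPairs
open import Data.List.Relation.Unary.Any as Any using (here; there)
open import Data.List.Relation.Unary.Unique.Propositional using (Unique)
import Data.List.Relation.Unary.Unique.Propositional.Properties as Unique
import Data.List.Relation.Unary.Unique.DecPropositional as UniqueDec
open import Data.Maybe using (just; nothing)
open import Data.Product using (_×_; _,_; proj₁; proj₂; ∃-syntax; ∃₂)
open import Data.Sum using (_⊎_; inj₁; inj₂)
open import Data.Vec as Vec using (Vec; []; _∷_; _∷ʳ_; toList; lookup)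
import Data.Vec.Properties as Vec
open import Data.Vec.Relation.Binary.Pointwise.Inductive using (Pointwise; []; _∷_)
open import Function using (_∘_; id; mk⇔)
open import Relation.Binary.Definitions using (WeaklyDecidable)
open import Relation.Binary.PropositionalEquality as ≡ using (_≡_; _≢_)
open import Relation.Nullary using (Dec; yes; no; does; contradiction; ¬_)
open import Relation.Unary using (Pred; Decidable)

-- Why K! V: for K + |v| = nN the coefficient of (x_1 ⋯ x_n)^N in (∑ x_i)^K x^v is K!/∏ (N - v_i)!.
-- A mixed difference of order (N,...,N) multiplies it by (N!)^n, which gives K! ∏ (N)_{v_i}, that
-- is K! times (x^v)* at (N,...,N). As K = nN - 2mC(n,2) must be a natural number, N has to be
-- large.
--
-- Powers are replaced by shifted products with the same leading form: (x_j - x_i)^{2m} by (x_j -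
-- x_i + m)_{2m}, zero for -m ≤ x_j - x_i < m, and (∑ x_i)^K by a product that is zero for sums from
-- s + 1 to s + K, where s = mC(n,2). Points of {0,...,N} at mutual distance at least m have sum
-- between s and nN - s = s + K, so only the sum s is left. It forces the numbers 0, m, 2m, ...;
-- since the window is asymmetric, a distance of exactly m occurs only in increasing order, and one
-- point remains.
--
-- The factorials on both sides can be cancelled in ℤ but not in a general ring, which explains the
-- detour: a polynomial with integer coefficients that is zero at all large integers takes the value
-- 0 everywhere, in every commutative ring.

-- The canonical map from the integers to a commutative ring.

module IntegerImage {c ℓ : Level} (R : CommutativeRing c ℓ) where
  open CommutativeRing R hiding (zero)
  open import Data.Integer using (+_; -[1+_]; _⊖_)
  open Ops R
  open import Algebra.Properties.Ring ring
  open import Relation.Binary.Reasoning.Setoid setoid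

  ⟦_⟧ℤ : ℤ → Carrier
  ⟦ + n ⟧ℤ = ι n
  ⟦ -[1+ n ] ⟧ℤ = - ι (suc n)

  ι-+ : ∀ m n → ι (m ℕ.+ n) ≈ ι m + ι n
  ι-+ zero n = sym (+-identityˡ _)
  ι-+ (suc m) n = trans (+-congˡ (ι-+ m n)) (sym (+-assoc _ _ _))

  ι-* : ∀ m n → ι (m ℕ.* n) ≈ ι m * ι n
  ι-* zero n = sym (zeroˡ _)
  ι-* (suc m) n = begin
    ι (n ℕ.+ m ℕ.* n)       ≈⟨ ι-+ n (m ℕ.* n) ⟩
    ι n + ι (m ℕ.* n)       ≈⟨ +-cong (sym (*-identityˡ _)) (ι-* m n) ⟩
    1# * ι n + ι m * ι n    ≈⟨ distribʳ _ _ _ ⟨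
    (1# + ι m) * ι n        ∎

  cancel-1 : ∀ a b → (1# + a) - (1# + b) ≈ a - b
  cancel-1 a b = begin
    (1# + a) - (1# + b)      ≈⟨ +-cong (+-comm _ _) (-‿+-comm 1# b) ⟨
    (a + 1#) + (- 1# - b)    ≈⟨ +-assoc _ _ _ ⟩
    a + (1# + (- 1# - b))    ≈⟨ +-congˡ (+-assoc _ _ _) ⟨
    a + ((1# - 1#) - b)      ≈⟨ +-congˡ (+-congʳ (-‿inverseʳ 1#)) ⟩
    a + (0# - b)             ≈⟨ +-congˡ (+-identityˡ _) ⟩
    a - b                    ∎

  ⟦⟧-⊖ : ∀ m n → ⟦ m ⊖ n ⟧ℤ ≈ ι m - ι n
  ⟦⟧-⊖ zero zero = sym (-‿inverseʳ _)
  ⟦⟧-⊖ zero (suc n) = sym (+-identityˡ _)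
  ⟦⟧-⊖ (suc m) zero = sym (trans (+-congˡ -0#≈0#) (+-identityʳ _))
  ⟦⟧-⊖ (suc m) (suc n) = begin
    ⟦ suc m ⊖ suc n ⟧ℤ     ≡⟨ ≡.cong ⟦_⟧ℤ (ℤ.[1+m]⊖[1+n]≡m⊖n m n) ⟩
    ⟦ m ⊖ n ⟧ℤ             ≈⟨ ⟦⟧-⊖ m n ⟩
    ι m - ι n              ≈⟨ cancel-1 _ _ ⟨
    ι (suc m) - ι (suc n)  ∎

  ⟦⟧-neg : ∀ a → ⟦ ℤ.- a ⟧ℤ ≈ - ⟦ a ⟧ℤ
  ⟦⟧-neg (+ zero) = sym -0#≈0#
  ⟦⟧-neg (+ suc n) = refl
  ⟦⟧-neg -[1+ n ] = sym (-‿involutive _)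

  ⟦⟧-+ : ∀ a b → ⟦ a ℤ.+ b ⟧ℤ ≈ ⟦ a ⟧ℤ + ⟦ b ⟧ℤ
  ⟦⟧-+ (+ m) (+ n) = ι-+ m n
  ⟦⟧-+ (+ m) -[1+ n ] = ⟦⟧-⊖ m (suc n)
  ⟦⟧-+ -[1+ m ] (+ n) = trans (⟦⟧-⊖ n (suc m)) (+-comm _ _)
  ⟦⟧-+ -[1+ m ] -[1+ n ] = begin
    - ι (suc (suc (m ℕ.+ n)))    ≡⟨ ≡.cong (λ k → - ι k) (≡.cong suc (ℕ.+-suc m n)) ⟨
    - ι (suc m ℕ.+ suc n)        ≈⟨ -‿cong (ι-+ (suc m) (suc n)) ⟩
    - (ι (suc m) + ι (suc n))    ≈⟨ -‿+-comm _ _ ⟨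
    - ι (suc m) - ι (suc n)      ∎

  ⟦⟧-*+ : ∀ m b → ⟦ + m ℤ.* b ⟧ℤ ≈ ι m * ⟦ b ⟧ℤ
  ⟦⟧-*+ m (+ n) = begin
    ⟦ + m ℤ.* + n ⟧ℤ  ≡⟨ ≡.cong ⟦_⟧ℤ (ℤ.pos-* m n) ⟨
    ι (m ℕ.* n)       ≈⟨ ι-* m n ⟩
    ι m * ι n         ∎
  ⟦⟧-*+ m -[1+ n ] = begin
    ⟦ + m ℤ.* -[1+ n ] ⟧ℤ          ≡⟨ ≡.cong ⟦_⟧ℤ (ℤ.neg-distribʳ-* (+ m) (+ suc n)) ⟨
    ⟦ ℤ.- (+ m ℤ.* + suc n) ⟧ℤ     ≈⟨ ⟦⟧-neg (+ m ℤ.* + suc n) ⟩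
    - ⟦ + m ℤ.* + suc n ⟧ℤ         ≈⟨ -‿cong (⟦⟧-*+ m (+ suc n)) ⟩
    - (ι m * ι (suc n))            ≈⟨ -‿distribʳ-* _ _ ⟩
    ι m * - ι (suc n)              ∎

  ⟦⟧-* : ∀ a b → ⟦ a ℤ.* b ⟧ℤ ≈ ⟦ a ⟧ℤ * ⟦ b ⟧ℤ
  ⟦⟧-* (+ m) b = ⟦⟧-*+ m b
  ⟦⟧-* -[1+ m ] b = begin
    ⟦ -[1+ m ] ℤ.* b ⟧ℤ          ≡⟨ ≡.cong ⟦_⟧ℤ (ℤ.neg-distribˡ-* (+ suc m) b) ⟨
    ⟦ ℤ.- (+ suc m ℤ.* b) ⟧ℤ     ≈⟨ ⟦⟧-neg (+ suc m ℤ.* b) ⟩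
    - ⟦ + suc m ℤ.* b ⟧ℤ         ≈⟨ -‿cong (⟦⟧-*+ (suc m) b) ⟩
    - (ι (suc m) * ⟦ b ⟧ℤ)       ≈⟨ -‿distribˡ-* _ _ ⟩
    - ι (suc m) * ⟦ b ⟧ℤ         ∎

  morphism : ℤ.+-*-rawRing -Raw-AlmostCommutative⟶ fromCommutativeRing R
  morphism = record
    { ⟦_⟧ = ⟦_⟧ℤ
    ; +-homo = ⟦⟧-+
    ; *-homo = ⟦⟧-*
    ; -‿homo = ⟦⟧-neg
    ; 0-homo = refl
    ; 1-homo = +-identityʳ _
    }

  -- `R` has no decidable equality, so the solver normalises with integer coefficients, and only
  -- equal integers are identified.
  weakDec : WeaklyDecidable (Induced-equivalence morphism)
  weakDec a b with a ℤ.≟ b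
  ... | yes ≡.refl = just refl
  ... | no _ = nothing

  module Solver = RingSolver ℤ.+-*-rawRing (fromCommutativeRing R) morphism weakDec
  open Solver using (solve; _:=_; _:+_; _:*_; :-_; _:-_) public

-- Polynomials as shift operators on functions of exponent vectors.

inc : ∀ {n} → Fin n → Vec ℕ n → Vec ℕ n
inc zero (k ∷ v) = suc k ∷ v
inc (suc i) (k ∷ v) = k ∷ inc i v

inc-comm : ∀ {n} (i j : Fin n) v → inc i (inc j v) ≡ inc j (inc i v)
inc-comm zero zero (k ∷ v) = ≡.refl
inc-comm zero (suc j) (k ∷ v) = ≡.refl
inc-comm (suc i) zero (k ∷ v) = ≡.refl
inc-comm (suc i) (suc j) (k ∷ v) = ≡.cong (k ∷_) (inc-comm i j v)

zeros : ∀ {n} → Vec ℕ n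
zeros {n} = Vec.replicate n 0

module Moments {c ℓ : Level} (R : CommutativeRing c ℓ) where
  open CommutativeRing R hiding (zero)
  open Ops R
  open IntegerImage R
  open import Algebra.Properties.Ring ring
  open import Relation.Binary.Reasoning.Setoid setoid

  Functional : ℕ → Set c
  Functional n = Vec ℕ n → Carrier

  infix 4 _≋_
  _≋_ : ∀ {n} → Functional n → Functional n → Set ℓ
  g ≋ g′ = ∀ v → g v ≈ g′ v

  -- This is P(E) g: the value at v is the sum of c_w g(v + w) over the monomials c_w x^w of P. The
  -- position of a coefficient in the list becomes the number of shifts of the head exponent.
  act : ∀ n → Poly n → Functional n → Functional n
  act zero a g [] = a * g []
  act (suc n) [] g v = 0#
  act (suc n) (p ∷ ps) g (k ∷ v) = act n p (g ∘ (k ∷_)) v + act (suc n) ps g (suc k ∷ v)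

  act-+ : ∀ n P g g′ → act n P (λ u → g u + g′ u) ≋ λ v → act n P g v + act n P g′ v
  act-+ zero a g g′ [] = distribˡ _ _ _
  act-+ (suc n) [] g g′ v = sym (+-identityˡ _)
  act-+ (suc n) (p ∷ ps) g g′ (k ∷ v) = trans
    (+-cong (act-+ n p (g ∘ (k ∷_)) (g′ ∘ (k ∷_)) v) (act-+ (suc n) ps g g′ (suc k ∷ v)))
    (solve 4 (λ a b c d → (a :+ b) :+ (c :+ d) := (a :+ c) :+ (b :+ d)) refl _ _ _ _)

  act-0 : ∀ n P → act n P (λ _ → 0#) ≋ λ _ → 0#
  act-0 zero a [] = zeroʳ _
  act-0 (suc n) [] v = refl
  act-0 (suc n) (p ∷ ps) (k ∷ v) = trans (+-cong (act-0 n p v) (act-0 (suc n) ps (suc k ∷ v))) (+-identityˡ _)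

  act-zeroP : ∀ n g → act n (zeroP n) g ≋ λ _ → 0#
  act-zeroP zero g [] = zeroˡ _
  act-zeroP (suc n) g v = refl

  act-constP : ∀ n a g → act n (constP n a) g ≋ λ v → a * g v
  act-constP zero a g [] = refl
  act-constP (suc n) a g (k ∷ v) = trans (+-identityʳ _) (act-constP n a (g ∘ (k ∷_)) v)

  act-varP : ∀ n i g → act n (varP n i) g ≋ g ∘ inc i
  act-varP (suc n) zero g (k ∷ v) = begin
    act n (zeroP n) (g ∘ (k ∷_)) v + (act n (constP n 1#) (g ∘ (suc k ∷_)) v + 0#)
      ≈⟨ +-cong (act-zeroP n _ v) (+-identityʳ _) ⟩
    0# + act n (constP n 1#) (g ∘ (suc k ∷_)) v  ≈⟨ +-identityˡ _ ⟩
    act n (constP n 1#) (g ∘ (suc k ∷_)) v       ≈⟨ act-constP n 1# (g ∘ (suc k ∷_)) v ⟩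
    1# * g (suc k ∷ v)                           ≈⟨ *-identityˡ _ ⟩
    g (suc k ∷ v)                                ∎
  act-varP (suc n) (suc i) g (k ∷ v) = trans (+-identityʳ _) (act-varP n i (g ∘ (k ∷_)) v)

  act-addP : ∀ n P Q g → act n (addP n P Q) g ≋ λ v → act n P g v + act n Q g v
  act-addP zero a b g [] = distribʳ _ _ _
  act-addP (suc n) [] Q g v = sym (+-identityˡ _)
  act-addP (suc n) (p ∷ ps) [] g v = sym (+-identityʳ _)
  act-addP (suc n) (p ∷ ps) (q ∷ qs) g (k ∷ v) = trans
    (+-cong (act-addP n p q (g ∘ (k ∷_)) v) (act-addP (suc n) ps qs g (suc k ∷ v)))
    (solve 4 (λ a b c d → (a :+ b) :+ (c :+ d) := (a :+ c) :+ (b :+ d)) refl _ _ _ _)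

  act-negP : ∀ n P g → act n (negP n P) g ≋ λ v → - act n P g v
  act-negP zero a g [] = sym (-‿distribˡ-* _ _)
  act-negP (suc n) [] g v = sym -0#≈0#
  act-negP (suc n) (p ∷ ps) g (k ∷ v) = trans
    (+-cong (act-negP n p (g ∘ (k ∷_)) v) (act-negP (suc n) ps g (suc k ∷ v)))
    (-‿+-comm _ _)

  act-subP : ∀ n P Q g → act n (subP n P Q) g ≋ λ v → act n P g v - act n Q g v
  act-subP n P Q g v = trans (act-addP n P (negP n Q) g v) (+-congˡ (act-negP n Q g v))

  mutual
    act-mulP : ∀ n P Q g → act n (mulP n P Q) g ≋ act n P (act n Q g)
    act-mulP zero a b g [] = *-assoc _ _ _
    act-mulP (suc n) [] Q g v = refl
    act-mulP (suc n) (p ∷ ps) Q g (k ∷ v) = begin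
      act (suc n) (mulP (suc n) (p ∷ ps) Q) g (k ∷ v)
        ≈⟨ act-addP (suc n) (List.map (mulP n p) Q) (zeroP n ∷ mulP (suc n) ps Q) g (k ∷ v) ⟩
      act (suc n) (List.map (mulP n p) Q) g (k ∷ v)
        + (act n (zeroP n) (g ∘ (k ∷_)) v + act (suc n) (mulP (suc n) ps Q) g (suc k ∷ v))
        ≈⟨ +-cong (act-map-mulP n p Q g k v)
             (trans (+-congʳ (act-zeroP n _ v)) (trans (+-identityˡ _) (act-mulP (suc n) ps Q g (suc k ∷ v)))) ⟩
      act (suc n) (p ∷ ps) (act (suc n) Q g) (k ∷ v) ∎

    -- `p` does not involve the first variable, so its action passes through the shifts of the head
    -- exponent. That exponent `k` is general because every coefficient of `Q` is read one step
    -- further.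
    act-map-mulP : ∀ n p Q g k v →
      act (suc n) (List.map (mulP n p) Q) g (k ∷ v) ≈ act n p (λ u → act (suc n) Q g (k ∷ u)) v
    act-map-mulP n p [] g k v = sym (act-0 n p v)
    act-map-mulP n p (q ∷ Q) g k v = begin
      act n (mulP n p q) (g ∘ (k ∷_)) v + act (suc n) (List.map (mulP n p) Q) g (suc k ∷ v)
        ≈⟨ +-cong (act-mulP n p q (g ∘ (k ∷_)) v) (act-map-mulP n p Q g (suc k) v) ⟩
      act n p (act n q (g ∘ (k ∷_))) v + act n p (λ u → act (suc n) Q g (suc k ∷ u)) v
        ≈⟨ act-+ n p _ _ v ⟨
      act n p (λ u → act (suc n) (q ∷ Q) g (k ∷ u)) v ∎

  ffs : ∀ {n} → (Fin n → Carrier) → Functional n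
  ffs t [] = 1#
  ffs t (k ∷ v) = ff (t zero) k * ffs (t ∘ suc) v

  -- The helper inside `star` with the running degree exposed, so that lemmas can speak of it and
  -- induct on it.
  starFrom : ∀ n → (Fin (suc n) → Carrier) → ℕ → List (Poly n) → Carrier
  starFrom n t j [] = 0#
  starFrom n t j (p ∷ qs) = ff (t zero) j * star n p (t ∘ suc) + starFrom n t (suc j) qs

  mutual
    -- The omitted left-hand side is the local function `go` of `star`, which
    -- cannot be named here; the abstraction in `star-unfold` determines it.
    go≡starFrom : ∀ n (t : Fin (suc n) → Carrier) (P : List (Poly n)) j qs → _ ≡ starFrom n t j qs

    star-unfold : ∀ n P t → star (suc n) P t ≡ starFrom n t 0 P
    star-unfold n [] t = ≡.refl
    -- The list and the starting degree become variables; only then does the goal fix the omitted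
    -- term for all arguments.
    star-unfold n (p ∷ qs) t with p ∷ qs | 1
    ... | P | j = ≡.cong (λ z → _ + z) (go≡starFrom n t P j qs)

    go≡starFrom n t P j [] = ≡.refl
    go≡starFrom n t P j (p ∷ qs) = ≡.cong (λ z → _ + z) (go≡starFrom n t P (suc j) qs)

  act-* : ∀ n P a g → act n P (λ u → a * g u) ≋ λ v → a * act n P g v
  act-* zero b a g [] = solve 3 (λ a b g → b :* (a :* g) := a :* (b :* g)) refl _ _ _
  act-* (suc n) [] a g v = sym (zeroʳ _)
  act-* (suc n) (p ∷ ps) a g (k ∷ v) = trans
    (+-cong (act-* n p a (g ∘ (k ∷_)) v) (act-* (suc n) ps a g (suc k ∷ v)))
    (sym (distribˡ _ _ _))

  mutual
    star≈act : ∀ n P t → star n P t ≈ act n P (ffs t) zeros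
    star≈act zero a t = sym (*-identityʳ _)
    star≈act (suc n) P t = trans (reflexive (star-unfold n P t)) (starFrom≈act n t 0 P)

    starFrom≈act : ∀ n t j P → starFrom n t j P ≈ act (suc n) P (ffs t) (j ∷ zeros)
    starFrom≈act n t j [] = refl
    starFrom≈act n t j (p ∷ qs) = +-cong
      (trans (*-congˡ (star≈act n p (t ∘ suc))) (sym (act-* n p _ _ zeros)))
      (starFrom≈act n t (suc j) qs)

  -- ((β , i) , (α , j)) stands for the linear form α xⱼ − β xᵢ.
  Form : ℕ → Set c
  Form n = (Carrier × Fin n) × (Carrier × Fin n)

  shift : ∀ {n} → Form n → Functional n → Functional n
  shift ((β , i) , (α , j)) g v = α * g (inc j v) - β * g (inc i v)

  run : ∀ {n} → List (Form n) → Functional n → Functional n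
  run L g = List.foldr shift g L

  shift-cong : ∀ {n} (l : Form n) {g g′} → g ≋ g′ → shift l g ≋ shift l g′
  shift-cong l e v = +-cong (*-congˡ (e _)) (-‿cong (*-congˡ (e _)))

  run-cong : ∀ {n} (L : List (Form n)) {g g′} → g ≋ g′ → run L g ≋ run L g′
  run-cong [] e = e
  run-cong (l ∷ L) e = shift-cong l (run-cong L e)

  run-++ : ∀ {n} (L L′ : List (Form n)) g v → run (L ++ L′) g v ≡ run L (run L′ g) v
  run-++ [] L′ g v = ≡.refl
  run-++ (((β , i) , (α , j)) ∷ L) L′ g v =
    ≡.cong₂ (λ x y → α * x - β * y) (run-++ L L′ g _) (run-++ L L′ g _)

  shift-comm : ∀ {n} (l l′ : Form n) g → shift l (shift l′ g) ≋ shift l′ (shift l g)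
  shift-comm ((β , i) , (α , j)) ((δ , i′) , (γ , j′)) g v = begin
    α * (γ * g (inc j′ (inc j v)) - δ * g (inc i′ (inc j v)))
      - β * (γ * g (inc j′ (inc i v)) - δ * g (inc i′ (inc i v)))
      ≈⟨ solve 8 (λ α β γ δ w x y z →
           α :* (γ :* w :- δ :* x) :- β :* (γ :* y :- δ :* z)
             := γ :* (α :* w :- β :* y) :- δ :* (α :* x :- β :* z)) refl α β γ δ _ _ _ _ ⟩
    γ * (α * g (inc j′ (inc j v)) - β * g (inc j′ (inc i v)))
      - δ * (α * g (inc i′ (inc j v)) - β * g (inc i′ (inc i v)))
      ≡⟨ ≡.cong₂ (λ x y → γ * x - δ * y)
           (≡.cong₂ (λ x y → α * g x - β * g y) (inc-comm j′ j v) (inc-comm j′ i v))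
           (≡.cong₂ (λ x y → α * g x - β * g y) (inc-comm i′ j v) (inc-comm i′ i v)) ⟩
    γ * (α * g (inc j (inc j′ v)) - β * g (inc i (inc j′ v)))
      - δ * (α * g (inc j (inc i′ v)) - β * g (inc i (inc i′ v))) ∎

  -- Shifts commute. Hence the factors can be regrouped into whole Vandermonde products, and a
  -- chosen factor can be moved to the front.
  run-↭ : ∀ {n} {L L′ : List (Form n)} → L ↭ L′ → ∀ g → run L g ≋ run L′ g
  run-↭ ↭.refl g v = refl
  run-↭ (↭.prep l p) g = shift-cong l (run-↭ p g)
  run-↭ (↭.swap {L} l l′ p) g v = trans (shift-comm l l′ (run L g) v)
    (shift-cong l′ (shift-cong l (run-↭ p g)) v)
  run-↭ (↭.trans p q) g v = trans (run-↭ p g v) (run-↭ q g v)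

-- Pairs of indices and the action of adjacent transpositions on them.

Pair : ℕ → Set
Pair n = Fin n × Fin n

both : ∀ {m n} → (Fin m → Fin n) → Pair m → Pair n
both f (i , j) = f i , f j

firstRow : ∀ n → List (Pair (suc n))
firstRow n = List.map (λ j → zero , suc j) (allFin n)

-- The filter in `pairs` has no visible recursion on n; here the row of the first variable splits
-- off, as the inductions require.
upper : ∀ n → List (Pair n)
upper zero = []
upper (suc n) = firstRow n ++ List.map (both suc) (upper n)

allFin-suc : ∀ n → allFin (suc n) ≡ zero ∷ List.map suc (allFin n)
allFin-suc n = ≡.cong (zero ∷_) (≡.sym (map-tabulate id suc))

module _ {c ℓ : Level} (R : CommutativeRing c ℓ) where
  open Ops R using (pairs)

  private
    lt? : ∀ {n} (p : Pair n) → _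
    lt? p = proj₁ p Fin.<? proj₂ p

    filter-zero : ∀ {n} (js : List (Fin n)) →
      filter lt? (List.map (zero ,_) (List.map suc js)) ≡ List.map (λ j → zero , suc j) js
    filter-zero [] = ≡.refl
    filter-zero (j ∷ js) = ≡.cong (_ ∷_) (filter-zero js)

    filter-suc-row : ∀ {n} (i : Fin n) js →
      filter lt? (List.map (suc i ,_) (List.map suc js)) ≡ List.map (both suc) (filter lt? (List.map (i ,_) js))
    filter-suc-row i [] = ≡.refl
    filter-suc-row i (j ∷ js) with does (i Fin.<? j)
    ... | true = ≡.cong (_ ∷_) (filter-suc-row i js)
    ... | false = filter-suc-row i js

    filter-suc : ∀ {n} (is js : List (Fin n)) →
      filter lt? (cartesianProduct (List.map suc is) (zero ∷ List.map suc js))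
        ≡ List.map (both suc) (filter lt? (cartesianProduct is js))
    filter-suc [] js = ≡.refl
    filter-suc (i ∷ is) js = begin
      filter lt? (List.map (suc i ,_) (List.map suc js) ++ cartesianProduct (List.map suc is) (zero ∷ List.map suc js))
        ≡⟨ filter-++ lt? (List.map (suc i ,_) (List.map suc js)) _ ⟩
      filter lt? (List.map (suc i ,_) (List.map suc js)) ++ filter lt? (cartesianProduct (List.map suc is) (zero ∷ List.map suc js))
        ≡⟨ ≡.cong₂ _++_ (filter-suc-row i js) (filter-suc is js) ⟩
      List.map (both suc) (filter lt? (List.map (i ,_) js)) ++ List.map (both suc) (filter lt? (cartesianProduct is js))
        ≡⟨ map-++ (both suc) (filter lt? (List.map (i ,_) js)) _ ⟨
      List.map (both suc) (filter lt? (List.map (i ,_) js) ++ filter lt? (cartesianProduct is js))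
        ≡⟨ ≡.cong (List.map (both suc)) (filter-++ lt? (List.map (i ,_) js) (cartesianProduct is js)) ⟨
      List.map (both suc) (filter lt? (cartesianProduct (i ∷ is) js)) ∎
      where open ≡.≡-Reasoning

  pairs≡upper : ∀ n → pairs n ≡ upper n
  pairs≡upper zero = ≡.refl
  pairs≡upper (suc n) = begin
    pairs (suc n)
      ≡⟨ ≡.cong (λ is → filter lt? (cartesianProduct is is)) (allFin-suc n) ⟩
    filter lt? (List.map (zero ,_) (List.map suc (allFin n)) ++ cartesianProduct (List.map suc (allFin n)) (zero ∷ List.map suc (allFin n)))
      ≡⟨ filter-++ lt? (List.map (zero ,_) (List.map suc (allFin n))) _ ⟩
    filter lt? (List.map (zero ,_) (List.map suc (allFin n))) ++ filter lt? (cartesianProduct (List.map suc (allFin n)) (zero ∷ List.map suc (allFin n)))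
      ≡⟨ ≡.cong₂ _++_ (filter-zero (allFin n)) (filter-suc (allFin n) (allFin n)) ⟩
    firstRow n ++ List.map (both suc) (pairs n)
      ≡⟨ ≡.cong (λ ps → firstRow n ++ List.map (both suc) ps) (pairs≡upper n) ⟩
    upper (suc n) ∎
    where open ≡.≡-Reasoning

-- The transpositions of two adjacent indices.
data Adjacent : ℕ → Set where
  here : ∀ {n} → Adjacent (suc (suc n))
  there : ∀ {n} → Adjacent n → Adjacent (suc n)

lo hi : ∀ {n} → Adjacent n → Fin n
lo here = zero
lo (there τ) = suc (lo τ)
hi here = suc zero
hi (there τ) = suc (hi τ)

transpose : ∀ {n} → Adjacent n → Fin n → Fin n
transpose here zero = suc zero
transpose here (suc zero) = zero
transpose here (suc (suc i)) = suc (suc i)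
transpose (there τ) zero = zero
transpose (there τ) (suc i) = suc (transpose τ i)

swapAt : ∀ {a} {A : Set a} {n} → Adjacent n → Vec A n → Vec A n
swapAt here (x ∷ y ∷ v) = y ∷ x ∷ v
swapAt (there τ) (x ∷ v) = x ∷ swapAt τ v

swapAt-involutive : ∀ {a} {A : Set a} {n} (τ : Adjacent n) (v : Vec A n) → swapAt τ (swapAt τ v) ≡ v
swapAt-involutive here (x ∷ y ∷ v) = ≡.refl
swapAt-involutive (there τ) (x ∷ v) = ≡.cong (x ∷_) (swapAt-involutive τ v)

swapAt-map : ∀ {a b} {A : Set a} {B : Set b} (f : A → B) {n} (τ : Adjacent n) v →
  swapAt τ (Vec.map f v) ≡ Vec.map f (swapAt τ v)
swapAt-map f here (x ∷ y ∷ v) = ≡.refl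
swapAt-map f (there τ) (x ∷ v) = ≡.cong (f x ∷_) (swapAt-map f τ v)

swapAt-replicate : ∀ {a} {A : Set a} {n} (τ : Adjacent n) (x : A) → swapAt τ (Vec.replicate n x) ≡ Vec.replicate n x
swapAt-replicate here x = ≡.refl
swapAt-replicate (there τ) x = ≡.cong (x ∷_) (swapAt-replicate τ x)

inc-swapAt : ∀ {n} (τ : Adjacent n) i v → inc (transpose τ i) (swapAt τ v) ≡ swapAt τ (inc i v)
inc-swapAt here zero (x ∷ y ∷ v) = ≡.refl
inc-swapAt here (suc zero) (x ∷ y ∷ v) = ≡.refl
inc-swapAt here (suc (suc i)) (x ∷ y ∷ v) = ≡.refl
inc-swapAt (there τ) zero (x ∷ v) = ≡.refl
inc-swapAt (there τ) (suc i) (x ∷ v) = ≡.cong (x ∷_) (inc-swapAt τ i v)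

transpose-lo : ∀ {n} (τ : Adjacent n) → transpose τ (lo τ) ≡ hi τ
transpose-lo here = ≡.refl
transpose-lo (there τ) = ≡.cong suc (transpose-lo τ)

transpose-allFin : ∀ {n} (τ : Adjacent n) → List.map (transpose τ) (allFin n) ↭ allFin n
transpose-allFin (here {n}) = ↭.swap _ _ (↭-reflexive (map-tabulate {n = n} (λ i → suc (suc i)) (transpose here)))
transpose-allFin (there {n} τ) = begin
  List.map (transpose (there τ)) (allFin (suc n))                 ≡⟨ ≡.cong (List.map (transpose (there τ))) (allFin-suc n) ⟩
  zero ∷ List.map (transpose (there τ)) (List.map suc (allFin n)) ≡⟨ ≡.cong (zero ∷_) (≡.trans (≡.sym (map-∘ (allFin n))) (map-∘ (allFin n))) ⟩
  zero ∷ List.map suc (List.map (transpose τ) (allFin n))         ↭⟨ ↭.prep zero (↭.map⁺ suc (transpose-allFin τ)) ⟩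
  zero ∷ List.map suc (allFin n)                                  ≡⟨ allFin-suc n ⟨
  allFin (suc n)                                                  ∎
  where open ↭.PermutationReasoning

-- No index lies strictly between two adjacent ones, so the transposition reverses one pair only and
-- permutes the other increasing pairs among themselves. This isolates the single factor that causes
-- the sign.
upper-transpose : ∀ {n} (τ : Adjacent n) →
  ∃[ rest ] upper n ↭ (lo τ , hi τ) ∷ rest × List.map (both (transpose τ)) rest ↭ rest
upper-transpose (here {n}) = A ++ B ++ C , ↭-reflexive upper-eq , (begin
  List.map σ (A ++ B ++ C)                          ≡⟨ map-++ σ A (B ++ C) ⟩
  List.map σ A ++ List.map σ (B ++ C)               ≡⟨ ≡.cong (List.map σ A ++_) (map-++ σ B C) ⟩
  List.map σ A ++ List.map σ B ++ List.map σ C      ≡⟨ ≡.cong₂ _++_ (≡.sym (map-∘ {g = σ} (allFin n))) (≡.cong₂ _++_ (≡.sym (map-∘ {g = σ} (allFin n))) (≡.sym (map-∘ {g = σ} (upper n)))) ⟩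
  B ++ A ++ C                                       ↭⟨ ↭.shifts B A ⟩
  A ++ B ++ C                                       ∎)
  where
  open ↭.PermutationReasoning
  σ : Pair (suc (suc n)) → Pair (suc (suc n))
  σ = both (transpose here)
  -- `A` and `B` are the rows of the two transposed indices and are exchanged; `C`, the pairs of
  -- later indices, is fixed.
  A B C : List (Pair (suc (suc n)))
  A = List.map (λ j → zero , suc (suc j)) (allFin n)
  B = List.map (λ j → suc zero , suc (suc j)) (allFin n)
  C = List.map (λ p → both suc (both suc p)) (upper n)
  upper-eq : upper (suc (suc n)) ≡ (zero , suc zero) ∷ A ++ B ++ C
  upper-eq = ≡.trans
    (≡.cong (λ is → List.map (λ j → zero , suc j) is ++ List.map (both suc) (upper (suc n))) (allFin-suc n))
    (≡.cong ((zero , suc zero) ∷_) (≡.cong₂ _++_ (≡.sym (map-∘ (allFin n)))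
      (≡.trans (map-++ (both suc) (firstRow n) _) (≡.cong₂ _++_ (≡.sym (map-∘ (allFin n))) (≡.sym (map-∘ (upper n)))))))
upper-transpose (there {n} τ) with upper-transpose τ
... | rest , split , stable = firstRow n ++ List.map (both suc) rest
  , ↭.trans (↭.++⁺ˡ (firstRow n) (↭.map⁺ (both suc) split)) (↭.shift _ (firstRow n) _)
  , (begin
  List.map σ (firstRow n ++ List.map (both suc) rest)
    ≡⟨ map-++ σ (firstRow n) _ ⟩
  List.map σ (firstRow n) ++ List.map σ (List.map (both suc) rest)
    ≡⟨ ≡.cong₂ _++_ (≡.trans (≡.sym (map-∘ (allFin n))) (map-∘ (allFin n))) (≡.trans (≡.sym (map-∘ rest)) (map-∘ rest)) ⟩
  List.map (λ j → zero , suc j) (List.map (transpose τ) (allFin n)) ++ List.map (both suc) (List.map (both (transpose τ)) rest)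
    ↭⟨ ↭.++⁺ (↭.map⁺ _ (transpose-allFin τ)) (↭.map⁺ _ stable) ⟩
  firstRow n ++ List.map (both suc) rest ∎)
  where
  open ↭.PermutationReasoning
  σ : Pair (suc n) → Pair (suc n)
  σ = both (transpose (there τ))

transpose-hi : ∀ {n} (τ : Adjacent n) → transpose τ (hi τ) ≡ lo τ
transpose-hi here = ≡.refl
transpose-hi (there τ) = ≡.cong suc (transpose-hi τ)

-- Staircase exponents and degree bounds.

infix 4 _≟ᵛ_
_≟ᵛ_ : ∀ {n} (v w : Vec ℕ n) → Dec (v ≡ w)
_≟ᵛ_ = Vec.≡-dec ℕ._≟_

stair : ∀ n → Vec ℕ n
stair zero = []
stair (suc n) = 0 ∷ Vec.map suc (stair n)

inc-map-suc : ∀ {n} (i : Fin n) v → inc i (Vec.map suc v) ≡ Vec.map suc (inc i v)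
inc-map-suc zero (k ∷ v) = ≡.refl
inc-map-suc (suc i) (k ∷ v) = ≡.cong (suc k ∷_) (inc-map-suc i v)

map-suc-injective : ∀ {n} {v w : Vec ℕ n} → Vec.map ℕ.suc v ≡ Vec.map ℕ.suc w → v ≡ w
map-suc-injective {v = []} {[]} e = ≡.refl
map-suc-injective {v = k ∷ v} {l ∷ w} e =
  ≡.cong₂ _∷_ (ℕ.suc-injective (Vec.∷-injectiveˡ e)) (map-suc-injective (Vec.∷-injectiveʳ e))

incs : ∀ {n} → Vec ℕ n → List (Fin n) → Vec ℕ n
incs = List.foldl (λ v j → inc j v)

incs-map-suc : ∀ {n} k (v : Vec ℕ n) js → incs (k ∷ v) (List.map suc js) ≡ k ∷ incs v js
incs-map-suc k v [] = ≡.refl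
incs-map-suc k v (j ∷ js) = incs-map-suc k (inc j v) js

incs-allFin : ∀ {n} (v : Vec ℕ n) → incs v (allFin n) ≡ Vec.map suc v
incs-allFin [] = ≡.refl
incs-allFin {suc n} (k ∷ v) = begin
  incs (k ∷ v) (allFin (suc n))              ≡⟨ ≡.cong (incs (k ∷ v)) (allFin-suc n) ⟩
  incs (suc k ∷ v) (List.map suc (allFin n)) ≡⟨ incs-map-suc (suc k) v (allFin n) ⟩
  suc k ∷ incs v (allFin n)                  ≡⟨ ≡.cong (suc k ∷_) (incs-allFin v) ⟩
  Vec.map suc (k ∷ v)                        ∎
  where open ≡.≡-Reasoning

incPair : ∀ {n} → Vec ℕ n → Pair n → Vec ℕ n
incPair b (i , j) = inc j (inc i b)

-- A bound for the exponents that the factors in the list can reach: x_j - x_i raises one of two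
-- exponents, and the bound raises both.
degrees : ∀ {n} → Vec ℕ n → List (Pair n) → Vec ℕ n
degrees = List.foldl incPair

degrees-++ : ∀ {n} (b : Vec ℕ n) L L′ → degrees b (L ++ L′) ≡ degrees (degrees b L) L′
degrees-++ b [] L′ = ≡.refl
degrees-++ b (p ∷ L) L′ = degrees-++ (incPair b p) L L′

degrees-row : ∀ {n} k (b : Vec ℕ n) js →
  degrees (k ∷ b) (List.map (λ j → zero , suc j) js) ≡ (List.length js ℕ.+ k) ∷ incs b js
degrees-row k b [] = ≡.refl
degrees-row k b (j ∷ js) = ≡.trans (degrees-row (suc k) (inc j b) js) (≡.cong (_∷ incs b (j ∷ js)) (ℕ.+-suc _ k))

degrees-both-suc : ∀ {n} k (b : Vec ℕ n) L → degrees (k ∷ b) (List.map (both suc) L) ≡ k ∷ degrees b L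
degrees-both-suc k b [] = ≡.refl
degrees-both-suc k b (p ∷ L) = degrees-both-suc k (incPair b p) L

-- Each index lies in n - 1 pairs. The start `s` is general because the row of the first index has
-- already raised the others by one.
degrees-upper : ∀ n s → degrees (Vec.replicate n s) (upper n) ≡ Vec.replicate n (ℕ.pred n ℕ.+ s)
degrees-upper zero s = ≡.refl
degrees-upper (suc n) s = begin
  degrees (s ∷ Vec.replicate n s) (firstRow n ++ List.map (both suc) (upper n))
    ≡⟨ degrees-++ (s ∷ Vec.replicate n s) (firstRow n) _ ⟩
  degrees (degrees (s ∷ Vec.replicate n s) (firstRow n)) (List.map (both suc) (upper n))
    ≡⟨ ≡.cong (λ b → degrees b (List.map (both suc) (upper n))) (≡.trans (degrees-row s _ (allFin n))
         (≡.cong₂ _∷_ (≡.cong (ℕ._+ s) (length-tabulate {n = n} id))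
           (≡.trans (incs-allFin (Vec.replicate n s)) (Vec.map-replicate suc s n)))) ⟩
  degrees ((n ℕ.+ s) ∷ Vec.replicate n (suc s)) (List.map (both suc) (upper n))
    ≡⟨ degrees-both-suc _ _ (upper n) ⟩
  (n ℕ.+ s) ∷ degrees (Vec.replicate n (suc s)) (upper n)
    ≡⟨ ≡.cong ((n ℕ.+ s) ∷_) (≡.trans (degrees-upper n (suc s)) (adjust n)) ⟩
  Vec.replicate (suc n) (n ℕ.+ s) ∎
  where
  open ≡.≡-Reasoning
  adjust : ∀ n → Vec.replicate n (ℕ.pred n ℕ.+ suc s) ≡ Vec.replicate n (n ℕ.+ s)
  adjust zero = ≡.refl
  adjust (suc n) = ≡.cong (Vec.replicate (suc n)) (ℕ.+-suc n s)

Below : ∀ {n} → Vec ℕ n → Vec ℕ n → Set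
Below = Pointwise ℕ._<_

below-inc : ∀ {n} (i : Fin n) {v b} → Below v b → Below v (inc i b)
below-inc zero (p ∷ ps) = ℕ.m<n⇒m<1+n p ∷ ps
below-inc (suc i) (p ∷ ps) = p ∷ below-inc i ps

inc-below-inc : ∀ {n} (i : Fin n) {v b} → Below v b → Below (inc i v) (inc i b)
inc-below-inc zero (p ∷ ps) = ℕ.s<s p ∷ ps
inc-below-inc (suc i) (p ∷ ps) = p ∷ inc-below-inc i ps

zeros-below-ones : ∀ n → Below (zeros {n}) (Vec.replicate n 1)
zeros-below-ones zero = []
zeros-below-ones (suc n) = ℕ.z<s ∷ zeros-below-ones n

-- Vandermonde products of shifts, their antisymmetry and their coefficients.

module Antisymmetry {c ℓ : Level} (R : CommutativeRing c ℓ) where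
  open CommutativeRing R hiding (zero)
  open Ops R
  open IntegerImage R
  open Moments R public
  open import Algebra.Properties.Ring ring
  open import Relation.Binary.Reasoning.Setoid setoid

  scaled : ∀ {n} → (Fin n → Carrier) → Pair n → Form n
  scaled a (i , j) = (a i , i) , (a j , j)

  monic : ∀ {n} → Pair n → Form n
  monic = scaled (λ _ → 1#)

  diff : ∀ {n} → List (Pair n) → Functional n → Functional n
  diff L = run (List.map monic L)

  diff-cong : ∀ {n} (L : List (Pair n)) {g g′} → g ≋ g′ → diff L g ≋ diff L g′
  diff-cong L = run-cong (List.map monic L)

  diff-∷ : ∀ {n} i j (L : List (Pair n)) g v → diff ((i , j) ∷ L) g v ≈ diff L g (inc j v) - diff L g (inc i v)
  diff-∷ i j L g v = +-cong (*-identityˡ _) (-‿cong (*-identityˡ _))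

  diff-++ : ∀ {n} (L L′ : List (Pair n)) g v → diff (L ++ L′) g v ≈ diff L (diff L′ g) v
  diff-++ L L′ g v = reflexive (≡.trans (≡.cong (λ l → run l g v) (map-++ monic L L′)) (run-++ (List.map monic L) _ g v))

  diff-↭ : ∀ {n} {L L′ : List (Pair n)} → L ↭ L′ → ∀ g → diff L g ≋ diff L′ g
  diff-↭ p = run-↭ (↭.map⁺ monic p)

  diff-0 : ∀ {n} (L : List (Pair n)) → diff L (λ _ → 0#) ≋ λ _ → 0#
  diff-0 [] v = refl
  diff-0 ((i , j) ∷ L) v = begin
    diff ((i , j) ∷ L) (λ _ → 0#) v                               ≈⟨ diff-∷ i j L _ v ⟩
    diff L (λ _ → 0#) (inc j v) - diff L (λ _ → 0#) (inc i v)     ≈⟨ +-cong (diff-0 L _) (-‿cong (diff-0 L _)) ⟩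
    0# - 0#                                                       ≈⟨ -‿inverseʳ 0# ⟩
    0#                                                            ∎

  diff-* : ∀ {n} (L : List (Pair n)) a g → diff L (λ u → a * g u) ≋ λ v → a * diff L g v
  diff-* [] a g v = refl
  diff-* ((i , j) ∷ L) a g v = begin
    diff ((i , j) ∷ L) (λ u → a * g u) v             ≈⟨ diff-∷ i j L _ v ⟩
    diff L (λ u → a * g u) (inc j v) - diff L (λ u → a * g u) (inc i v)
      ≈⟨ +-cong (diff-* L a g _) (-‿cong (diff-* L a g _)) ⟩
    a * diff L g (inc j v) - a * diff L g (inc i v)  ≈⟨ solve 3 (λ a x y → a :* x :- a :* y := a :* (x :- y)) refl _ _ _ ⟩
    a * (diff L g (inc j v) - diff L g (inc i v))    ≈⟨ *-congˡ (diff-∷ i j L g v) ⟨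
    a * diff ((i , j) ∷ L) g v                       ∎

  diff-+ : ∀ {n} (L : List (Pair n)) g g′ → diff L (λ u → g u + g′ u) ≋ λ v → diff L g v + diff L g′ v
  diff-+ [] g g′ v = refl
  diff-+ ((i , j) ∷ L) g g′ v = begin
    diff ((i , j) ∷ L) (λ u → g u + g′ u) v             ≈⟨ diff-∷ i j L _ v ⟩
    diff L (λ u → g u + g′ u) (inc j v) - diff L (λ u → g u + g′ u) (inc i v)
      ≈⟨ +-cong (diff-+ L g g′ _) (-‿cong (diff-+ L g g′ _)) ⟩
    (diff L g (inc j v) + diff L g′ (inc j v)) - (diff L g (inc i v) + diff L g′ (inc i v))
      ≈⟨ solve 4 (λ x x′ y y′ → (x :+ x′) :- (y :+ y′) := (x :- y) :+ (x′ :- y′)) refl _ _ _ _ ⟩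
    (diff L g (inc j v) - diff L g (inc i v)) + (diff L g′ (inc j v) - diff L g′ (inc i v))
      ≈⟨ +-cong (diff-∷ i j L g v) (diff-∷ i j L g′ v) ⟨
    diff ((i , j) ∷ L) g v + diff ((i , j) ∷ L) g′ v    ∎

  diff-∑ : ∀ {n} (L : List (Pair n)) {A : Set} (a : A → Carrier) (G : A → Functional n) xs →
    diff L (λ v → ∑ (List.map (λ x → a x * G x v) xs)) ≋ λ v → ∑ (List.map (λ x → a x * diff L (G x) v) xs)
  diff-∑ L a G [] = diff-0 L
  diff-∑ L a G (x ∷ xs) v = trans (diff-+ L _ _ v) (+-cong (diff-* L (a x) (G x) v) (diff-∑ L a G xs v))

  diff-both-suc : ∀ {n} (L : List (Pair n)) g k v → diff (List.map (both suc) L) g (k ∷ v) ≡ diff L (g ∘ (k ∷_)) v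
  diff-both-suc [] g k v = ≡.refl
  diff-both-suc ((i , j) ∷ L) g k v =
    ≡.cong₂ (λ x y → 1# * x - 1# * y) (diff-both-suc L g k _) (diff-both-suc L g k _)

  -- Serves for adding 1 to every exponent and for translating by a fixed vector.
  diff-translate : ∀ {n} (φ : Vec ℕ n → Vec ℕ n) → (∀ i v → inc i (φ v) ≡ φ (inc i v)) →
    ∀ L g v → diff L g (φ v) ≡ diff L (g ∘ φ) v
  diff-translate φ φ-inc [] g v = ≡.refl
  diff-translate φ φ-inc ((i , j) ∷ L) g v = ≡.cong₂ (λ x y → 1# * x - 1# * y)
    (≡.trans (≡.cong (diff L g) (φ-inc j v)) (diff-translate φ φ-inc L g (inc j v)))
    (≡.trans (≡.cong (diff L g) (φ-inc i v)) (diff-translate φ φ-inc L g (inc i v)))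

  diff-transpose : ∀ {n} (τ : Adjacent n) L g v →
    diff (List.map (both (transpose τ)) L) g (swapAt τ v) ≡ diff L (g ∘ swapAt τ) v
  diff-transpose τ [] g v = ≡.refl
  diff-transpose τ ((i , j) ∷ L) g v = ≡.cong₂ (λ x y → 1# * x - 1# * y)
    (≡.trans (≡.cong (diff L′ g) (inc-swapAt τ j v)) (diff-transpose τ L g (inc j v)))
    (≡.trans (≡.cong (diff L′ g) (inc-swapAt τ i v)) (diff-transpose τ L g (inc i v)))
    where L′ = List.map (both (transpose τ)) L

  -- Only exponents within the degree bound are ever read. This permits replacing a functional by a
  -- finite combination of `δ`s.
  diff-agree : ∀ {n} (L : List (Pair n)) {g g′ b} → (∀ v → Below v (degrees b L) → g v ≈ g′ v) →
    ∀ v → Below v b → diff L g v ≈ diff L g′ v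
  diff-agree [] e v lt = e v lt
  diff-agree ((i , j) ∷ L) {b = b} e v lt = +-cong
    (*-congˡ (diff-agree L e (inc j v) (inc-below-inc j (below-inc i lt))))
    (-‿cong (*-congˡ (diff-agree L e (inc i v) (below-inc j (inc-below-inc i lt)))))

  monomial : ∀ {n} → (Fin n → Carrier) → Functional n
  monomial a [] = 1#
  monomial a (k ∷ v) = pow (a zero) k * monomial (a ∘ suc) v

  monomial-inc : ∀ {n} (a : Fin n → Carrier) i v → monomial a (inc i v) ≈ a i * monomial a v
  monomial-inc a zero (k ∷ v) = *-assoc _ _ _
  monomial-inc a (suc i) (k ∷ v) = trans (*-congˡ (monomial-inc (a ∘ suc) i v))
    (solve 3 (λ x y z → x :* (y :* z) := y :* (x :* z)) refl _ _ _)

  monomial-zeros : ∀ {n} (a : Fin n → Carrier) → monomial a zeros ≈ 1#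
  monomial-zeros {zero} a = refl
  monomial-zeros {suc n} a = trans (*-identityˡ _) (monomial-zeros (a ∘ suc))

  -- Since a_i a^v is the weight at `inc i v`, the coefficients of the forms are absorbed by the
  -- weight a^v. A weighted Vandermonde product is thus a plain one applied to a weighted
  -- functional.
  monomial-scaled : ∀ {n} (a : Fin n → Carrier) L g v →
    monomial a v * run (List.map (scaled a) L) g v ≈ diff L (λ u → monomial a u * g u) v
  monomial-scaled a [] g v = refl
  monomial-scaled a ((i , j) ∷ L) g v = begin
    monomial a v * (a j * S (inc j v) - a i * S (inc i v))
      ≈⟨ solve 5 (λ m x y z w → m :* (x :* y :- z :* w) := (x :* m) :* y :- (z :* m) :* w) refl _ _ _ _ _ ⟩
    (a j * monomial a v) * S (inc j v) - (a i * monomial a v) * S (inc i v)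
      ≈⟨ +-cong (*-congʳ (monomial-inc a j v)) (-‿cong (*-congʳ (monomial-inc a i v))) ⟨
    monomial a (inc j v) * S (inc j v) - monomial a (inc i v) * S (inc i v)
      ≈⟨ +-cong (monomial-scaled a L g _) (-‿cong (monomial-scaled a L g _)) ⟩
    diff L g′ (inc j v) - diff L g′ (inc i v)
      ≈⟨ diff-∷ i j L g′ v ⟨
    diff ((i , j) ∷ L) g′ v ∎
    where
    S = run (List.map (scaled a) L) g
    g′ = λ u → monomial a u * g u

  Δ : ∀ {n} → Functional n → Functional n
  Δ {n} = diff (upper n)

  private
    module _ {n} (τ : Adjacent n) where
      rest = proj₁ (upper-transpose τ)

      Δ-split : ∀ g v → Δ g v ≈ diff rest g (inc (hi τ) v) - diff rest g (inc (lo τ) v)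
      Δ-split g v = trans (diff-↭ (proj₁ (proj₂ (upper-transpose τ))) g v) (diff-∷ (lo τ) (hi τ) rest g v)

      diff-rest : ∀ g v → diff rest g (swapAt τ v) ≈ diff rest (g ∘ swapAt τ) v
      diff-rest g v = trans (diff-↭ (↭.↭-sym (proj₂ (proj₂ (upper-transpose τ)))) g _)
        (reflexive (diff-transpose τ rest g v))

      inc-hi : ∀ v → inc (hi τ) (swapAt τ v) ≡ swapAt τ (inc (lo τ) v)
      inc-hi v = ≡.trans (≡.cong (λ i → inc i (swapAt τ v)) (≡.sym (transpose-lo τ))) (inc-swapAt τ (lo τ) v)

      inc-lo : ∀ v → inc (lo τ) (swapAt τ v) ≡ swapAt τ (inc (hi τ) v)
      inc-lo v = ≡.trans (≡.cong (λ i → inc i (swapAt τ v)) (≡.sym (transpose-hi τ))) (inc-swapAt τ (hi τ) v)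

  -- The transposition permutes all factors but E_hi - E_lo, which it reverses.
  Δ-swap : ∀ {n} (τ : Adjacent n) g v → Δ g (swapAt τ v) ≈ - Δ (g ∘ swapAt τ) v
  Δ-swap τ g v = begin
    Δ g (swapAt τ v)
      ≈⟨ Δ-split τ g _ ⟩
    D g (inc (hi τ) (swapAt τ v)) - D g (inc (lo τ) (swapAt τ v))
      ≡⟨ ≡.cong₂ (λ x y → D g x - D g y) (inc-hi τ v) (inc-lo τ v) ⟩
    D g (swapAt τ (inc (lo τ) v)) - D g (swapAt τ (inc (hi τ) v))
      ≈⟨ +-cong (diff-rest τ g _) (-‿cong (diff-rest τ g _)) ⟩
    D (g ∘ swapAt τ) (inc (lo τ) v) - D (g ∘ swapAt τ) (inc (hi τ) v)
      ≈⟨ solve 2 (λ x y → x :- y := :- (y :- x)) refl _ _ ⟩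
    - (D (g ∘ swapAt τ) (inc (hi τ) v) - D (g ∘ swapAt τ) (inc (lo τ) v))
      ≈⟨ -‿cong (Δ-split τ _ v) ⟨
    - Δ (g ∘ swapAt τ) v ∎
    where D = diff (rest τ)

  -- `Δ-swap` would give only 2 Δ g v = 0, and 2 may be a zero divisor. Instead the two terms of the
  -- factor E_hi - E_lo are shown to be equal.
  Δ-invariant : ∀ {n} (τ : Adjacent n) g v → g ∘ swapAt τ ≋ g → swapAt τ v ≡ v → Δ g v ≈ 0#
  Δ-invariant τ g v inv fixed = begin
    Δ g v                                      ≈⟨ Δ-split τ g v ⟩
    D g (inc (hi τ) v) - D g (inc (lo τ) v)    ≈⟨ +-congʳ same ⟩
    D g (inc (lo τ) v) - D g (inc (lo τ) v)    ≈⟨ -‿inverseʳ _ ⟩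
    0#                                         ∎
    where
    D = diff (rest τ)
    same : D g (inc (hi τ) v) ≈ D g (inc (lo τ) v)
    same = begin
      D g (inc (hi τ) v)               ≡⟨ ≡.cong (λ u → D g (inc (hi τ) u)) fixed ⟨
      D g (inc (hi τ) (swapAt τ v))    ≡⟨ ≡.cong (D g) (inc-hi τ v) ⟩
      D g (swapAt τ (inc (lo τ) v))    ≈⟨ diff-rest τ g _ ⟩
      D (g ∘ swapAt τ) (inc (lo τ) v)  ≈⟨ diff-cong (rest τ) inv _ ⟩
      D g (inc (lo τ) v)               ∎

  Δ^ : ∀ {n} → ℕ → Functional n → Functional n
  Δ^ zero g = g
  Δ^ (suc k) g = Δ (Δ^ k g)

  Δ^-cong : ∀ {n} k {g g′ : Functional n} → g ≋ g′ → Δ^ k g ≋ Δ^ k g′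
  Δ^-cong zero e = e
  Δ^-cong {n} (suc k) e = diff-cong (upper n) (Δ^-cong k e)

  Δ^-swap : ∀ {n} (τ : Adjacent n) k g → g ∘ swapAt τ ≋ g → ∀ v → Δ^ k g (swapAt τ v) ≈ sgn k * Δ^ k g v
  Δ^-swap τ zero g inv v = trans (inv v) (sym (*-identityˡ _))
  Δ^-swap {n} τ (suc k) g inv v = begin
    Δ (Δ^ k g) (swapAt τ v)          ≈⟨ Δ-swap τ (Δ^ k g) v ⟩
    - Δ (Δ^ k g ∘ swapAt τ) v        ≈⟨ -‿cong (diff-cong (upper n) (Δ^-swap τ k g inv) v) ⟩
    - Δ (λ u → sgn k * Δ^ k g u) v   ≈⟨ -‿cong (diff-* (upper n) (sgn k) (Δ^ k g) v) ⟩
    - (sgn k * Δ (Δ^ k g) v)         ≈⟨ -‿distribˡ-* _ _ ⟩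
    sgn (suc k) * Δ^ (suc k) g v     ∎

  δ : ∀ {n} → Vec ℕ n → Functional n
  δ w v with v ≟ᵛ w
  ... | yes _ = 1#
  ... | no _ = 0#

  δ-yes : ∀ {n} {v w : Vec ℕ n} → v ≡ w → δ w v ≡ 1#
  δ-yes {v = v} {w} e with v ≟ᵛ w
  ... | yes _ = ≡.refl
  ... | no ne = contradiction e ne

  δ-no : ∀ {n} {v w : Vec ℕ n} → v ≢ w → δ w v ≡ 0#
  δ-no {v = v} {w} ne with v ≟ᵛ w
  ... | yes e = contradiction e ne
  ... | no _ = ≡.refl

  δ-cong : ∀ {m n} {v w : Vec ℕ m} {v′ w′ : Vec ℕ n} → (v ≡ w → v′ ≡ w′) → (v′ ≡ w′ → v ≡ w) → δ w v ≡ δ w′ v′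
  δ-cong {v = v} {w} f f⁻¹ with v ≟ᵛ w
  ... | yes e = ≡.sym (δ-yes (f e))
  ... | no ne = ≡.sym (δ-no (ne ∘ f⁻¹))

  δ-swap : ∀ {n} (τ : Adjacent n) w v → δ (swapAt τ w) v ≡ δ w (swapAt τ v)
  δ-swap τ w v = δ-cong
    (λ e → ≡.trans (≡.cong (swapAt τ) e) (swapAt-involutive τ w))
    (λ e → ≡.trans (≡.sym (swapAt-involutive τ v)) (≡.cong (swapAt τ) e))

  -- The coefficient of x^w in the Vandermonde product.
  coefficient : ∀ {n} → Functional n
  coefficient w = Δ (δ w) zeros

  coefficient-swap : ∀ {n} (τ : Adjacent n) w → coefficient (swapAt τ w) ≈ - coefficient w
  coefficient-swap {n} τ w = begin
    Δ (δ (swapAt τ w)) zeros          ≈⟨ diff-cong (upper n) (λ v → reflexive (δ-swap τ w v)) zeros ⟩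
    Δ (δ w ∘ swapAt τ) zeros          ≈⟨ -‿involutive _ ⟨
    - - Δ (δ w ∘ swapAt τ) zeros      ≈⟨ -‿cong (Δ-swap τ (δ w) zeros) ⟨
    - Δ (δ w) (swapAt τ zeros)        ≡⟨ ≡.cong (λ z → - Δ (δ w) z) (swapAt-replicate τ 0) ⟩
    - Δ (δ w) zeros                   ∎

  coefficient-repeat : ∀ {n} (τ : Adjacent n) w → swapAt τ w ≡ w → coefficient w ≈ 0#
  coefficient-repeat τ w e = Δ-invariant τ (δ w) zeros
    (λ v → reflexive (≡.trans (≡.sym (δ-swap τ w v)) (≡.cong (λ u → δ u v) e)))
    (swapAt-replicate τ 0)

  -- Raising the first exponent leads to 0, so every factor E_j - E_0 of the row contributes its
  -- positive term E_j.
  diff-row : ∀ {n} (js : List (Fin n)) g → (∀ k v → g (suc k ∷ v) ≈ 0#) → ∀ v →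
    diff (List.map (λ j → zero , suc j) js) g (0 ∷ v) ≈ g (0 ∷ incs v js)
  diff-row [] g g0 v = refl
  diff-row (j ∷ js) g g0 v = begin
    diff (List.map (λ j → zero , suc j) (j ∷ js)) g (0 ∷ v)
      ≈⟨ diff-∷ zero (suc j) (List.map (λ j → zero , suc j) js) g (0 ∷ v) ⟩
    diff (List.map (λ j → zero , suc j) js) g (0 ∷ inc j v) - diff (List.map (λ j → zero , suc j) js) g (1 ∷ v)
      ≈⟨ +-cong (diff-row js g g0 (inc j v)) (-‿cong (vanish js 0 v)) ⟩
    g (0 ∷ incs (inc j v) js) - 0#  ≈⟨ +-congˡ -0#≈0# ⟩
    g (0 ∷ incs (inc j v) js) + 0#  ≈⟨ +-identityʳ _ ⟩
    g (0 ∷ incs (inc j v) js)       ∎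
    where
    vanish : ∀ js k v → diff (List.map (λ j → zero , suc j) js) g (suc k ∷ v) ≈ 0#
    vanish [] k v = g0 k v
    vanish (j ∷ js) k v = begin
      diff (List.map (λ j → zero , suc j) (j ∷ js)) g (suc k ∷ v)
        ≈⟨ diff-∷ zero (suc j) (List.map (λ j → zero , suc j) js) g (suc k ∷ v) ⟩
      _ - _   ≈⟨ +-cong (vanish js k (inc j v)) (-‿cong (vanish js (suc k) v)) ⟩
      0# - 0# ≈⟨ -‿inverseʳ 0# ⟩
      0#      ∎

  -- The exponent 0 of the first variable makes its row contribute the product of all other
  -- variables. Removing that product lowers the remaining exponents by one and leaves the staircase
  -- for n.
  coefficient-stair : ∀ n → coefficient (stair n) ≈ 1#
  coefficient-stair zero = refl
  coefficient-stair (suc n) = begin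
    Δ (δ w) zeros                                      ≈⟨ diff-++ (firstRow n) _ (δ w) zeros ⟩
    diff (firstRow n) K zeros                          ≈⟨ diff-row (allFin n) K K0 zeros ⟩
    K (0 ∷ incs zeros (allFin n))                      ≡⟨ diff-both-suc (upper n) (δ w) 0 _ ⟩
    Δ (δ w ∘ (0 ∷_)) (incs zeros (allFin n))           ≡⟨ ≡.cong (Δ (δ w ∘ (0 ∷_))) (incs-allFin zeros) ⟩
    Δ (δ w ∘ (0 ∷_)) (Vec.map suc zeros)               ≡⟨ diff-translate (Vec.map suc) inc-map-suc (upper n) (δ w ∘ (0 ∷_)) zeros ⟩
    Δ (δ w ∘ (0 ∷_) ∘ Vec.map suc) zeros
      ≈⟨ diff-cong (upper n) (λ v → reflexive (δ-cong {v = 0 ∷ Vec.map suc v} {w} {v} {stair n} (map-suc-injective ∘ Vec.∷-injectiveʳ) (≡.cong (λ u → 0 ∷ Vec.map suc u)))) zeros ⟩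
    Δ (δ (stair n)) zeros                              ≈⟨ coefficient-stair n ⟩
    1#                                                 ∎
    where
    w = stair (suc n)
    K = diff (List.map (both suc) (upper n)) (δ w)
    K0 : ∀ k v → K (suc k ∷ v) ≈ 0#
    K0 k v = begin
      K (suc k ∷ v)                    ≡⟨ diff-both-suc (upper n) (δ w) (suc k) v ⟩
      Δ (δ w ∘ (suc k ∷_)) v           ≈⟨ diff-cong (upper n) (λ u → reflexive (δ-no {v = suc k ∷ u} {w} λ ())) v ⟩
      Δ (λ _ → 0#) v                   ≈⟨ diff-0 (upper n) v ⟩
      0#                               ∎

-- Permutations as injective vectors: inverses and their number.

unique-sets-↭ : ∀ {A : Set} {xs ys : List A} → Unique xs → Unique ys →
  (∀ {x} → x ∈ xs → x ∈ ys) → (∀ {x} → x ∈ ys → x ∈ xs) → xs ↭ ys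
unique-sets-↭ xs! ys! f g = ∼bag⇒↭ (unique∧set⇒bag xs! ys! (mk⇔ f g))

unique-map-on : ∀ {A B : Set} {f : A → B} {xs} → Unique xs →
  (∀ {x y} → x ∈ xs → y ∈ xs → f x ≡ f y → x ≡ y) → Unique (List.map f xs)
unique-map-on [] inj = []
unique-map-on (x≢ ∷ xs!) inj =
  All.map⁺ (All.tabulate λ y∈ e → All.lookup x≢ y∈ (inj (here ≡.refl) (there y∈) e))
    ∷ unique-map-on xs! (λ p q → inj (there p) (there q))

LookupInjective : ∀ {A : Set} {k} → Vec A k → Set
LookupInjective v = ∀ i j → lookup v i ≡ lookup v j → i ≡ j

toList-lookup : ∀ {A : Set} {k} (v : Vec A k) → List.map (lookup v) (allFin k) ≡ toList v
toList-lookup [] = ≡.refl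
toList-lookup {k = suc k} (x ∷ v) = begin
  List.map (lookup (x ∷ v)) (allFin (suc k))              ≡⟨ ≡.cong (List.map (lookup (x ∷ v))) (allFin-suc k) ⟩
  x ∷ List.map (lookup (x ∷ v)) (List.map suc (allFin k)) ≡⟨ ≡.cong (x ∷_) (List.map-∘ (allFin k)) ⟨
  x ∷ List.map (lookup v) (allFin k)                      ≡⟨ ≡.cong (x ∷_) (toList-lookup v) ⟩
  x ∷ toList v                                            ∎
  where open ≡.≡-Reasoning

lookup-∈ : ∀ {A : Set} {k} (v : Vec A k) i → lookup v i ∈ toList v
lookup-∈ v i = ≡.subst (lookup v i ∈_) (toList-lookup v) (∈-map⁺ (lookup v) (∈-allFin i))

unique⇒injective : ∀ {A : Set} {k} (v : Vec A k) → Unique (toList v) → LookupInjective v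
unique⇒injective (x ∷ v) (x≢ ∷ v!) zero zero e = ≡.refl
unique⇒injective (x ∷ v) (x≢ ∷ v!) zero (suc j) e = contradiction e (All.lookup x≢ (lookup-∈ v j))
unique⇒injective (x ∷ v) (x≢ ∷ v!) (suc i) zero e = contradiction (≡.sym e) (All.lookup x≢ (lookup-∈ v i))
unique⇒injective (x ∷ v) (x≢ ∷ v!) (suc i) (suc j) e = ≡.cong suc (unique⇒injective v v! i j e)

injective⇒unique : ∀ {A : Set} {k} (v : Vec A k) → LookupInjective v → Unique (toList v)
injective⇒unique v inj = ≡.subst Unique (toList-lookup v) (Unique.map⁺ (inj _ _) (Unique.allFin⁺ _))

-- Pigeonhole: prepending a missed `i` would give an injection of n + 1 positions into n values.
covers : ∀ {n} (v : Vec (Fin n) n) → LookupInjective v → ∀ i → ∃[ j ] lookup v j ≡ i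
covers {n} v inj i with Fin.any? (λ j → lookup v j Fin.≟ i)
... | yes found = found
... | no missing = contradiction (Fin.injective⇒≤ (λ {j} {k} → inj′ j k)) (ℕ.<-irrefl ≡.refl)
  where
  inj′ : LookupInjective (i ∷ v)
  inj′ zero zero e = ≡.refl
  inj′ zero (suc j) e = contradiction (j , ≡.sym e) missing
  inj′ (suc j) zero e = contradiction (j , e) missing
  inj′ (suc j) (suc k) e = ≡.cong suc (inj j k e)

unique⇒↭allFin : ∀ {n} (v : Vec (Fin n) n) → Unique (toList v) → toList v ↭ allFin n
unique⇒↭allFin v v! = unique-sets-↭ v! (Unique.allFin⁺ _) (λ _ → ∈-allFin _)
  λ {i} _ → let j , e = covers v (unique⇒injective v v!) i in ≡.subst (_∈ toList v) e (lookup-∈ v j)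

position : ∀ {n} → Vec (Fin n) n → Fin n → Fin n
position v i with Fin.any? (λ j → lookup v j Fin.≟ i)
... | yes (j , _) = j
-- An arbitrary value; the case does not occur when `v` is injective.
... | no _ = i

lookup-position : ∀ {n} (v : Vec (Fin n) n) → LookupInjective v → ∀ i → lookup v (position v i) ≡ i
lookup-position v inj i with Fin.any? (λ j → lookup v j Fin.≟ i)
... | yes (j , e) = e
... | no missing = contradiction (covers v inj i) missing

inverse : ∀ {n} → Vec (Fin n) n → Vec (Fin n) n
inverse v = Vec.tabulate (position v)

lookup-inverse : ∀ {n} (v : Vec (Fin n) n) → LookupInjective v → ∀ i → lookup (inverse v) (lookup v i) ≡ i
lookup-inverse v inj i = ≡.trans (Vec.lookup∘tabulate (position v) _) (inj _ _ (lookup-position v inj (lookup v i)))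

inverse-injective : ∀ {n} (v : Vec (Fin n) n) → LookupInjective v → LookupInjective (inverse v)
inverse-injective v inj i j e = begin
  i                       ≡⟨ lookup-position v inj i ⟨
  lookup v (position v i) ≡⟨ ≡.cong (lookup v) e′ ⟩
  lookup v (position v j) ≡⟨ lookup-position v inj j ⟩
  j                       ∎
  where
  open ≡.≡-Reasoning
  e′ = ≡.trans (≡.sym (Vec.lookup∘tabulate (position v) i)) (≡.trans e (Vec.lookup∘tabulate (position v) j))

inverse-involutive : ∀ {n} (v : Vec (Fin n) n) → LookupInjective v → inverse (inverse v) ≡ v
inverse-involutive v inj = ≡.trans (Vec.tabulate-cong same) (Vec.tabulate∘lookup v)
  where
  same : ∀ i → position (inverse v) i ≡ lookup v i
  same i = inverse-injective v inj _ _
    (≡.trans (lookup-position (inverse v) (inverse-injective v inj) i) (≡.sym (lookup-inverse v inj i)))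

allVecs-complete : ∀ {n} k (v : Vec (Fin n) k) → v ∈ allVecs k
allVecs-complete zero [] = here ≡.refl
allVecs-complete {n} (suc k) (i ∷ v) =
  ∈-concatMap⁺ (λ u → List.map (λ j → j ∷ u) (allFin n))
    (Any.map (λ { ≡.refl → ∈-map⁺ (_∷ v) (∈-allFin i) }) (allVecs-complete k v))

allVecs-unique : ∀ n k → Unique (allVecs {n} k)
allVecs-unique n zero = [] ∷ []
allVecs-unique n (suc k) = Unique.concat⁺
  (All.map⁺ (All.universal (λ v → Unique.map⁺ Vec.∷-injectiveˡ (Unique.allFin⁺ n)) (allVecs k)))
  (AllPairs.map⁺ (AllPairs.map disjoint (allVecs-unique n k)))
  where
  disjoint : ∀ {v w : Vec (Fin n) k} → v ≢ w →
    ∀ {u} → ¬ (u ∈ List.map (_∷ v) (allFin n) × u ∈ List.map (_∷ w) (allFin n))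
  disjoint v≢w (p , q) with ∈-map⁻ _ p | ∈-map⁻ _ q
  ... | _ , _ , ≡.refl | _ , _ , e = v≢w (Vec.∷-injectiveʳ e)

unique? : ∀ {n k} → Decidable (λ (v : Vec (Fin n) k) → Unique (toList v))
unique? v = UniqueDec.unique? Fin._≟_ (toList v)

permutations-unique : ∀ n → Unique (permutations n)
permutations-unique n = Unique.filter⁺ unique? (allVecs-unique n n)

∈-permutations : ∀ {n} {v : Vec (Fin n) n} → LookupInjective v → v ∈ permutations n
∈-permutations {n} {v} inj = ∈-filter⁺ unique? (allVecs-complete n v) (injective⇒unique v inj)

permutations-injective : ∀ {n} {v : Vec (Fin n) n} → v ∈ permutations n → LookupInjective v
permutations-injective {n} {v} v∈ = unique⇒injective v (proj₂ (∈-filter⁻ unique? {xs = allVecs n} v∈))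

inverse-permutations : ∀ n → List.map inverse (permutations n) ↭ permutations n
inverse-permutations n = unique-sets-↭
  (unique-map-on (permutations-unique n) λ {v} {w} p q e → begin
    v                     ≡⟨ inverse-involutive v (permutations-injective p) ⟨
    inverse (inverse v)   ≡⟨ ≡.cong inverse e ⟩
    inverse (inverse w)   ≡⟨ inverse-involutive w (permutations-injective q) ⟩
    w                     ∎)
  (permutations-unique n)
  (λ p → let v , v∈ , e = ∈-map⁻ inverse p in
    ≡.subst (_∈ permutations n) (≡.sym e) (∈-permutations (inverse-injective v (permutations-injective v∈))))
  (λ {v} p → let inj = permutations-injective p in
    ≡.subst (_∈ List.map inverse (permutations n)) (inverse-involutive v inj)
      (∈-map⁺ inverse (∈-permutations (inverse-injective v inj))))
  where open ≡.≡-Reasoning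

extensions : ∀ {n k} (v : Vec (Fin n) k) → List (Vec (Fin n) (suc k))
extensions {n} v = filter unique? (List.map (_∷ v) (allFin n))

-- The admissible heads together with the entries of `v` list every element of `Fin n` exactly once.
length-extensions : ∀ {n k} (v : Vec (Fin n) k) → Unique (toList v) → List.length (extensions v) ≡ n ℕ.∸ k
length-extensions {n} {k} v v! = begin
  List.length (extensions v)                              ≡⟨ ℕ.m+n∸n≡m _ k ⟨
  List.length (extensions v) ℕ.+ k ℕ.∸ k                  ≡⟨ ≡.cong (ℕ._∸ k) total ⟩
  n ℕ.∸ k                                                 ∎
  where
  open ≡.≡-Reasoning
  member : ∀ {w} → w ∈ extensions v → ∃[ i ] w ≡ i ∷ v × All (i ≢_) (toList v)
  member w∈ with ∈-filter⁻ unique? {xs = List.map (_∷ v) (allFin n)} w∈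
  ... | w∈′ , w! with ∈-map⁻ (_∷ v) w∈′
  ... | i , _ , ≡.refl = i , ≡.refl , AllPairs.head w!
  heads = List.map Vec.head (extensions v)
  heads! : Unique heads
  heads! = unique-map-on (Unique.filter⁺ unique? (Unique.map⁺ Vec.∷-injectiveˡ (Unique.allFin⁺ n))) λ p q e →
    let i , e₁ , _ = member p
        j , e₂ , _ = member q
    in ≡.trans e₁ (≡.trans (≡.cong (_∷ v) (≡.trans (≡.sym (≡.cong Vec.head e₁)) (≡.trans e (≡.cong Vec.head e₂)))) (≡.sym e₂))
  cover : ∀ i → i ∈ heads ++ toList v
  cover i with Any.any? (i Fin.≟_) (toList v)
  ... | yes i∈ = ∈-++⁺ʳ heads i∈
  ... | no i∉ = ∈-++⁺ˡ (∈-map⁺ Vec.head (∈-filter⁺ unique? (∈-map⁺ (_∷ v) (∈-allFin i)) (All.¬Any⇒All¬ _ i∉ ∷ v!)))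
  all↭ : heads ++ toList v ↭ allFin n
  all↭ = unique-sets-↭ (Unique.++⁺ heads! v! disjoint) (Unique.allFin⁺ n) (λ _ → ∈-allFin _) (λ _ → cover _)
    where
    disjoint : ∀ {i} → ¬ (i ∈ heads × i ∈ toList v)
    disjoint (p , q) with ∈-map⁻ Vec.head p
    ... | w , w∈ , ≡.refl with member w∈
    ... | i , ≡.refl , i≢ = All.lookup i≢ q ≡.refl
  total : List.length (extensions v) ℕ.+ k ≡ n
  total = begin
    List.length (extensions v) ℕ.+ k                        ≡⟨ ≡.cong₂ ℕ._+_ (List.length-map Vec.head (extensions v)) (Vec.length-toList v) ⟨
    List.length heads ℕ.+ List.length (toList v)            ≡⟨ List.length-++ heads ⟨
    List.length (heads ++ toList v)                         ≡⟨ ↭.↭-length all↭ ⟩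
    List.length (allFin n)                                  ≡⟨ List.length-tabulate {n = n} id ⟩
    n                                                       ∎

no-extensions : ∀ {n k} (v : Vec (Fin n) k) → ¬ Unique (toList v) → extensions v ≡ []
no-extensions {n} v ¬v! = List.filter-none unique? (All.map⁺ (All.universal (λ i w! → ¬v! (AllPairs.tail w!)) (allFin n)))

-- An injective vector of length k has n - k injective extensions, any other vector has none.
length-injections : ∀ {n k} (vs : List (Vec (Fin n) k)) →
  List.length (filter unique? (List.concatMap (λ v → List.map (_∷ v) (allFin n)) vs))
    ≡ List.length (filter unique? vs) ℕ.* (n ℕ.∸ k)
length-injections [] = ≡.refl
length-injections {n} {k} (v ∷ vs) = begin
  List.length (filter unique? (List.map (_∷ v) (allFin n) ++ more))
    ≡⟨ ≡.cong List.length (List.filter-++ unique? (List.map (_∷ v) (allFin n)) more) ⟩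
  List.length (extensions v ++ filter unique? more)
    ≡⟨ List.length-++ (extensions v) ⟩
  List.length (extensions v) ℕ.+ List.length (filter unique? more)
    ≡⟨ ≡.cong (List.length (extensions v) ℕ.+_) (length-injections vs) ⟩
  List.length (extensions v) ℕ.+ List.length (filter unique? vs) ℕ.* (n ℕ.∸ k)
    ≡⟨ step (unique? v) ⟩
  List.length (filter unique? (v ∷ vs)) ℕ.* (n ℕ.∸ k) ∎
  where
  open ≡.≡-Reasoning
  more = List.concatMap (λ v → List.map (_∷ v) (allFin n)) vs
  rest = List.length (filter unique? vs) ℕ.* (n ℕ.∸ k)
  step : Dec (Unique (toList v)) →
    List.length (extensions v) ℕ.+ rest ≡ List.length (filter unique? (v ∷ vs)) ℕ.* (n ℕ.∸ k)
  step (yes v!) = ≡.trans (≡.cong (ℕ._+ rest) (length-extensions v v!))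
    (≡.cong (λ l → List.length l ℕ.* (n ℕ.∸ k)) (≡.sym (List.filter-accept unique? {xs = vs} v!)))
  step (no ¬v!) = ≡.trans (≡.cong (λ l → List.length l ℕ.+ rest) (no-extensions v ¬v!))
    (≡.cong (λ l → List.length l ℕ.* (n ℕ.∸ k)) (≡.sym (List.filter-reject unique? {xs = vs} ¬v!)))

length-permutations : ∀ n → List.length (permutations n) ≡ n !
length-permutations n = begin
  count n                        ≡⟨ ℕ.*-identityʳ _ ⟨
  count n ℕ.* 1                  ≡⟨ ≡.cong (λ d → count n ℕ.* d !) (ℕ.n∸n≡0 n) ⟨
  count n ℕ.* (n ℕ.∸ n) !        ≡⟨ remaining n ℕ.≤-refl ⟩
  n !                            ∎
  where
  open ≡.≡-Reasoning
  count : ℕ → ℕ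
  count k = List.length (filter unique? (allVecs {n} k))
  -- The product `count k` · (n - k)! does not depend on k; in this form no quotient n!/(n - k)! is
  -- needed.
  remaining : ∀ k → k ℕ.≤ n → count k ℕ.* (n ℕ.∸ k) ! ≡ n !
  remaining zero k≤n = ℕ.*-identityˡ _
  remaining (suc k) k<n = begin
    count (suc k) ℕ.* (n ℕ.∸ suc k) !                     ≡⟨ ≡.cong (ℕ._* (n ℕ.∸ suc k) !) (length-injections (allVecs {n} k)) ⟩
    count k ℕ.* (n ℕ.∸ k) ℕ.* (n ℕ.∸ suc k) !             ≡⟨ ℕ.*-assoc (count k) _ _ ⟩
    count k ℕ.* ((n ℕ.∸ k) ℕ.* (n ℕ.∸ suc k) !)           ≡⟨ ≡.cong (λ d → count k ℕ.* (d ℕ.* (n ℕ.∸ suc k) !)) (ℕ.+-∸-assoc 1 k<n) ⟩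
    count k ℕ.* (suc (n ℕ.∸ suc k)) !                     ≡⟨ ≡.cong (λ d → count k ℕ.* d !) (ℕ.+-∸-assoc 1 k<n) ⟨
    count k ℕ.* (n ℕ.∸ k) !                               ≡⟨ remaining k (ℕ.<⇒≤ k<n) ⟩
    n !                                                   ∎

-- Brings a repeated entry to the first two places, where the transposition `here` fixes the vector.
repeated : ∀ {n} (xs : List (Fin n)) → ¬ Unique xs → ∃₂ λ x ys → xs ↭ x ∷ x ∷ ys
repeated [] ¬! = contradiction [] ¬!
repeated (x ∷ xs) ¬! with Any.any? (x Fin.≟_) xs
... | yes x∈ with ∈-∃++ x∈
... | ys , zs , ≡.refl = x , ys ++ zs , ↭.prep x (↭.shift x ys zs)
repeated (x ∷ xs) ¬! | no x∉ with repeated xs (λ xs! → ¬! (All.¬Any⇒All¬ xs x∉ ∷ xs!))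
... | y , ys , p = y , x ∷ ys , ↭.trans (↭.prep x p) (↭.↭-sym (↭.shift x (y ∷ y ∷ []) ys))

vecOf : ∀ {A : Set} {n} (xs : List A) → List.length xs ≡ n → ∃[ v ] toList {n = n} v ≡ xs
vecOf xs ≡.refl = Vec.fromList xs , Vec.toList∘fromList xs

toℕ-injective : ∀ {n k} {v w : Vec (Fin n) k} → Vec.map toℕ v ≡ Vec.map toℕ w → v ≡ w
toℕ-injective {v = []} {[]} e = ≡.refl
toℕ-injective {v = i ∷ v} {j ∷ w} e =
  ≡.cong₂ _∷_ (Fin.toℕ-injective (Vec.∷-injectiveˡ e)) (toℕ-injective (Vec.∷-injectiveʳ e))

below⇒toℕ : ∀ {n k} (v : Vec ℕ k) → Below v (Vec.replicate k n) → ∃[ w ] v ≡ Vec.map (toℕ {n}) w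
below⇒toℕ [] [] = [] , ≡.refl
below⇒toℕ (x ∷ v) (p ∷ ps) with below⇒toℕ v ps
... | w , e = Fin.fromℕ< p ∷ w , ≡.cong₂ _∷_ (≡.sym (Fin.toℕ-fromℕ< p)) e

stair-toℕ : ∀ n → Vec.map toℕ (Vec.allFin n) ≡ stair n
stair-toℕ zero = ≡.refl
stair-toℕ (suc n) = ≡.cong (0 ∷_) (begin
  Vec.map toℕ (Vec.tabulate suc)             ≡⟨ Vec.tabulate-∘ toℕ suc ⟨
  Vec.tabulate (λ i → suc (toℕ i))           ≡⟨ Vec.tabulate-∘ suc toℕ ⟩
  Vec.map suc (Vec.tabulate toℕ)             ≡⟨ ≡.cong (Vec.map suc) (Vec.tabulate-∘ toℕ id) ⟩
  Vec.map suc (Vec.map toℕ (Vec.allFin n))   ≡⟨ ≡.cong (Vec.map suc) (stair-toℕ n) ⟩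
  Vec.map suc (stair n)                      ∎)
  where open ≡.≡-Reasoning

toList-allFin : ∀ n → toList (Vec.allFin n) ≡ allFin n
toList-allFin n = begin
  toList (Vec.allFin n)                        ≡⟨ toList-lookup (Vec.allFin n) ⟨
  List.map (lookup (Vec.allFin n)) (allFin n)  ≡⟨ List.map-cong Vec.lookup-allFin (allFin n) ⟩
  List.map id (allFin n)                       ≡⟨ List.map-id (allFin n) ⟩
  allFin n                                     ∎
  where open ≡.≡-Reasoning

-- A weighted Vandermonde product applied to an antisymmetric functional, and the permanent.

module Vandermonde {c ℓ : Level} (R : CommutativeRing c ℓ) where
  open CommutativeRing R hiding (zero)
  open Ops R
  open IntegerImage R
  open Antisymmetry R public
  open import Relation.Binary.Reasoning.Setoid setoid

  ∑-cong : ∀ {A : Set} {f g : A → Carrier} → (∀ x → f x ≈ g x) → ∀ xs → ∑ (List.map f xs) ≈ ∑ (List.map g xs)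
  ∑-cong e [] = refl
  ∑-cong e (x ∷ xs) = +-cong (e x) (∑-cong e xs)

  ∑-cong-∈ : ∀ {A : Set} {f g : A → Carrier} xs → (∀ {x} → x ∈ xs → f x ≈ g x) → ∑ (List.map f xs) ≈ ∑ (List.map g xs)
  ∑-cong-∈ [] e = refl
  ∑-cong-∈ (x ∷ xs) e = +-cong (e (here ≡.refl)) (∑-cong-∈ xs (e ∘ there))

  ∑-↭ : ∀ {xs ys} → xs ↭ ys → ∑ xs ≈ ∑ ys
  ∑-↭ ↭.refl = refl
  ∑-↭ (↭.prep x p) = +-congˡ (∑-↭ p)
  ∑-↭ (↭.swap x y p) = trans (solve 3 (λ a b c → a :+ (b :+ c) := b :+ (a :+ c)) refl _ _ _) (+-congˡ (+-congˡ (∑-↭ p)))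
  ∑-↭ (↭.trans p q) = trans (∑-↭ p) (∑-↭ q)

  ∑-*ʳ : ∀ {A : Set} (f : A → Carrier) a xs → ∑ (List.map (λ x → f x * a) xs) ≈ ∑ (List.map f xs) * a
  ∑-*ʳ f a [] = sym (zeroˡ a)
  ∑-*ʳ f a (x ∷ xs) = trans (+-congˡ (∑-*ʳ f a xs)) (sym (distribʳ _ _ _))

  ∑-one : ∀ {A : Set} {f : A → Carrier} → (∀ x → f x ≈ 1#) → ∀ xs → ∑ (List.map f xs) ≈ ι (List.length xs)
  ∑-one e [] = refl
  ∑-one e (x ∷ xs) = +-cong (e x) (∑-one e xs)

  ∑-filter : ∀ {A : Set} {p} {P : Pred A p} (P? : Decidable P) (f : A → Carrier) →
    (∀ x → ¬ P x → f x ≈ 0#) → ∀ xs → ∑ (List.map f xs) ≈ ∑ (List.map f (filter P? xs))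
  ∑-filter P? f f0 [] = refl
  ∑-filter P? f f0 (x ∷ xs) with P? x
  ... | yes _ = +-congˡ (∑-filter P? f f0 xs)
  ... | no ¬p = trans (+-cong (f0 x ¬p) (∑-filter P? f f0 xs)) (+-identityˡ _)

  ∑-single : ∀ {A : Set} {f : A → Carrier} {x xs} → Unique xs → x ∈ xs → (∀ {y} → y ≢ x → f y ≈ 0#) →
    ∑ (List.map f xs) ≈ f x
  ∑-single {f = f} {x} {_ ∷ xs} (x≢ ∷ xs!) (here ≡.refl) f0 = begin
    f x + ∑ (List.map f xs)  ≈⟨ +-congˡ (vanish x≢) ⟩
    f x + 0#                 ≈⟨ +-identityʳ _ ⟩
    f x                      ∎
    where
    vanish : ∀ {xs} → All (x ≢_) xs → ∑ (List.map f xs) ≈ 0#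
    vanish [] = refl
    vanish (ne ∷ nes) = trans (+-cong (f0 (ne ∘ ≡.sym)) (vanish nes)) (+-identityˡ _)
  ∑-single {f = f} {x} {y ∷ xs} (y≢ ∷ xs!) (there x∈) f0 = begin
    f y + ∑ (List.map f xs)  ≈⟨ +-cong (f0 (All.lookup y≢ x∈)) (∑-single xs! x∈ f0) ⟩
    0# + f x                 ≈⟨ +-identityˡ _ ⟩
    f x                      ∎

  ∏-↭ : ∀ {xs ys} → xs ↭ ys → ∏ xs ≈ ∏ ys
  ∏-↭ ↭.refl = refl
  ∏-↭ (↭.prep x p) = *-congˡ (∏-↭ p)
  ∏-↭ (↭.swap x y p) = trans (solve 3 (λ a b c → a :* (b :* c) := b :* (a :* c)) refl _ _ _) (*-congˡ (*-congˡ (∏-↭ p)))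
  ∏-↭ (↭.trans p q) = trans (∏-↭ p) (∏-↭ q)

  -- A permutation of lists is made of adjacent swaps behind a common prefix. The prefix is absorbed
  -- into `F`, which therefore varies in the induction.
  swap-invariant-↭ : ∀ {A : Set} {xs ys : List A} → xs ↭ ys → ∀ {n} (F : Vec A n → Carrier) →
    (∀ τ v → F (swapAt τ v) ≈ F v) → ∀ v w → toList v ≡ xs → toList w ≡ ys → F v ≈ F w
  swap-invariant-↭ ↭.refl F inv v w e e′ = reflexive (≡.cong F (≡.trans (≡.sym (Vec.cast-is-id ≡.refl v)) (Vec.toList-injective ≡.refl v w (≡.trans e (≡.sym e′)))))
  swap-invariant-↭ (↭.prep x p) F inv (_ ∷ v) (_ ∷ w) ≡.refl ≡.refl =
    swap-invariant-↭ p (F ∘ (x ∷_)) (λ τ u → inv (there τ) (x ∷ u)) v w ≡.refl ≡.refl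
  swap-invariant-↭ (↭.swap x y p) F inv (_ ∷ _ ∷ v) (_ ∷ _ ∷ w) ≡.refl ≡.refl = trans
    (sym (inv here (x ∷ y ∷ v)))
    (swap-invariant-↭ p (F ∘ (y ∷_) ∘ (x ∷_)) (λ τ u → inv (there (there τ)) (y ∷ x ∷ u)) v w ≡.refl ≡.refl)
  swap-invariant-↭ (↭.trans {ys = zs} p q) F inv v w e e′
    with vecOf zs (≡.trans (≡.sym (↭.↭-length p)) (≡.trans (≡.cong List.length (≡.sym e)) (Vec.length-toList v)))
  ... | u , eu = trans (swap-invariant-↭ p F inv v u e eu) (swap-invariant-↭ q F inv u w eu e′)

  module _ {n} (h : Functional n) (h-swap : ∀ τ v → h (swapAt τ v) ≈ - h v) where

    private
      ψ : Vec (Fin n) n → Carrier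
      ψ w = coefficient (Vec.map toℕ w) * h (Vec.map toℕ w)

      ψ-swap : ∀ τ w → ψ (swapAt τ w) ≈ ψ w
      ψ-swap τ w = begin
        coefficient (Vec.map toℕ (swapAt τ w)) * h (Vec.map toℕ (swapAt τ w))
          ≡⟨ ≡.cong (λ u → coefficient u * h u) (swapAt-map toℕ τ w) ⟨
        coefficient (swapAt τ w′) * h (swapAt τ w′)  ≈⟨ *-cong (coefficient-swap τ w′) (h-swap τ w′) ⟩
        - coefficient w′ * - h w′                    ≈⟨ solve 2 (λ x y → :- x :* :- y := x :* y) refl _ _ ⟩
        ψ w                                          ∎
        where w′ = Vec.map toℕ w

      ψ-unique : ∀ w → Unique (toList w) → ψ w ≈ h (stair n)
      ψ-unique w w! = begin
        ψ w                                    ≈⟨ swap-invariant-↭ (unique⇒↭allFin w w!) ψ ψ-swap w (Vec.allFin n) ≡.refl (toList-allFin n) ⟩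
        ψ (Vec.allFin n)                       ≡⟨ ≡.cong (λ u → coefficient u * h u) (stair-toℕ n) ⟩
        coefficient (stair n) * h (stair n)    ≈⟨ *-congʳ (coefficient-stair n) ⟩
        1# * h (stair n)                       ≈⟨ *-identityˡ _ ⟩
        h (stair n)                            ∎

      -- The antisymmetry of `h` yields only 2h = 0 at a repeated exponent; the vanishing comes from
      -- the Vandermonde coefficient.
      ψ-repeated : ∀ w → ¬ Unique (toList w) → ψ w ≈ 0#
      ψ-repeated w ¬w! with repeated (toList w) ¬w!
      ... | x , ys , p with vecOf (x ∷ x ∷ ys) (≡.trans (≡.sym (↭.↭-length p)) (Vec.length-toList w))
      ... | _ ∷ _ ∷ v , ≡.refl = begin
        ψ w                ≈⟨ swap-invariant-↭ p ψ ψ-swap w (x ∷ x ∷ v) ≡.refl ≡.refl ⟩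
        ψ (x ∷ x ∷ v)      ≈⟨ *-congʳ (coefficient-repeat here (Vec.map toℕ (x ∷ x ∷ v)) ≡.refl) ⟩
        0# * _             ≈⟨ zeroˡ _ ⟩
        0#                 ∎

    -- Only exponents below n occur in the Vandermonde product, and the
    -- product of two antisymmetric functionals is symmetric.
    vandermonde-antisymmetric : ∀ (a : Fin n → Carrier) →
      run (List.map (scaled a) (upper n)) h zeros
        ≈ ∑ (List.map (λ w → monomial a (Vec.map toℕ w)) (permutations n)) * h (stair n)
    vandermonde-antisymmetric a = begin
      run (List.map (scaled a) (upper n)) h zeros
        ≈⟨ *-identityˡ _ ⟨
      1# * run (List.map (scaled a) (upper n)) h zeros
        ≈⟨ *-congʳ (monomial-zeros a) ⟨
      monomial a zeros * run (List.map (scaled a) (upper n)) h zeros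
        ≈⟨ monomial-scaled a (upper n) h zeros ⟩
      Δ f zeros
        -- Below the degree bound, which is all that `Δ` reads at 0, `f` is a finite combination of
        -- `δ`s, and `Δ` turns each `δ` into a coefficient.
        ≈⟨ diff-agree (upper n) expand zeros (zeros-below-ones n) ⟩
      Δ (λ v → ∑ (List.map (λ w → f (Vec.map toℕ w) * δ (Vec.map toℕ w) v) (allVecs n))) zeros
        ≈⟨ diff-∑ (upper n) (f ∘ Vec.map toℕ) (δ ∘ Vec.map toℕ) (allVecs n) zeros ⟩
      ∑ (List.map (λ w → f (Vec.map toℕ w) * coefficient (Vec.map toℕ w)) (allVecs n))
        ≈⟨ ∑-cong (λ w → solve 3 (λ x y z → (x :* y) :* z := x :* (z :* y)) refl _ _ _) (allVecs n) ⟩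
      ∑ (List.map (λ w → monomial a (Vec.map toℕ w) * ψ w) (allVecs n))
        ≈⟨ ∑-filter unique? _ (λ w ¬w! → trans (*-congˡ (ψ-repeated w ¬w!)) (zeroʳ _)) (allVecs n) ⟩
      ∑ (List.map (λ w → monomial a (Vec.map toℕ w) * ψ w) (permutations n))
        ≈⟨ ∑-cong-∈ (permutations n) (λ {w} w∈ → *-congˡ (ψ-unique w (injective⇒unique w (permutations-injective w∈)))) ⟩
      ∑ (List.map (λ w → monomial a (Vec.map toℕ w) * h (stair n)) (permutations n))
        ≈⟨ ∑-*ʳ (λ w → monomial a (Vec.map toℕ w)) (h (stair n)) (permutations n) ⟩
      ∑ (List.map (λ w → monomial a (Vec.map toℕ w)) (permutations n)) * h (stair n) ∎
      where
      f : Functional n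
      f v = monomial a v * h v
      -- The exponent 0 has the strict bound 1, which n - 1 pairs raise to n.
      bound : ∀ n → degrees (Vec.replicate n 1) (upper n) ≡ Vec.replicate n n
      bound zero = ≡.refl
      bound (suc n) = ≡.trans (degrees-upper (suc n) 1) (≡.cong (Vec.replicate (suc n)) (ℕ.+-comm n 1))
      expand : ∀ v → Below v (degrees (Vec.replicate n 1) (upper n)) →
        f v ≈ ∑ (List.map (λ w → f (Vec.map toℕ w) * δ (Vec.map toℕ w) v) (allVecs n))
      expand v lt with below⇒toℕ v (≡.subst (Below v) (bound n) lt)
      ... | u , ≡.refl = sym (begin
        ∑ (List.map (λ w → f (Vec.map toℕ w) * δ (Vec.map toℕ w) v) (allVecs n))
          ≈⟨ ∑-single (allVecs-unique n n) (allVecs-complete n u)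
               (λ {w} ne → trans (*-congˡ (reflexive (δ-no {v = v} {Vec.map toℕ w} (λ e → ne (toℕ-injective (≡.sym e)))))) (zeroʳ _)) ⟩
        f v * δ v v    ≈⟨ *-congˡ (reflexive (δ-yes {v = v} {v} ≡.refl)) ⟩
        f v * 1#       ≈⟨ *-identityʳ _ ⟩
        f v            ∎)

  monomial-∏ : ∀ {n} (a : Fin n → Carrier) v → monomial a v ≈ ∏ (List.map (λ j → pow (a j) (lookup v j)) (allFin n))
  monomial-∏ a [] = refl
  monomial-∏ {suc n} a (k ∷ v) = begin
    pow (a zero) k * monomial (a ∘ suc) v
      ≈⟨ *-congˡ (monomial-∏ (a ∘ suc) v) ⟩
    pow (a zero) k * ∏ (List.map (λ j → pow (a (suc j)) (lookup v j)) (allFin n))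
      ≡⟨ ≡.cong (λ l → pow (a zero) k * ∏ l) (List.map-∘ (allFin n)) ⟩
    pow (a zero) k * ∏ (List.map (λ j → pow (a j) (lookup (k ∷ v) j)) (List.map suc (allFin n)))
      ≡⟨ ≡.cong (λ is → ∏ (List.map (λ j → pow (a j) (lookup (k ∷ v) j)) is)) (allFin-suc n) ⟨
    ∏ (List.map (λ j → pow (a j) (lookup (k ∷ v) j)) (allFin (suc n))) ∎

  -- On the left a_j has the exponent w(j), in the permanent a_σ(i) has the exponent i. The terms
  -- match for w = σ⁻¹, and inversion permutes the permutations.
  ∑-monomial≈per : ∀ {n} (a : Fin n → Carrier) →
    ∑ (List.map (λ w → monomial a (Vec.map toℕ w)) (permutations n)) ≈ per (λ i j → pow (a j) (toℕ i))
  ∑-monomial≈per {n} a = begin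
    ∑ (List.map (λ w → monomial a (Vec.map toℕ w)) (permutations n))
      ≈⟨ ∑-↭ (↭.map⁺ _ (inverse-permutations n)) ⟨
    ∑ (List.map (λ w → monomial a (Vec.map toℕ w)) (List.map inverse (permutations n)))
      ≡⟨ ≡.cong ∑ (List.map-∘ (permutations n)) ⟨
    ∑ (List.map (λ σ → monomial a (Vec.map toℕ (inverse σ))) (permutations n))
      ≈⟨ ∑-cong-∈ (permutations n) (λ {σ} σ∈ → reindex σ (permutations-injective σ∈)) ⟩
    per (λ i j → pow (a j) (toℕ i)) ∎
    where
    reindex : ∀ σ → LookupInjective σ →
      monomial a (Vec.map toℕ (inverse σ)) ≈ ∏ (List.map (λ i → pow (a (lookup σ i)) (toℕ i)) (allFin n))
    reindex σ inj = begin
      monomial a (Vec.map toℕ (inverse σ))                             ≈⟨ monomial-∏ a (Vec.map toℕ (inverse σ)) ⟩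
      ∏ (List.map G (allFin n))                                        ≈⟨ ∏-↭ (↭.map⁺ G (unique⇒↭allFin σ (injective⇒unique σ inj))) ⟨
      ∏ (List.map G (toList σ))                                        ≡⟨ ≡.cong (∏ ∘ List.map G) (toList-lookup σ) ⟨
      ∏ (List.map G (List.map (lookup σ) (allFin n)))                  ≡⟨ ≡.cong ∏ (List.map-∘ (allFin n)) ⟨
      ∏ (List.map (G ∘ lookup σ) (allFin n))                           ≡⟨ ≡.cong ∏ (List.map-cong (λ i → ≡.cong (pow (a (lookup σ i))) (back i)) (allFin n)) ⟩
      ∏ (List.map (λ i → pow (a (lookup σ i)) (toℕ i)) (allFin n))     ∎
      where
      G : Fin n → Carrier
      G j = pow (a j) (lookup (Vec.map toℕ (inverse σ)) j)
      back : ∀ i → lookup (Vec.map toℕ (inverse σ)) (lookup σ i) ≡ toℕ i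
      back i = ≡.trans (Vec.lookup-map (lookup σ i) toℕ (inverse σ)) (≡.cong toℕ (lookup-inverse σ inj i))

-- Regrouping of factors, staircases and signs.

module _ {a b} {A : Set a} {B : Set b} where

  concatMap-∷-↭ : ∀ (f : A → B) (g : A → List B) xs →
    concatMap (λ x → f x ∷ g x) xs ↭ List.map f xs ++ concatMap g xs
  concatMap-∷-↭ f g [] = ↭.refl
  concatMap-∷-↭ f g (x ∷ xs) = ↭.prep (f x) (begin
    g x ++ concatMap (λ x → f x ∷ g x) xs       ↭⟨ ↭.++⁺ˡ (g x) (concatMap-∷-↭ f g xs) ⟩
    g x ++ List.map f xs ++ concatMap g xs      ↭⟨ ↭.shifts (g x) (List.map f xs) ⟩
    List.map f xs ++ g x ++ concatMap g xs      ∎)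
    where open ↭.PermutationReasoning

  -- Turns the k-th power of each factor into k copies of the whole product, the form that `Δ^`
  -- iterates.
  concatMap-replicate-↭ : ∀ (f : A → B) k xs →
    concatMap (λ x → List.replicate k (f x)) xs ↭ List.concat (List.replicate k (List.map f xs))
  concatMap-replicate-↭ f zero [] = ↭.refl
  concatMap-replicate-↭ f zero (x ∷ xs) = concatMap-replicate-↭ f zero xs
  concatMap-replicate-↭ f (suc k) xs = ↭.trans (concatMap-∷-↭ f (λ x → List.replicate k (f x)) xs)
    (↭.++⁺ˡ (List.map f xs) (concatMap-replicate-↭ f k xs))

[1+n]C2 : ∀ n → suc n C 2 ≡ n ℕ.+ n C 2
[1+n]C2 n = ≡.trans (≡.sym (nCk+nC[k+1]≡[n+1]C[k+1] n 1)) (≡.cong (ℕ._+ n C 2) (nC1≡n n))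

stairDown : ∀ n → Vec ℕ n
stairDown zero = []
stairDown (suc n) = n ∷ stairDown n

stair-∷ʳ : ∀ n → stair (suc n) ≡ stair n ∷ʳ n
stair-∷ʳ zero = ≡.refl
stair-∷ʳ (suc n) = ≡.cong (0 ∷_) (≡.trans (≡.cong (Vec.map suc) (stair-∷ʳ n)) (Vec.map-∷ʳ suc n (stair n)))

infixl 6 _⊕_
_⊕_ : ∀ {n} → Vec ℕ n → Vec ℕ n → Vec ℕ n
_⊕_ = Vec.zipWith ℕ._+_

inc-⊕ : ∀ {n} d (i : Fin n) v → inc i (v ⊕ d) ≡ inc i v ⊕ d
inc-⊕ (e ∷ d) zero (k ∷ v) = ≡.refl
inc-⊕ (e ∷ d) (suc i) (k ∷ v) = ≡.cong (k ℕ.+ e ∷_) (inc-⊕ d i v)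

zeros-⊕ : ∀ {n} (d : Vec ℕ n) → zeros ⊕ d ≡ d
zeros-⊕ [] = ≡.refl
zeros-⊕ (e ∷ d) = ≡.cong (e ∷_) (zeros-⊕ d)

module Signs {c ℓ : Level} (R : CommutativeRing c ℓ) where
  open CommutativeRing R hiding (zero)
  open Ops R
  open IntegerImage R
  open import Algebra.Properties.Ring ring
  open import Relation.Binary.Reasoning.Setoid setoid

  sgn-+ : ∀ a b → sgn (a ℕ.+ b) ≈ sgn a * sgn b
  sgn-+ zero b = sym (*-identityˡ _)
  sgn-+ (suc a) b = trans (-‿cong (sgn-+ a b)) (-‿distribˡ-* _ _)

  sgn-square : ∀ a → sgn a * sgn a ≈ 1#
  sgn-square zero = *-identityˡ _
  sgn-square (suc a) = trans (solve 1 (λ x → :- x :* :- x := x :* x) refl _) (sgn-square a)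

  sgn-2* : ∀ a → sgn (2 ℕ.* a) ≈ 1#
  sgn-2* a = trans (sgn-+ a (a ℕ.+ 0)) (trans (*-congˡ (reflexive (≡.cong sgn (ℕ.+-identityʳ a)))) (sgn-square a))

  ∏-suc : ∀ (G : ℕ → Carrier) n →
    ∏ (List.map (G ∘ toℕ) (allFin (suc n))) ≡ G 0 * ∏ (List.map (G ∘ suc ∘ toℕ) (allFin n))
  ∏-suc G n = ≡.cong (λ l → G 0 * ∏ l)
    (≡.trans (≡.cong (List.map (G ∘ toℕ)) (≡.sym (List.map-tabulate {n = n} id suc))) (≡.sym (List.map-∘ (allFin n))))

  ∏-last : ∀ (G : ℕ → Carrier) n →
    ∏ (List.map (G ∘ toℕ) (allFin (suc n))) ≈ ∏ (List.map (G ∘ toℕ) (allFin n)) * G n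
  ∏-last G zero = *-comm _ _
  ∏-last G (suc n) = begin
    ∏ (List.map (G ∘ toℕ) (allFin (suc (suc n))))               ≡⟨ ∏-suc G (suc n) ⟩
    G 0 * ∏ (List.map (G ∘ suc ∘ toℕ) (allFin (suc n)))         ≈⟨ *-congˡ (∏-last (G ∘ suc) n) ⟩
    G 0 * (∏ (List.map (G ∘ suc ∘ toℕ) (allFin n)) * G (suc n)) ≈⟨ *-assoc _ _ _ ⟨
    G 0 * ∏ (List.map (G ∘ suc ∘ toℕ) (allFin n)) * G (suc n)   ≡⟨ ≡.cong (_* G (suc n)) (∏-suc G n) ⟨
    ∏ (List.map (G ∘ toℕ) (allFin (suc n))) * G (suc n)         ∎

  ff-cong : ∀ {x y} r → x ≈ y → ff x r ≈ ff y r
  ff-cong zero e = refl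
  ff-cong (suc r) e = *-cong (ff-cong r e) (+-congʳ e)

  ff-+ : ∀ x k j → ff x k * ff (x - ι k) j ≈ ff x (j ℕ.+ k)
  ff-+ x k zero = *-identityʳ _
  ff-+ x k (suc j) = begin
    ff x k * (ff (x - ι k) j * (x - ι k - ι j))
      ≈⟨ solve 5 (λ a b x k j → a :* (b :* (x :- k :- j)) := (a :* b) :* (x :- (j :+ k))) refl _ _ _ _ _ ⟩
    ff x k * ff (x - ι k) j * (x - (ι j + ι k))
      ≈⟨ *-cong (ff-+ x k j) (+-congˡ (-‿cong (sym (ι-+ j k)))) ⟩
    ff x (j ℕ.+ k) * (x - ι (j ℕ.+ k)) ∎

-- Both identities, reduced to the value of the even power of the Vandermonde product.

module Assembly {c ℓ : Level} (R : CommutativeRing c ℓ) where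
  open CommutativeRing R hiding (zero)
  open Ops R
  open IntegerImage R
  open Vandermonde R
  open Signs R
  open import Algebra.Properties.Ring ring
  open import Relation.Binary.Reasoning.Setoid setoid

  act-difference : ∀ n (p : Pair n) g → act n (subP n (varP n (proj₂ p)) (varP n (proj₁ p))) g ≋ shift (monic p) g
  act-difference n (i , j) g v = trans (act-subP n (varP n j) (varP n i) g v)
    (+-cong (trans (act-varP n j g v) (sym (*-identityˡ _)))
            (-‿cong (trans (act-varP n i g v) (sym (*-identityˡ _)))))

  act-scaled : ∀ n (a : Fin n → Carrier) (p : Pair n) g →
    act n (subP n (mulP n (constP n (a (proj₂ p))) (varP n (proj₂ p)))
                  (mulP n (constP n (a (proj₁ p))) (varP n (proj₁ p)))) g ≋ shift (scaled a p) g
  act-scaled n a (i , j) g v = trans (act-subP n _ _ g v) (+-cong (term j) (-‿cong (term i)))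
    where
    term : ∀ i → act n (mulP n (constP n (a i)) (varP n i)) g v ≈ a i * g (inc i v)
    term i = begin
      act n (mulP n (constP n (a i)) (varP n i)) g v   ≈⟨ act-mulP n (constP n (a i)) (varP n i) g v ⟩
      act n (constP n (a i)) (act n (varP n i) g) v    ≈⟨ act-constP n (a i) _ v ⟩
      a i * act n (varP n i) g v                       ≈⟨ *-congˡ (act-varP n i g v) ⟩
      a i * g (inc i v)                                ∎

  act-1 : ∀ n g → act n (constP n 1#) g ≋ g
  act-1 n g v = trans (act-constP n 1# g v) (*-identityˡ _)

  act-powP : ∀ n P (l : Form n) → (∀ g → act n P g ≋ shift l g) →
    ∀ k g → act n (powP n P k) g ≋ run (List.replicate k l) g
  act-powP n P l e zero g = act-1 n g
  act-powP n P l e (suc k) g v = begin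
    act n (mulP n P (powP n P k)) g v           ≈⟨ act-mulP n P (powP n P k) g v ⟩
    act n P (act n (powP n P k) g) v            ≈⟨ e _ v ⟩
    shift l (act n (powP n P k) g) v            ≈⟨ shift-cong l (act-powP n P l e k g) v ⟩
    shift l (run (List.replicate k l) g) v      ∎

  act-prodP : ∀ n (P : Pair n → Poly n) (F : Pair n → List (Form n)) → (∀ p g → act n (P p) g ≋ run (F p) g) →
    ∀ L g → act n (prodP n (List.map P L)) g ≋ run (concatMap F L) g
  act-prodP n P F e [] g = act-1 n g
  act-prodP n P F e (p ∷ L) g v = begin
    act n (mulP n (P p) (prodP n (List.map P L))) g v    ≈⟨ act-mulP n (P p) _ g v ⟩
    act n (P p) (act n (prodP n (List.map P L)) g) v     ≈⟨ e p _ v ⟩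
    run (F p) (act n (prodP n (List.map P L)) g) v       ≈⟨ run-cong (F p) (act-prodP n P F e L g) v ⟩
    run (F p) (run (concatMap F L) g) v                  ≡⟨ run-++ (F p) (concatMap F L) g v ⟨
    run (F p ++ concatMap F L) g v                       ∎

  run-powers : ∀ {n} k g → run (concatMap (λ p → List.replicate k (monic p)) (upper n)) g ≋ Δ^ k g
  run-powers {n} k g v = trans (run-↭ (concatMap-replicate-↭ monic k (upper n)) g v) (blocks k v)
    where
    blocks : ∀ k v → run (List.concat (List.replicate k (List.map monic (upper n)))) g v ≈ Δ^ k g v
    blocks zero v = refl
    blocks (suc k) v = trans (reflexive (run-++ (List.map monic (upper n)) _ g v)) (diff-cong (upper n) (blocks k) v)

  star-Qpoly : ∀ m n t → star n (Qpoly m n) t ≈ Δ^ (2 ℕ.* m ℕ.∸ 1) (ffs t) zeros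
  star-Qpoly m n t = begin
    star n (Qpoly m n) t                             ≈⟨ star≈act n (Qpoly m n) t ⟩
    act n (Qpoly m n) (ffs t) zeros
      ≈⟨ act-prodP n _ _ (λ p → act-powP n _ (monic p) (act-difference n p) k) (pairs n) (ffs t) zeros ⟩
    run (concatMap F (pairs n)) (ffs t) zeros        ≡⟨ ≡.cong (λ L → run (concatMap F L) (ffs t) zeros) (pairs≡upper R n) ⟩
    run (concatMap F (upper n)) (ffs t) zeros        ≈⟨ run-powers k (ffs t) zeros ⟩
    Δ^ k (ffs t) zeros                               ∎
    where
    k = 2 ℕ.* m ℕ.∸ 1
    F : Pair n → List (Form n)
    F p = List.replicate k (monic p)

  star-Rpoly : ∀ m n a t →
    star n (Rpoly m n a) t ≈ run (List.map (scaled a) (upper n)) (Δ^ (2 ℕ.* m ℕ.∸ 1) (ffs t)) zeros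
  star-Rpoly m n a t = begin
    star n (Rpoly m n a) t                                            ≈⟨ star≈act n (Rpoly m n a) t ⟩
    act n (Rpoly m n a) (ffs t) zeros
      ≈⟨ act-prodP n _ (λ p → scaled a p ∷ F p) factor (pairs n) (ffs t) zeros ⟩
    run (concatMap (λ p → scaled a p ∷ F p) (pairs n)) (ffs t) zeros
      ≡⟨ ≡.cong (λ L → run (concatMap (λ p → scaled a p ∷ F p) L) (ffs t) zeros) (pairs≡upper R n) ⟩
    run (concatMap (λ p → scaled a p ∷ F p) (upper n)) (ffs t) zeros
      ≈⟨ run-↭ (concatMap-∷-↭ (scaled a) F (upper n)) (ffs t) zeros ⟩
    run (List.map (scaled a) (upper n) ++ concatMap F (upper n)) (ffs t) zeros
      ≡⟨ run-++ (List.map (scaled a) (upper n)) _ (ffs t) zeros ⟩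
    run (List.map (scaled a) (upper n)) (run (concatMap F (upper n)) (ffs t)) zeros
      ≈⟨ run-cong (List.map (scaled a) (upper n)) (run-powers k (ffs t)) zeros ⟩
    run (List.map (scaled a) (upper n)) (Δ^ k (ffs t)) zeros          ∎
    where
    k = 2 ℕ.* m ℕ.∸ 1
    F : Pair n → List (Form n)
    F p = List.replicate k (monic p)
    factor : ∀ p g → act n (mulP n (subP n (mulP n (constP n (a (proj₂ p))) (varP n (proj₂ p)))
                                           (mulP n (constP n (a (proj₁ p))) (varP n (proj₁ p))))
                                   (powP n (subP n (varP n (proj₂ p)) (varP n (proj₁ p))) k)) g
                     ≋ run (scaled a p ∷ F p) g
    factor p g v = begin
      _ ≈⟨ act-mulP n _ _ g v ⟩
      _ ≈⟨ act-scaled n a p _ v ⟩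
      shift (scaled a p) (act n (powP n (subP n (varP n (proj₂ p)) (varP n (proj₁ p))) k) g) v
        ≈⟨ shift-cong (scaled a p) (act-powP n _ (monic p) (act-difference n p) k g) v ⟩
      run (scaled a p ∷ F p) g v ∎

  ffs-cong : ∀ {n} {t t′ : Fin n → Carrier} → (∀ i → t i ≈ t′ i) → ffs t ≋ ffs t′
  ffs-cong e [] = refl
  ffs-cong e (k ∷ v) = *-cong (ff-cong k (e zero)) (ffs-cong (e ∘ suc) v)

  ffs-swap : ∀ {n} (τ : Adjacent n) x v → ffs {n} (λ _ → x) (swapAt τ v) ≈ ffs (λ _ → x) v
  ffs-swap here x (k ∷ l ∷ v) = solve 3 (λ a b c → a :* (b :* c) := b :* (a :* c)) refl _ _ _
  ffs-swap (there τ) x (k ∷ v) = *-congˡ (ffs-swap τ x v)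

  -- (x)ₖ (x − k)ⱼ = (x)ₖ₊ⱼ in each variable, with k running down the staircase.
  ffs-staircase : ∀ n x v →
    ∏ (List.map (λ r → ff x (toℕ r)) (allFin n)) * ffs {n} (λ i → x - ι (n ℕ.∸ 1 ℕ.∸ toℕ i)) v
      ≈ ffs {n} (λ _ → x) (v ⊕ stairDown n)
  ffs-staircase zero x [] = *-identityˡ _
  ffs-staircase (suc n) x (k ∷ v) = begin
    ∏ (List.map (λ r → ff x (toℕ r)) (allFin (suc n))) * (ff (x - ι n) k * ffs (λ i → x - ι (n ℕ.∸ suc (toℕ i))) v)
      ≈⟨ *-cong (∏-last (ff x) n) (*-congˡ (ffs-cong (λ i → reflexive (≡.cong (λ d → x - ι d) (≡.sym (ℕ.∸-+-assoc n 1 (toℕ i))))) v)) ⟩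
    (P * ff x n) * (ff (x - ι n) k * S)
      ≈⟨ solve 4 (λ p a b s → (p :* a) :* (b :* s) := (a :* b) :* (p :* s)) refl _ _ _ _ ⟩
    (ff x n * ff (x - ι n) k) * (P * S)
      ≈⟨ *-cong (ff-+ x n k) (ffs-staircase n x v) ⟩
    ffs {suc n} (λ _ → x) ((k ∷ v) ⊕ stairDown (suc n)) ∎
    where
    P = ∏ (List.map (λ r → ff x (toℕ r)) (allFin n))
    S = ffs {n} (λ i → x - ι (n ℕ.∸ 1 ℕ.∸ toℕ i)) v

  -- One sign for each of the n entries that `x` passes.
  move-last : ∀ {n} (h : Functional (suc n)) → (∀ τ v → h (swapAt τ v) ≈ - h v) →
    ∀ x v → h (x ∷ v) ≈ sgn n * h (v ∷ʳ x)
  move-last h h-swap x [] = sym (*-identityˡ _)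
  move-last {suc n} h h-swap x (y ∷ v) = begin
    h (x ∷ y ∷ v)                      ≈⟨ h-swap here (y ∷ x ∷ v) ⟩
    - h (y ∷ x ∷ v)                    ≈⟨ -‿cong (move-last (h ∘ (y ∷_)) (λ τ u → h-swap (there τ) (y ∷ u)) x v) ⟩
    - (sgn n * h (y ∷ (v ∷ʳ x)))       ≈⟨ -‿distribˡ-* _ _ ⟩
    sgn (suc n) * h (y ∷ (v ∷ʳ x))     ∎

  -- Reversing the tail costs C(n,2) swaps and moving the head n to the end costs n more, together
  -- C(n+1,2).
  stairDown-sign : ∀ n (h : Functional n) → (∀ τ v → h (swapAt τ v) ≈ - h v) →
    h (stairDown n) ≈ sgn (n C 2) * h (stair n)
  stairDown-sign zero h h-swap = sym (*-identityˡ _)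
  stairDown-sign (suc n) h h-swap = begin
    h (n ∷ stairDown n)
      ≈⟨ stairDown-sign n (h ∘ (n ∷_)) (λ τ u → h-swap (there τ) (n ∷ u)) ⟩
    sgn (n C 2) * h (n ∷ stair n)
      ≈⟨ *-congˡ (move-last h h-swap n (stair n)) ⟩
    sgn (n C 2) * (sgn n * h (stair n ∷ʳ n))
      ≈⟨ solve 3 (λ a b c → a :* (b :* c) := (b :* a) :* c) refl _ _ _ ⟩
    (sgn n * sgn (n C 2)) * h (stair n ∷ʳ n)
      ≈⟨ *-congʳ (sgn-+ n (n C 2)) ⟨
    sgn (n ℕ.+ n C 2) * h (stair n ∷ʳ n)
      ≡⟨ ≡.cong₂ (λ k u → sgn k * h u) ([1+n]C2 n) (stair-∷ʳ n) ⟨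
    sgn (suc n C 2) * h (stair (suc n)) ∎

  Δ^-translate : ∀ {n} k (g : Functional n) d v → Δ^ k (λ u → g (u ⊕ d)) v ≈ Δ^ k g (v ⊕ d)
  Δ^-translate zero g d v = refl
  Δ^-translate {n} (suc k) g d v = begin
    Δ (Δ^ k (λ u → g (u ⊕ d))) v     ≈⟨ diff-cong (upper n) (Δ^-translate k g d) v ⟩
    Δ (λ u → Δ^ k g (u ⊕ d)) v       ≡⟨ diff-translate (_⊕ d) (inc-⊕ d) (upper n) (Δ^ k g) v ⟨
    Δ (Δ^ k g) (v ⊕ d)               ∎

  Δ^-* : ∀ {n} k a (g : Functional n) → Δ^ k (λ u → a * g u) ≋ λ v → a * Δ^ k g v
  Δ^-* zero a g v = refl
  Δ^-* {n} (suc k) a g v = trans (diff-cong (upper n) (Δ^-* k a g) v) (diff-* (upper n) a (Δ^ k g) v)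

  pow-1 : ∀ k → pow 1# k ≈ 1#
  pow-1 zero = refl
  pow-1 (suc k) = trans (*-identityˡ _) (pow-1 k)

  monomial-1 : ∀ {n} (v : Vec ℕ n) → monomial (λ _ → 1#) v ≈ 1#
  monomial-1 [] = refl
  monomial-1 (k ∷ v) = trans (*-cong (pow-1 k) (monomial-1 v)) (*-identityˡ _)

  falling∏ : ℕ → ℕ → Carrier → Carrier
  falling∏ m n x = ∏ (List.map (λ r → ff x (toℕ r ℕ.* m)) (allFin n))

  -- The value of V enters as the hypothesis `core`, because its proof works over ℤ and uses the
  -- present module there.
  module _ (m n : ℕ) (1≤m : 1 ℕ.≤ m) (x : Carrier)
    (core : ι ((m !) ℕ.^ n) * Δ^ {n} (2 ℕ.* m) (ffs (λ _ → x)) zeros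
              ≈ sgn (m ℕ.* (n C 2)) * ι (numConst m n) * falling∏ m n x) where

    private
      k = 2 ℕ.* m ℕ.∸ 1

      2m≡1+k : 2 ℕ.* m ≡ suc k
      2m≡1+k = ≡.sym (ℕ.m+[n∸m]≡n (ℕ.≤-trans 1≤m (ℕ.m≤m+n m _)))

      sgn-k : sgn k ≈ - 1#
      sgn-k = begin
        sgn k        ≈⟨ -‿involutive _ ⟨
        - sgn (suc k) ≡⟨ ≡.cong (λ d → - sgn d) 2m≡1+k ⟨
        - sgn (2 ℕ.* m) ≈⟨ -‿cong (sgn-2* m) ⟩
        - 1#         ∎

      h : Functional n
      h = Δ^ k (ffs (λ _ → x))

      h-swap : ∀ τ v → h (swapAt τ v) ≈ - h v
      h-swap τ v = begin
        h (swapAt τ v)   ≈⟨ Δ^-swap τ k (ffs (λ _ → x)) (ffs-swap τ x) v ⟩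
        sgn k * h v      ≈⟨ *-congʳ sgn-k ⟩
        - 1# * h v       ≈⟨ -1*x≈-x _ ⟩
        - h v            ∎

      square : Δ^ {n} (2 ℕ.* m) (ffs (λ _ → x)) zeros ≈ ι (n !) * h (stair n)
      square = begin
        Δ^ {n} (2 ℕ.* m) (ffs (λ _ → x)) zeros  ≡⟨ ≡.cong (λ d → Δ^ {n} d (ffs (λ _ → x)) zeros) 2m≡1+k ⟩
        Δ h zeros                               ≈⟨ vandermonde-antisymmetric h h-swap (λ _ → 1#) ⟩
        ∑ (List.map (λ w → monomial (λ _ → 1#) (Vec.map toℕ w)) (permutations n)) * h (stair n)
          ≈⟨ *-congʳ (trans (∑-one (λ w → monomial-1 (Vec.map toℕ w)) (permutations n)) (reflexive (≡.cong ι (length-permutations n)))) ⟩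
        ι (n !) * h (stair n) ∎

      core′ : ι (denConst m n) * h (stair n) ≈ sgn (m ℕ.* (n C 2)) * ι (numConst m n) * falling∏ m n x
      core′ = begin
        ι (denConst m n) * h (stair n)                     ≈⟨ *-congʳ (ι-* ((m !) ℕ.^ n) (n !)) ⟩
        ι ((m !) ℕ.^ n) * ι (n !) * h (stair n)            ≈⟨ *-assoc _ _ _ ⟩
        ι ((m !) ℕ.^ n) * (ι (n !) * h (stair n))          ≈⟨ *-congˡ square ⟨
        ι ((m !) ℕ.^ n) * Δ^ {n} (2 ℕ.* m) (ffs (λ _ → x)) zeros ≈⟨ core ⟩
        sgn (m ℕ.* (n C 2)) * ι (numConst m n) * falling∏ m n x ∎

      sgn-m : sgn (n C 2) * sgn (m ℕ.* (n C 2)) ≈ sgn ((m ℕ.∸ 1) ℕ.* (n C 2))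
      sgn-m = begin
        sgn (n C 2) * sgn (m ℕ.* (n C 2))
          ≡⟨ ≡.cong (λ d → sgn (n C 2) * sgn (d ℕ.* (n C 2))) (ℕ.m+[n∸m]≡n 1≤m) ⟨
        sgn (n C 2) * sgn (n C 2 ℕ.+ (m ℕ.∸ 1) ℕ.* (n C 2))
          ≈⟨ *-congˡ (sgn-+ (n C 2) _) ⟩
        sgn (n C 2) * (sgn (n C 2) * sgn ((m ℕ.∸ 1) ℕ.* (n C 2)))
          ≈⟨ *-assoc _ _ _ ⟨
        sgn (n C 2) * sgn (n C 2) * sgn ((m ℕ.∸ 1) ℕ.* (n C 2))
          ≈⟨ *-congʳ (sgn-square (n C 2)) ⟩
        1# * sgn ((m ℕ.∸ 1) ℕ.* (n C 2))
          ≈⟨ *-identityˡ _ ⟩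
        sgn ((m ℕ.∸ 1) ℕ.* (n C 2)) ∎

    Q-identity :
      ι (denConst m n) * ∏ (List.map (λ r → ff x (toℕ r)) (allFin n))
        * star n (Qpoly m n) (λ i → x - ι (n ℕ.∸ 1 ℕ.∸ toℕ i))
      ≈ sgn ((m ℕ.∸ 1) ℕ.* (n C 2)) * ι (numConst m n) * falling∏ m n x
    Q-identity = begin
      ι (denConst m n) * P * star n (Qpoly m n) t
        ≈⟨ *-assoc _ _ _ ⟩
      ι (denConst m n) * (P * star n (Qpoly m n) t)
        ≈⟨ *-congˡ staircase ⟩
      ι (denConst m n) * (sgn (n C 2) * h (stair n))
        ≈⟨ solve 3 (λ a b c → a :* (b :* c) := b :* (a :* c)) refl _ _ _ ⟩
      sgn (n C 2) * (ι (denConst m n) * h (stair n))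
        ≈⟨ *-congˡ core′ ⟩
      sgn (n C 2) * (sgn (m ℕ.* (n C 2)) * ι (numConst m n) * falling∏ m n x)
        ≈⟨ solve 4 (λ a b c d → a :* (b :* c :* d) := (a :* b) :* c :* d) refl _ _ _ _ ⟩
      sgn (n C 2) * sgn (m ℕ.* (n C 2)) * ι (numConst m n) * falling∏ m n x
        ≈⟨ *-congʳ (*-congʳ sgn-m) ⟩
      sgn ((m ℕ.∸ 1) ℕ.* (n C 2)) * ι (numConst m n) * falling∏ m n x ∎
      where
      P = ∏ (List.map (λ r → ff x (toℕ r)) (allFin n))
      t : Fin n → Carrier
      t i = x - ι (n ℕ.∸ 1 ℕ.∸ toℕ i)
      -- Multiplication by (x)_0 ⋯ (x)_{n-1} trades the distinct arguments for a translation of the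
      -- exponents by `stairDown`. What remains is the functional with equal arguments, to which
      -- antisymmetry applies.
      staircase : P * star n (Qpoly m n) t ≈ sgn (n C 2) * h (stair n)
      staircase = begin
        P * star n (Qpoly m n) t                                 ≈⟨ *-congˡ (star-Qpoly m n t) ⟩
        P * Δ^ k (ffs t) zeros                                   ≈⟨ Δ^-* k P (ffs t) zeros ⟨
        Δ^ k (λ v → P * ffs t v) zeros                           ≈⟨ Δ^-cong k (ffs-staircase n x) zeros ⟩
        Δ^ k (λ v → ffs (λ _ → x) (v ⊕ stairDown n)) zeros       ≈⟨ Δ^-translate k (ffs (λ _ → x)) (stairDown n) zeros ⟩
        h (zeros ⊕ stairDown n)                                  ≡⟨ ≡.cong h (zeros-⊕ (stairDown n)) ⟩
        h (stairDown n)                                          ≈⟨ stairDown-sign n h h-swap ⟩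
        sgn (n C 2) * h (stair n)                                ∎

    R-identity : ∀ a →
      ι (denConst m n) * star n (Rpoly m n a) (λ _ → x)
      ≈ sgn (m ℕ.* (n C 2)) * ι (numConst m n) * per (λ i j → pow (a j) (toℕ i)) * falling∏ m n x
    R-identity a = begin
      ι (denConst m n) * star n (Rpoly m n a) (λ _ → x)
        ≈⟨ *-congˡ (star-Rpoly m n a (λ _ → x)) ⟩
      ι (denConst m n) * run (List.map (scaled a) (upper n)) h zeros
        ≈⟨ *-congˡ (vandermonde-antisymmetric h h-swap a) ⟩
      ι (denConst m n) * (∑ (List.map (λ w → monomial a (Vec.map toℕ w)) (permutations n)) * h (stair n))
        ≈⟨ *-congˡ (*-congʳ (∑-monomial≈per a)) ⟩
      ι (denConst m n) * (per A * h (stair n))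
        ≈⟨ solve 3 (λ a b c → a :* (b :* c) := b :* (a :* c)) refl _ _ _ ⟩
      per A * (ι (denConst m n) * h (stair n))
        ≈⟨ *-congˡ core′ ⟩
      per A * (sgn (m ℕ.* (n C 2)) * ι (numConst m n) * falling∏ m n x)
        ≈⟨ solve 4 (λ p a b c → p :* (a :* b :* c) := a :* b :* p :* c) refl _ _ _ _ ⟩
      sgn (m ℕ.* (n C 2)) * ι (numConst m n) * per A * falling∏ m n x ∎
      where
      A : Fin n → Fin n → Carrier
      A i j = pow (a j) (toℕ i)

-- Finite differences of integer functions.

module FiniteDifferences where

  open import Data.Integer using (+_; _+_; _*_; _-_; -_)
  open import Data.Integer.Solver using (module +-*-Solver)
  open import Relation.Binary.PropositionalEquality using (refl; sym; trans; cong; cong₂)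

  open Ops ℤ.+-*-commutativeRing using (ι; ff; sgn)
  open Antisymmetry ℤ.+-*-commutativeRing using (Functional; diff; diff-∷; ffs)
  open Signs ℤ.+-*-commutativeRing using (sgn-+; sgn-2*)
  open +-*-Solver using (solve; _:=_; _:+_; _:*_; :-_; _:-_; con)
  open ≡.≡-Reasoning

  ι≡+ : ∀ n → ι n ≡ + n
  ι≡+ zero = refl
  ι≡+ (suc n) = cong (λ z → (+ 1) + z) (ι≡+ n)

  ff-suc : ∀ x k → ff (+ 1 + x) (suc k) ≡ (+ 1 + x) * ff x k
  ff-suc x zero = solve 1 (λ x → con (+ 1) :* (con (+ 1) :+ x :- con (+ 0)) := (con (+ 1) :+ x) :* con (+ 1)) refl x
  ff-suc x (suc k) = begin
    ff (+ 1 + x) (suc k) * (+ 1 + x - (+ 1 + ι k))   ≡⟨ cong (_* (+ 1 + x - (+ 1 + ι k))) (ff-suc x k) ⟩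
    (+ 1 + x) * ff x k * (+ 1 + x - (+ 1 + ι k))
      ≡⟨ solve 3 (λ x f k → (con (+ 1) :+ x) :* f :* (con (+ 1) :+ x :- (con (+ 1) :+ k)) := (con (+ 1) :+ x) :* (f :* (x :- k))) refl x (ff x k) (ι k) ⟩
    (+ 1 + x) * (ff x k * (x - ι k))                 ∎

  ff-vanish : ∀ {a r} → a ℕ.< r → ff (+ a) r ≡ + 0
  ff-vanish {zero} {suc zero} _ = refl
  ff-vanish {zero} {suc (suc r)} _ = cong (_* (+ 0 - ι (suc r))) (ff-vanish {zero} {suc r} ℕ.z<s)
  ff-vanish {suc a} {suc r} (ℕ.s≤s a<r) = begin
    ff (+ suc a) (suc r)     ≡⟨ ff-suc (+ a) r ⟩
    + suc a * ff (+ a) r     ≡⟨ cong ((+ suc a) *_) (ff-vanish a<r) ⟩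
    + suc a * + 0            ≡⟨ ℤ.*-zeroʳ (+ suc a) ⟩
    + 0                      ∎

  ff-! : ∀ r b → ff (+ (r ℕ.+ b)) r * + (b !) ≡ + ((r ℕ.+ b) !)
  ff-! zero b = ℤ.*-identityˡ _
  ff-! (suc r) b = begin
    ff (+ suc (r ℕ.+ b)) (suc r) * + (b !)              ≡⟨ cong (_* + (b !)) (ff-suc (+ (r ℕ.+ b)) r) ⟩
    + suc (r ℕ.+ b) * ff (+ (r ℕ.+ b)) r * + (b !)      ≡⟨ ℤ.*-assoc (+ suc (r ℕ.+ b)) (ff (+ (r ℕ.+ b)) r) (+ (b !)) ⟩
    + suc (r ℕ.+ b) * (ff (+ (r ℕ.+ b)) r * + (b !))    ≡⟨ cong ((+ suc (r ℕ.+ b)) *_) (ff-! r b) ⟩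
    + suc (r ℕ.+ b) * + ((r ℕ.+ b) !)                   ≡⟨ ℤ.pos-* (suc (r ℕ.+ b)) _ ⟨
    + (suc (r ℕ.+ b) !)                                 ∎

  ff-neg1 : ∀ k → ff (- (+ 1)) k ≡ sgn k * + (k !)
  ff-neg1 zero = refl
  ff-neg1 (suc k) = begin
    ff (- (+ 1)) k * (- (+ 1) - ι k)         ≡⟨ cong₂ (λ f i → f * (- (+ 1) - i)) (ff-neg1 k) (ι≡+ k) ⟩
    sgn k * + (k !) * (- (+ 1) - + k)
      ≡⟨ solve 3 (λ s f k → s :* f :* (:- con (+ 1) :- k) := :- s :* ((con (+ 1) :+ k) :* f)) refl (sgn k) (+ (k !)) (+ k) ⟩
    - sgn k * (+ suc k * + (k !))            ≡⟨ cong (- sgn k *_) (ℤ.pos-* (suc k) (k !)) ⟨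
    sgn (suc k) * + (suc k !)                ∎

  -- Truncated subtraction does no harm: for k > N the factor (N)_k is already 0.
  ff-∸ : ∀ N k → ff (+ N) (suc k) ≡ ff (+ N) k * + (N ℕ.∸ k)
  ff-∸ N k with ℕ.≤-<-connex k N
  ... | inj₁ k≤N = cong (ff (+ N) k *_) (begin
    + N - ι k        ≡⟨ cong (λ z → + N - z) (ι≡+ k) ⟩
    + N - + k        ≡⟨ ℤ.m-n≡m⊖n N k ⟩
    N ℤ.⊖ k          ≡⟨ ℤ.⊖-≥ k≤N ⟩
    + (N ℕ.∸ k)      ∎)
  ... | inj₂ N<k = begin
    ff (+ N) k * (+ N - ι k)       ≡⟨ cong (_* (+ N - ι k)) (ff-vanish N<k) ⟩
    + 0                            ≡⟨ cong (_* + (N ℕ.∸ k)) (ff-vanish N<k) ⟨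
    ff (+ N) k * + (N ℕ.∸ k)       ∎

  binomial-! : ∀ N k → + (N C k) * + (k !) ≡ ff (+ N) k
  binomial-! N zero = refl
  binomial-! zero (suc k) = sym (ff-vanish {0} {suc k} ℕ.z<s)
  binomial-! (suc N) (suc k) = begin
    + (suc N C suc k) * + (suc k !)
      ≡⟨ cong₂ (λ c f → + c * f) (sym (nCk+nC[k+1]≡[n+1]C[k+1] N k)) (ℤ.pos-* (suc k) (k !)) ⟩
    (+ (N C k) + + (N C suc k)) * (+ suc k * + (k !))
      ≡⟨ solve 4 (λ a b k f → (a :+ b) :* (k :* f) := k :* (a :* f) :+ b :* (k :* f)) refl (+ (N C k)) (+ (N C suc k)) (+ suc k) (+ (k !)) ⟩
    + suc k * (+ (N C k) * + (k !)) + + (N C suc k) * (+ suc k * + (k !))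
      ≡⟨ cong₂ (λ a b → + suc k * a + b) (binomial-! N k) (trans (cong ((+ (N C suc k)) *_) (sym (ℤ.pos-* (suc k) (k !)))) (binomial-! N (suc k))) ⟩
    + suc k * ff (+ N) k + ff (+ N) k * (+ N - ι k)
      ≡⟨ cong (λ i → + suc k * ff (+ N) k + ff (+ N) k * (+ N - i)) (ι≡+ k) ⟩
    + suc k * ff (+ N) k + ff (+ N) k * (+ N - + k)
      ≡⟨ solve 3 (λ k n f → (con (+ 1) :+ k) :* f :+ f :* (n :- k) := (con (+ 1) :+ n) :* f) refl (+ k) (+ N) (ff (+ N) k) ⟩
    + suc N * ff (+ N) k
      ≡⟨ ff-suc (+ N) k ⟨
    ff (+ suc N) (suc k) ∎

  -- The M-th forward difference at 0.
  D : ℕ → (ℕ → ℤ) → ℤ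
  D zero f = f 0
  D (suc M) f = D M (f ∘ suc) - D M f

  D-local : ∀ M {f g : ℕ → ℤ} → (∀ {c} → c ℕ.≤ M → f c ≡ g c) → D M f ≡ D M g
  D-local zero e = e ℕ.z≤n
  D-local (suc M) e = cong₂ _-_ (D-local M (λ le → e (ℕ.s≤s le))) (D-local M (λ le → e (ℕ.m≤n⇒m≤1+n le)))

  D-cong : ∀ M {f g : ℕ → ℤ} → (∀ c → f c ≡ g c) → D M f ≡ D M g
  D-cong M e = D-local M (λ {c} _ → e c)

  D-+ : ∀ M f g → D M (λ c → f c + g c) ≡ D M f + D M g
  D-+ zero f g = refl
  D-+ (suc M) f g = trans (cong₂ _-_ (D-+ M (f ∘ suc) (g ∘ suc)) (D-+ M f g))
    (solve 4 (λ a b c d → (a :+ b) :- (c :+ d) := (a :- c) :+ (b :- d)) refl (D M (f ∘ suc)) (D M (g ∘ suc)) (D M f) (D M g))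

  D-* : ∀ M a f → D M (λ c → a * f c) ≡ a * D M f
  D-* zero a f = refl
  D-* (suc M) a f = trans (cong₂ _-_ (D-* M a (f ∘ suc)) (D-* M a f))
    (solve 3 (λ a b c → a :* b :- a :* c := a :* (b :- c)) refl a (D M (f ∘ suc)) (D M f))

  D-0 : ∀ M → D M (λ _ → + 0) ≡ + 0
  D-0 zero = refl
  D-0 (suc M) = cong₂ _-_ (D-0 M) (D-0 M)

  -- Leibniz rule at 0: the M-th difference of c f(c) is M times the (M - 1)-st difference of f(c +
  -- 1), and shifting f adds its next difference. For M = 0 the value of `ℕ.pred` is multiplied by
  -- 0.
  D-affine : ∀ M f b → D M (λ c → (+ c + b) * f c) ≡ b * D M f + + M * (D M f + D (ℕ.pred M) f)
  D-affine M f b = trans (shifted M f b) (cong (λ z → b * D M f + z) (unshift M))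
    where
    unshift : ∀ M → + M * D (ℕ.pred M) (f ∘ suc) ≡ + M * (D M f + D (ℕ.pred M) f)
    unshift zero = refl
    unshift (suc M) = cong ((+ suc M) *_) (solve 2 (λ a b → a := a :- b :+ b) refl (D M (f ∘ suc)) (D M f))
    next : ∀ M f → D M (f ∘ suc) + + M * (D (ℕ.pred M) (λ c → f (suc (suc c))) - D (ℕ.pred M) (f ∘ suc)) ≡ + suc M * D M (f ∘ suc)
    next zero f = solve 1 (λ a → a :+ con (+ 0) := con (+ 1) :* a) refl (f 1)
    next (suc M) f = solve 2 (λ a m → a :+ m :* a := (con (+ 1) :+ m) :* a) refl (D (suc M) (f ∘ suc)) (+ suc M)
    shifted : ∀ M f b → D M (λ c → (+ c + b) * f c) ≡ b * D M f + + M * D (ℕ.pred M) (f ∘ suc)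
    shifted zero f b = solve 2 (λ b f → (con (+ 0) :+ b) :* f := b :* f :+ con (+ 0)) refl b (f 0)
    shifted (suc M) f b = begin
      D M (λ c → (+ suc c + b) * f (suc c)) - D M (λ c → (+ c + b) * f c)
        ≡⟨ cong (_- D M (λ c → (+ c + b) * f c)) (D-cong M λ c → cong (_* f (suc c)) (solve 2 (λ c b → (con (+ 1) :+ c) :+ b := c :+ (con (+ 1) :+ b)) refl (+ c) b)) ⟩
      D M (λ c → (+ c + (+ 1 + b)) * f (suc c)) - D M (λ c → (+ c + b) * f c)
        ≡⟨ cong₂ _-_ (shifted M (f ∘ suc) (+ 1 + b)) (shifted M f b) ⟩
      ((+ 1 + b) * D M (f ∘ suc) + + M * p) - (b * D M f + + M * q)
        ≡⟨ solve 6 (λ b x m p y q → ((con (+ 1) :+ b) :* x :+ m :* p) :- (b :* y :+ m :* q) := b :* (x :- y) :+ (x :+ m :* (p :- q))) refl b (D M (f ∘ suc)) (+ M) p (D M f) q ⟩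
      b * (D M (f ∘ suc) - D M f) + (D M (f ∘ suc) + + M * (p - q))
        ≡⟨ cong (λ z → b * D (suc M) f + z) (next M f) ⟩
      b * D (suc M) f + + suc M * D M (f ∘ suc) ∎
      where
      p = D (ℕ.pred M) (λ c → f (suc (suc c)))
      q = D (ℕ.pred M) (f ∘ suc)

  -- One term of the binomial formula for the M-th difference. The sign exponent M + c₀ has the
  -- parity of M - c₀, and for c₀ > M the binomial coefficient is 0.
  D-single : ∀ M c₀ (f : ℕ → ℤ) → (∀ {c} → c ℕ.≤ M → c ≢ c₀ → f c ≡ + 0) →
    D M f ≡ sgn (M ℕ.+ c₀) * + (M C c₀) * f c₀
  D-single zero zero f f0 = sym (ℤ.*-identityˡ (f 0))
  D-single zero (suc c₀) f f0 = trans (f0 ℕ.z≤n λ ()) (cong (_* f (suc c₀)) (sym (ℤ.*-zeroʳ (sgn (suc c₀)))))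
  D-single (suc M) zero f f0 = begin
    D M (f ∘ suc) - D M f
      ≡⟨ cong₂ _-_ (trans (D-local M (λ le → f0 (ℕ.s≤s le) λ ())) (D-0 M)) (D-single M zero f (f0 ∘ ℕ.m≤n⇒m≤1+n)) ⟩
    + 0 - sgn (M ℕ.+ 0) * + 1 * f 0
      ≡⟨ solve 2 (λ s f → con (+ 0) :- s :* con (+ 1) :* f := :- s :* con (+ 1) :* f) refl (sgn (M ℕ.+ 0)) (f 0) ⟩
    sgn (suc M ℕ.+ 0) * + 1 * f 0 ∎
  D-single (suc M) (suc c₀) f f0 = begin
    D M (f ∘ suc) - D M f
      ≡⟨ cong₂ _-_ (D-single M c₀ (f ∘ suc) (λ le ne → f0 (ℕ.s≤s le) (ne ∘ ℕ.suc-injective)))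
                   (D-single M (suc c₀) f (f0 ∘ ℕ.m≤n⇒m≤1+n)) ⟩
    sgn (M ℕ.+ c₀) * + (M C c₀) * f₁ - sgn (M ℕ.+ suc c₀) * + (M C suc c₀) * f₁
      ≡⟨ cong (λ k → sgn (M ℕ.+ c₀) * + (M C c₀) * f₁ - sgn k * + (M C suc c₀) * f₁) (ℕ.+-suc M c₀) ⟩
    sgn (M ℕ.+ c₀) * + (M C c₀) * f₁ - (- sgn (M ℕ.+ c₀)) * + (M C suc c₀) * f₁
      ≡⟨ solve 4 (λ s a b f → s :* a :* f :- (:- s) :* b :* f := (:- (:- s)) :* (a :+ b) :* f) refl (sgn (M ℕ.+ c₀)) (+ (M C c₀)) (+ (M C suc c₀)) f₁ ⟩
    (- - sgn (M ℕ.+ c₀)) * + (M C c₀ ℕ.+ M C suc c₀) * f₁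
      ≡⟨ cong₂ (λ k c → - sgn k * + c * f₁) (sym (ℕ.+-suc M c₀)) (nCk+nC[k+1]≡[n+1]C[k+1] M c₀) ⟩
    sgn (suc M ℕ.+ suc c₀) * + (suc M C suc c₀) * f₁ ∎
    where f₁ = f (suc c₀)

  -- The difference of order Mᵢ in the i-th coordinate, evaluated at the origin.
  Λ : ∀ {n} → Vec ℕ n → (Vec ℕ n → ℤ) → ℤ
  Λ [] F = F []
  Λ (M ∷ Ms) F = D M (λ c → Λ Ms (F ∘ (c ∷_)))

  dec : ∀ {n} → Fin n → Vec ℕ n → Vec ℕ n
  dec zero (k ∷ v) = ℕ.pred k ∷ v
  dec (suc i) (k ∷ v) = k ∷ dec i v

  Λ-cong : ∀ {n} (M : Vec ℕ n) {F G} → (∀ c → F c ≡ G c) → Λ M F ≡ Λ M G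
  Λ-cong [] e = e []
  Λ-cong (M ∷ Ms) e = D-cong M (λ c → Λ-cong Ms (λ cs → e (c ∷ cs)))

  Λ-+ : ∀ {n} (M : Vec ℕ n) F G → Λ M (λ c → F c + G c) ≡ Λ M F + Λ M G
  Λ-+ [] F G = refl
  Λ-+ (M ∷ Ms) F G = trans (D-cong M (λ c → Λ-+ Ms (F ∘ (c ∷_)) (G ∘ (c ∷_)))) (D-+ M _ _)

  Λ-* : ∀ {n} (M : Vec ℕ n) a F → Λ M (λ c → a * F c) ≡ a * Λ M F
  Λ-* [] a F = refl
  Λ-* (M ∷ Ms) a F = trans (D-cong M (λ c → Λ-* Ms a (F ∘ (c ∷_)))) (D-* M a _)

  Λ-coordinate : ∀ {n} (M : Vec ℕ n) i F →
    Λ M (λ c → + lookup c i * F c) ≡ + lookup M i * (Λ M F + Λ (dec i M) F)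
  Λ-coordinate (M ∷ Ms) zero F = begin
    D M (λ c → Λ Ms (λ cs → + c * F (c ∷ cs)))          ≡⟨ D-cong M (λ c → trans (Λ-* Ms (+ c) (F ∘ (c ∷_))) (cong (_* f c) (sym (ℤ.+-identityʳ (+ c))))) ⟩
    D M (λ c → (+ c + + 0) * f c)                       ≡⟨ D-affine M f (+ 0) ⟩
    + 0 + + M * (D M f + D (ℕ.pred M) f)                ≡⟨ ℤ.+-identityˡ _ ⟩
    + M * (D M f + D (ℕ.pred M) f)                      ∎
    where
    f : ℕ → ℤ
    f c = Λ Ms (F ∘ (c ∷_))
  Λ-coordinate (M ∷ Ms) (suc i) F = begin
    D M (λ c → Λ Ms (λ cs → + lookup cs i * F (c ∷ cs)))   ≡⟨ D-cong M (λ c → Λ-coordinate Ms i (F ∘ (c ∷_))) ⟩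
    D M (λ c → + lookup Ms i * (f c + g c))                ≡⟨ D-* M (+ lookup Ms i) (λ c → f c + g c) ⟩
    + lookup Ms i * D M (λ c → f c + g c)                  ≡⟨ cong ((+ lookup Ms i) *_) (D-+ M f g) ⟩
    + lookup Ms i * (D M f + D M g)                        ∎
    where
    f g : ℕ → ℤ
    f c = Λ Ms (F ∘ (c ∷_))
    g c = Λ (dec i Ms) (F ∘ (c ∷_))

  affine : ∀ {n} → Pair n → ℤ → Vec ℕ n → ℤ
  affine (i , j) b c = + lookup c j - + lookup c i + b

  Λ-affine : ∀ {n} (M : Vec ℕ n) i j b F → Λ M (λ c → affine (i , j) b c * F c)
    ≡ + lookup M j * (Λ M F + Λ (dec j M) F) - + lookup M i * (Λ M F + Λ (dec i M) F) + b * Λ M F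
  Λ-affine M i j b F = begin
    Λ M (λ c → affine (i , j) b c * F c)
      ≡⟨ Λ-cong M (λ c → solve 4 (λ x y b f → (x :- y :+ b) :* f := x :* f :+ (con (- (+ 1)) :* (y :* f) :+ b :* f)) refl (+ lookup c j) (+ lookup c i) b (F c)) ⟩
    Λ M (λ c → + lookup c j * F c + (- (+ 1) * (+ lookup c i * F c) + b * F c))
      ≡⟨ trans (Λ-+ M _ _) (cong (λ z → Λ M (λ c → + lookup c j * F c) + z) (trans (Λ-+ M _ _) (cong₂ _+_ (Λ-* M (- (+ 1)) _) (Λ-* M b F)))) ⟩
    Λ M (λ c → + lookup c j * F c) + (- (+ 1) * Λ M (λ c → + lookup c i * F c) + b * Λ M F)
      ≡⟨ cong₂ (λ x y → x + (- (+ 1) * y + b * Λ M F)) (Λ-coordinate M j F) (Λ-coordinate M i F) ⟩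
    X + (- (+ 1) * Y + b * Λ M F)
      ≡⟨ solve 3 (λ x y z → x :+ (con (- (+ 1)) :* y :+ z) := x :- y :+ z) refl X Y (b * Λ M F) ⟩
    X - Y + b * Λ M F ∎
    where
    X = + lookup M j * (Λ M F + Λ (dec j M) F)
    Y = + lookup M i * (Λ M F + Λ (dec i M) F)

  sum-dec : ∀ {n} (M : Vec ℕ n) i → lookup M i ≡ 0 ⊎ suc (Vec.sum (dec i M)) ≡ Vec.sum M
  sum-dec (zero ∷ M) zero = inj₁ refl
  sum-dec (suc k ∷ M) zero = inj₂ refl
  sum-dec (k ∷ M) (suc i) with sum-dec M i
  ... | inj₁ e = inj₁ e
  ... | inj₂ e = inj₂ (trans (sym (ℕ.+-suc k _)) (cong (k ℕ.+_) e))

  -- F behaves under Λ like a polynomial of total degree at most d.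
  Degree≤ : ∀ {n} → ℕ → (Vec ℕ n → ℤ) → Set
  Degree≤ d F = ∀ M → d ℕ.< Vec.sum M → Λ M F ≡ + 0

  -- By the Leibniz rule a coordinate factor costs at most one order of difference. If M has entry 0
  -- there, `dec` does not lower it, but the term carries this entry as a factor.
  Degree≤-affine : ∀ {n} (p : Pair n) b {F d} → Degree≤ d F → Degree≤ (suc d) (λ c → affine p b c * F c)
  Degree≤-affine (i , j) b {F} {d} van M d<M = begin
    Λ M (λ c → affine (i , j) b c * F c)
      ≡⟨ Λ-affine M i j b F ⟩
    + lookup M j * (Λ M F + Λ (dec j M) F) - + lookup M i * (Λ M F + Λ (dec i M) F) + b * Λ M F
      ≡⟨ cong₂ (λ x y → x - y + b * Λ M F) (zero-term j) (zero-term i) ⟩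
    + 0 + b * Λ M F
      ≡⟨ trans (ℤ.+-identityˡ _) (cong (b *_) top) ⟩
    b * + 0
      ≡⟨ ℤ.*-zeroʳ b ⟩
    + 0 ∎
    where
    top : Λ M F ≡ + 0
    top = van M (ℕ.<-trans (ℕ.n<1+n d) d<M)
    zero-term : ∀ i → + lookup M i * (Λ M F + Λ (dec i M) F) ≡ + 0
    zero-term i with sum-dec M i
    ... | inj₁ e = cong (λ k → + k * (Λ M F + Λ (dec i M) F)) e
    ... | inj₂ e = trans (cong ((+ lookup M i) *_) (cong₂ _+_ top (van (dec i M) (ℕ.s<s⁻¹ (≡.subst (suc d ℕ.<_) (sym e) d<M)))))
      (ℤ.*-zeroʳ (+ lookup M i))

  -- At order d + 1 only the differences of `F` of the lowered order d survive, so the constant `b`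
  -- drops out. This is the freedom to choose the lower order terms.
  Λ-affine-top : ∀ {n} (p : Pair n) b {F d} → Degree≤ d F → ∀ M → Vec.sum M ≡ suc d →
    Λ M (λ c → affine p b c * F c)
      ≡ + lookup M (proj₂ p) * Λ (dec (proj₂ p) M) F - + lookup M (proj₁ p) * Λ (dec (proj₁ p) M) F
  Λ-affine-top (i , j) b {F} {d} van M e = begin
    Λ M (λ c → affine (i , j) b c * F c)
      ≡⟨ Λ-affine M i j b F ⟩
    + lookup M j * (Λ M F + Λ (dec j M) F) - + lookup M i * (Λ M F + Λ (dec i M) F) + b * Λ M F
      ≡⟨ cong (λ z → + lookup M j * (z + Λ (dec j M) F) - + lookup M i * (z + Λ (dec i M) F) + b * z)
           (van M (ℕ.≤-reflexive (sym e))) ⟩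
    + lookup M j * (+ 0 + Λ (dec j M) F) - + lookup M i * (+ 0 + Λ (dec i M) F) + b * + 0
      ≡⟨ solve 5 (λ x y z w b → x :* (con (+ 0) :+ y) :- z :* (con (+ 0) :+ w) :+ b :* con (+ 0) := x :* y :- z :* w)
           refl (+ lookup M j) (Λ (dec j M) F) (+ lookup M i) (Λ (dec i M) F) b ⟩
    + lookup M j * Λ (dec j M) F - + lookup M i * Λ (dec i M) F ∎

  D-D : ∀ M k φ → D M (λ c → D k (λ t → φ (c ℕ.+ t))) ≡ D (M ℕ.+ k) φ
  D-D zero k φ = refl
  D-D (suc M) k φ = cong₂ _-_ (D-D M k (φ ∘ suc)) (D-D M k φ)

  -- Differences in the various coordinates of a function of the sum are all differences in the sum,
  -- and their orders add up.
  Λ-sum : ∀ {n} (M : Vec ℕ n) φ → Λ M (φ ∘ Vec.sum) ≡ D (Vec.sum M) φ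
  Λ-sum [] φ = refl
  Λ-sum (M ∷ Ms) φ = trans (D-cong M (λ c → Λ-sum Ms (φ ∘ (c ℕ.+_)))) (D-D M (Vec.sum Ms) φ)

  D-ff-step : ∀ M K s → D M (λ t → ff (+ t - s) (suc K))
    ≡ (- (s + ι K)) * D M (λ t → ff (+ t - s) K)
      + + M * (D M (λ t → ff (+ t - s) K) + D (ℕ.pred M) (λ t → ff (+ t - s) K))
  D-ff-step M K s = trans
    (D-cong M (λ t → solve 4 (λ f t s k → f :* (t :- s :- k) := (t :+ (:- (s :+ k))) :* f) refl (ff (+ t - s) K) (+ t) s (ι K)))
    (D-affine M (λ t → ff (+ t - s) K) (- (s + ι K)))

  -- (t - s)_K has degree K in t: every further factor is affine and raises the degree by one
  -- through the Leibniz rule.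
  D-ff-vanish : ∀ K s {M} → K ℕ.< M → D M (λ t → ff (+ t - s) K) ≡ + 0
  D-ff-vanish zero s {suc M} lt = ℤ.+-inverseʳ (D M (λ _ → + 1))
  D-ff-vanish (suc K) s {suc M} (ℕ.s≤s lt) = begin
    D (suc M) (λ t → ff (+ t - s) (suc K))
      ≡⟨ D-ff-step (suc M) K s ⟩
    (- (s + ι K)) * D (suc M) (λ t → ff (+ t - s) K) + + suc M * (D (suc M) (λ t → ff (+ t - s) K) + D M (λ t → ff (+ t - s) K))
      ≡⟨ cong₂ (λ x y → (- (s + ι K)) * x + + suc M * (x + y)) (D-ff-vanish K s (ℕ.m<n⇒m<1+n lt)) (D-ff-vanish K s lt) ⟩
    (- (s + ι K)) * + 0 + + suc M * (+ 0 + + 0)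
      ≡⟨ solve 2 (λ a b → a :* con (+ 0) :+ b :* con (+ 0) := con (+ 0)) refl (- (s + ι K)) (+ suc M) ⟩
    + 0 ∎

  D-ff-top : ∀ K s → D K (λ t → ff (+ t - s) K) ≡ + (K !)
  D-ff-top zero s = refl
  D-ff-top (suc K) s = begin
    D (suc K) (λ t → ff (+ t - s) (suc K))
      ≡⟨ D-ff-step (suc K) K s ⟩
    (- (s + ι K)) * D (suc K) (λ t → ff (+ t - s) K) + + suc K * (D (suc K) (λ t → ff (+ t - s) K) + D K (λ t → ff (+ t - s) K))
      ≡⟨ cong₂ (λ x y → (- (s + ι K)) * x + + suc K * (x + y)) (D-ff-vanish K s (ℕ.n<1+n K)) (D-ff-top K s) ⟩
    (- (s + ι K)) * + 0 + + suc K * (+ 0 + + (K !))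
      ≡⟨ solve 3 (λ a b f → a :* con (+ 0) :+ b :* (con (+ 0) :+ f) := b :* f) refl (- (s + ι K)) (+ suc K) (+ (K !)) ⟩
    + suc K * + (K !)
      ≡⟨ ℤ.pos-* (suc K) (K !) ⟨
    + (suc K !) ∎

  affines : ∀ {n} → List (Pair n × ℤ) → (Vec ℕ n → ℤ) → Vec ℕ n → ℤ
  affines L F c = List.foldr (λ l z → affine (proj₁ l) (proj₂ l) c * z) (F c) L

  Degree≤-affines : ∀ {n} (L : List (Pair n × ℤ)) {F d} → Degree≤ d F → Degree≤ (List.length L ℕ.+ d) (affines L F)
  Degree≤-affines [] van = van
  Degree≤-affines ((p , b) ∷ L) van = Degree≤-affine p b (Degree≤-affines L van)

  -- The starred product at (N,...,N) as a mixed difference.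

  module LeadingForm (N K : ℕ) (s : ℤ) where

    φ : ∀ {n} → Vec ℕ n → ℤ
    φ c = ff (+ Vec.sum c - s) K

    g : ∀ {n} → Functional n
    g = ffs (λ _ → + N)

    -- The orders of difference left after the shifts `v`: choosing x_i from a factor uses up one
    -- difference in coordinate i.
    rest : ∀ {n} → Vec ℕ n → Vec ℕ n
    rest = Vec.map (N ℕ.∸_)

    Degree≤-φ : ∀ {n} → Degree≤ {n} K φ
    Degree≤-φ M lt = trans (Λ-sum M (λ t → ff (+ t - s) K)) (D-ff-vanish K s lt)

    g-inc : ∀ {n} i (v : Vec ℕ n) → g (inc i v) ≡ g v * + lookup (rest v) i
    g-inc zero (k ∷ v) = trans (cong (_* g v) (ff-∸ N k))
      (solve 3 (λ f n g → f :* n :* g := f :* g :* n) refl (ff (+ N) k) (+ (N ℕ.∸ k)) (g v))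
    g-inc (suc i) (k ∷ v) = trans (cong (ff (+ N) k *_) (g-inc i v)) (sym (ℤ.*-assoc (ff (+ N) k) _ _))

    dec-rest : ∀ {n} i (v : Vec ℕ n) → dec i (rest v) ≡ rest (inc i v)
    dec-rest zero (k ∷ v) = cong (_∷ rest v) (ℕ.pred[m∸n]≡m∸[1+n] N k)
    dec-rest (suc i) (k ∷ v) = cong (N ℕ.∸ k ∷_) (dec-rest i v)

    lookup-rest : ∀ {n} i (v : Vec ℕ n) → lookup (rest v) i ≡ 0 → N ℕ.< lookup (inc i v) i
    lookup-rest zero (k ∷ v) e = ℕ.s≤s (ℕ.m∸n≡0⇒m≤n e)
    lookup-rest (suc i) (k ∷ v) e = lookup-rest i v e

    lookup-inc : ∀ {n} i j (v : Vec ℕ n) → lookup v i ℕ.≤ lookup (inc j v) i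
    lookup-inc zero zero (k ∷ v) = ℕ.n≤1+n k
    lookup-inc zero (suc j) (k ∷ v) = ℕ.≤-refl
    lookup-inc (suc i) zero (k ∷ v) = ℕ.≤-refl
    lookup-inc (suc i) (suc j) (k ∷ v) = lookup-inc i j v

    g-beyond : ∀ {n} i (v : Vec ℕ n) → N ℕ.< lookup v i → g v ≡ + 0
    g-beyond zero (k ∷ v) lt = cong (_* g v) (ff-vanish lt)
    g-beyond (suc i) (k ∷ v) lt = trans (cong (ff (+ N) k *_) (g-beyond i v lt)) (ℤ.*-zeroʳ (ff (+ N) k))

    -- Shifts never lower an exponent, and (N)_k = 0 as soon as k > N.
    diff-beyond : ∀ {n} (L : List (Pair n)) i v → N ℕ.< lookup v i → diff L g v ≡ + 0
    diff-beyond [] i v lt = g-beyond i v lt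
    diff-beyond ((k , j) ∷ L) i v lt = trans (diff-∷ k j L g v)
      (cong₂ _-_ (diff-beyond L i (inc j v) (ℕ.<-≤-trans lt (lookup-inc i j v)))
                 (diff-beyond L i (inc k v) (ℕ.<-≤-trans lt (lookup-inc i k v))))

    -- A mixed difference of full order sees only the leading forms xⱼ − xᵢ, which act as shifts of g.
    Λ-leading : ∀ {n} (L : List (Pair n × ℤ)) v → Vec.sum (rest v) ≡ List.length L ℕ.+ K →
      g v * Λ (rest v) (affines L φ) ≡ + (K !) * diff (List.map proj₁ L) g v
    Λ-leading [] v e = begin
      g v * Λ (rest v) φ                                      ≡⟨ cong (g v *_) (Λ-sum (rest v) (λ t → ff (+ t - s) K)) ⟩
      g v * D (Vec.sum (rest v)) (λ t → ff (+ t - s) K)       ≡⟨ cong (λ d → g v * D d (λ t → ff (+ t - s) K)) e ⟩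
      g v * D K (λ t → ff (+ t - s) K)                        ≡⟨ cong (g v *_) (D-ff-top K s) ⟩
      g v * + (K !)                                           ≡⟨ ℤ.*-comm (g v) _ ⟩
      + (K !) * g v                                           ∎
    Λ-leading (((i , j) , b) ∷ L) v e = begin
      g v * Λ M (λ c → affine (i , j) b c * F c)
        ≡⟨ cong (g v *_) (Λ-affine-top (i , j) b (Degree≤-affines L Degree≤-φ) M e) ⟩
      g v * (+ lookup M j * Λ (dec j M) F - + lookup M i * Λ (dec i M) F)
        ≡⟨ solve 5 (λ g a x b y → g :* (a :* x :- b :* y) := g :* a :* x :- g :* b :* y) refl (g v) (+ lookup M j) (Λ (dec j M) F) (+ lookup M i) (Λ (dec i M) F) ⟩
      g v * + lookup M j * Λ (dec j M) F - g v * + lookup M i * Λ (dec i M) F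
        ≡⟨ cong₂ _-_ (branch j) (branch i) ⟩
      + (K !) * diff L′ g (inc j v) - + (K !) * diff L′ g (inc i v)
        ≡⟨ solve 3 (λ k x y → k :* x :- k :* y := k :* (x :- y)) refl (+ (K !)) (diff L′ g (inc j v)) (diff L′ g (inc i v)) ⟩
      + (K !) * (diff L′ g (inc j v) - diff L′ g (inc i v))
        ≡⟨ cong ((+ (K !)) *_) (diff-∷ i j L′ g v) ⟨
      + (K !) * diff ((i , j) ∷ L′) g v ∎
      where
      M = rest v
      F = affines L φ
      L′ = List.map proj₁ L
      -- Either a difference in coordinate i is left and is spent, with (N)_{k+1} = (N)_k (N - k),
      -- or none is left and both sides vanish, the right one because the exponent passes N.
      branch : ∀ i → g v * + lookup M i * Λ (dec i M) F ≡ + (K !) * diff L′ g (inc i v)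
      branch i with sum-dec M i
      ... | inj₁ e₀ = begin
        g v * + lookup M i * Λ (dec i M) F        ≡⟨ cong (λ z → g v * + z * Λ (dec i M) F) e₀ ⟩
        g v * + 0 * Λ (dec i M) F                 ≡⟨ cong (_* Λ (dec i M) F) (ℤ.*-zeroʳ (g v)) ⟩
        + 0                                       ≡⟨ ℤ.*-zeroʳ (+ (K !)) ⟨
        + (K !) * + 0                             ≡⟨ cong ((+ (K !)) *_) (diff-beyond L′ i (inc i v) (lookup-rest i v e₀)) ⟨
        + (K !) * diff L′ g (inc i v)             ∎
      ... | inj₂ e₁ = begin
        g v * + lookup M i * Λ (dec i M) F        ≡⟨ cong₂ (λ x M → x * Λ M F) (sym (g-inc i v)) (dec-rest i v) ⟩
        g (inc i v) * Λ (rest (inc i v)) F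
          ≡⟨ Λ-leading L (inc i v) (trans (cong Vec.sum (sym (dec-rest i v))) (ℕ.suc-injective (trans e₁ e))) ⟩
        + (K !) * diff L′ g (inc i v)             ∎

-- Extremal sums of numbers with prescribed gaps.

module SeparatedNumbers where

  open import Data.Nat
  open import Data.Nat.Properties
  open import Data.Nat.Solver using (module +-*-Solver)
  open import Data.List using (length)
  open import Data.Nat.ListAction using (sum)
  open import Data.List.Properties using (length-map; map-id-local)
  open import Data.List.Relation.Unary.AllPairs using (AllPairs)
  open import Relation.Binary.PropositionalEquality using (refl; sym; trans; cong; cong₂; subst)

  data Deletion (x : ℕ) : List ℕ → List ℕ → Set where
    here : ∀ {xs} → Deletion x xs (x ∷ xs)
    there : ∀ {y xs ys} → Deletion x xs ys → Deletion x (y ∷ xs) (y ∷ ys)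

  deletion-sum : ∀ {x xs ys} → Deletion x xs ys → sum ys ≡ x + sum xs
  deletion-sum here = refl
  deletion-sum {x} (there {y} {xs} d) = trans (cong (y +_) (deletion-sum d))
    (trans (sym (+-assoc y x (sum xs))) (trans (cong (_+ sum xs) (+-comm y x)) (+-assoc x y (sum xs))))

  deletion-length : ∀ {x xs ys} → Deletion x xs ys → length ys ≡ suc (length xs)
  deletion-length here = refl
  deletion-length (there d) = cong suc (deletion-length d)

  deletion-All : ∀ {P : ℕ → Set} {x xs ys} → Deletion x xs ys → All P ys → All P xs
  deletion-All here (_ ∷ ps) = ps
  deletion-All (there d) (p ∷ ps) = p ∷ deletion-All d ps

  deletion-deleted : ∀ {P : ℕ → Set} {x xs ys} → Deletion x xs ys → All P ys → P x
  deletion-deleted here (p ∷ _) = p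
  deletion-deleted (there d) (_ ∷ ps) = deletion-deleted d ps

  module Gaps (m : ℕ) where

    -- Here `x` stands before `y`: ascents are at least m, descents at least e. The grid gives e = m
    -- + 1; the value e = m arises by the reflection x ↦ N - x.
    Gap : ℕ → ℕ → ℕ → Set
    Gap e x y = x + m ≤ y ⊎ y + e ≤ x

    progression : ℕ → ℕ → List ℕ
    progression a zero = []
    progression a (suc n) = a ∷ progression (a + m) n

    map-progression : ∀ a n → map (_+ m) (progression a n) ≡ progression (a + m) n
    map-progression a zero = refl
    map-progression a (suc n) = cong (a + m ∷_) (map-progression (a + m) n)

    lower : List ℕ → List ℕ
    lower = map (_∸ m)

    lower-sum : ∀ {xs} → All (m ≤_) xs → sum xs ≡ length xs * m + sum (lower xs)
    lower-sum [] = refl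
    lower-sum {x ∷ xs} (m≤x ∷ ms) = begin-equality
      x + sum xs                                          ≡⟨ cong₂ _+_ (sym (m+[n∸m]≡n m≤x)) (lower-sum ms) ⟩
      m + (x ∸ m) + (length xs * m + sum (lower xs))
        ≡⟨ solve 4 (λ m x l s → m :+ x :+ (l :+ s) := m :+ l :+ (x :+ s)) refl m (x ∸ m) (length xs * m) (sum (lower xs)) ⟩
      m + length xs * m + (x ∸ m + sum (lower xs))        ∎
      where
      open ≤-Reasoning
      open +-*-Solver

    lower-inverse : ∀ {xs} → All (m ≤_) xs → map (_+ m) (lower xs) ≡ xs
    lower-inverse {xs} ms = trans (sym (map-∘ xs)) (map-id-local (All.map m∸n+n≡m ms))

    lower-gap : ∀ {e x y} → m ≤ x → m ≤ y → Gap e x y → Gap e (x ∸ m) (y ∸ m)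
    lower-gap {e} {x} {y} m≤x m≤y (inj₁ le) = inj₁ (subst (_≤ y ∸ m) (sym (m∸n+n≡m m≤x)) (m+n≤o⇒m≤o∸n x le))
    lower-gap {e} {x} {y} m≤x m≤y (inj₂ le) = inj₂ (subst (_≤ x ∸ m) (+-∸-comm e m≤y) (∸-monoˡ-≤ m le))

    lower-gaps : ∀ {e xs} → All (m ≤_) xs → AllPairs (Gap e) xs → AllPairs (Gap e) (lower xs)
    lower-gaps [] [] = []
    lower-gaps (m≤x ∷ ms) (g ∷ gs) = row m≤x ms g ∷ lower-gaps ms gs
      where
      row : ∀ {e x ys} → m ≤ x → All (m ≤_) ys → All (Gap e x) ys → All (Gap e (x ∸ m)) (lower ys)
      row m≤x [] [] = []
      row m≤x (m≤y ∷ ms) (g ∷ gs) = lower-gap m≤x m≤y g ∷ row m≤x ms gs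

    -- At most one of the numbers lies below m.
    delete-small : ∀ {e} → m ≤ e → ∀ y ys → AllPairs (Gap e) (y ∷ ys) →
      ∃₂ λ x rest → Deletion x rest (y ∷ ys) × All (m ≤_) rest × AllPairs (Gap e) rest
    delete-small {e} m≤e y ys (g ∷ gs) with m ≤? y
    ... | no m≰y = y , ys , here , All.map large g , gs
      where
      large : ∀ {z} → Gap e y z → m ≤ z
      large (inj₁ le) = ≤-trans (m≤n+m m y) le
      large {z} (inj₂ le) = contradiction (≤-trans m≤e (≤-trans (m≤n+m e z) le)) m≰y
    delete-small m≤e y [] gs | yes _ = y , [] , here , [] , []
    delete-small m≤e y (z ∷ zs) (g ∷ gs) | yes m≤y with delete-small m≤e z zs gs
    ... | x , rest , d , ms , gs′ = x , y ∷ rest , there d , m≤y ∷ ms , deletion-All d g ∷ gs′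

    private
      triangle : ∀ n → m * (suc n C 2) ≡ n * m + m * (n C 2)
      triangle n = trans (cong (m *_) ([1+n]C2 n)) (trans (*-distribˡ-+ m n (n C 2)) (cong (_+ m * (n C 2)) (*-comm m n)))

      sum-split : ∀ {x rest xs n} → Deletion x rest xs → All (m ≤_) rest → length xs ≡ suc n →
        sum xs ≡ n * m + (x + sum (lower rest))
      sum-split {x} {rest} {xs} {n} d ms e = begin-equality
        sum xs                                       ≡⟨ deletion-sum d ⟩
        x + sum rest                                 ≡⟨ cong (x +_) (lower-sum ms) ⟩
        x + (length rest * m + sum (lower rest))     ≡⟨ cong (λ k → x + (k * m + sum (lower rest))) (suc-injective (trans (sym (deletion-length d)) e)) ⟩
        x + (n * m + sum (lower rest))               ≡⟨ solve 3 (λ x l s → x :+ (l :+ s) := l :+ (x :+ s)) refl x (n * m) (sum (lower rest)) ⟩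
        n * m + (x + sum (lower rest))               ∎
        where
        open ≤-Reasoning
        open +-*-Solver

      lower-length : ∀ {x rest xs n} → Deletion x rest xs → length xs ≡ suc n → length (lower rest) ≡ n
      lower-length {rest = rest} d e = trans (length-map (_∸ m) rest) (suc-injective (trans (sym (deletion-length d)) e))

    -- Deleting one number leaves n numbers that are all at least m. Lowering these by m keeps the
    -- gaps and costs nm, and nm + mC(n,2) = mC(n+1,2).
    gaps-sum-≥ : ∀ {e} → m ≤ e → ∀ n xs → length xs ≡ n → AllPairs (Gap e) xs → m * (n C 2) ≤ sum xs
    gaps-sum-≥ m≤e zero xs e gs = subst (_≤ sum xs) (sym (*-zeroʳ m)) z≤n
    gaps-sum-≥ m≤e (suc n) (y ∷ ys) e gs with delete-small m≤e y ys gs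
    ... | x , rest , d , ms , gs′ = begin
      m * (suc n C 2)                  ≡⟨ triangle n ⟩
      n * m + m * (n C 2)              ≤⟨ +-monoʳ-≤ (n * m) (gaps-sum-≥ m≤e n (lower rest) (lower-length d e) (lower-gaps ms gs′)) ⟩
      n * m + sum (lower rest)         ≤⟨ +-monoʳ-≤ (n * m) (m≤n+m (sum (lower rest)) x) ⟩
      n * m + (x + sum (lower rest))   ≡⟨ sum-split d ms e ⟨
      sum (y ∷ ys)                     ∎
      where open ≤-Reasoning

    -- Equality makes the deleted number 0 and, by induction, the others m, 2m, ... in this order.
    -- The 0 stands first: placed after m it would be a descent of only m, and descents are at least
    -- m + 1.
    gaps-sum-≡ : 1 ≤ m → ∀ n xs → length xs ≡ n → AllPairs (Gap (suc m)) xs → sum xs ≡ m * (n C 2) →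
      xs ≡ progression 0 n
    gaps-sum-≡ 1≤m zero [] e gs s = refl
    gaps-sum-≡ 1≤m (suc n) (y ∷ ys) e gs s with delete-small (n≤1+n m) y ys gs
    ... | x , rest , d , ms , gs′ = first d rest≡ x≡0 gs
      where
      S = sum (lower rest)
      x+S : x + S ≡ m * (n C 2)
      x+S = +-cancelˡ-≡ (n * m) (x + S) (m * (n C 2)) (trans (sym (sum-split d ms e)) (trans s (triangle n)))
      S≥ : m * (n C 2) ≤ S
      S≥ = gaps-sum-≥ (n≤1+n m) n (lower rest) (lower-length d e) (lower-gaps ms gs′)
      S≡ : S ≡ m * (n C 2)
      S≡ = ≤-antisym (≤-trans (m≤n+m S x) (≤-reflexive x+S)) S≥
      x≡0 : x ≡ 0
      x≡0 = +-cancelʳ-≡ S x 0 (trans x+S (sym S≡))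
      rest≡ : rest ≡ progression m n
      rest≡ = trans (sym (lower-inverse ms)) (trans
        (cong (map (_+ m)) (gaps-sum-≡ 1≤m n (lower rest) (lower-length d e) (lower-gaps ms gs′) S≡))
        (map-progression 0 n))
      first : ∀ {x rest xs n} → Deletion x rest xs → rest ≡ progression m n → x ≡ 0 →
        AllPairs (Gap (suc m)) xs → xs ≡ progression 0 (suc n)
      first here refl refl gs = refl
      first {n = suc n} (there d) refl refl (g ∷ gs) with deletion-deleted d g
      ... | inj₁ le = contradiction (≤-trans 1≤m (≤-trans (m≤m+n m m) le)) λ ()
      ... | inj₂ le = contradiction le 1+n≰n

    -- The reflection reverses the order, so an ascent of m becomes a descent of m, and the stricter
    -- bound for descents is lost.
    complement-gap : ∀ {N x y} → x ≤ N → y ≤ N → Gap (suc m) x y → Gap m (N ∸ x) (N ∸ y)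
    complement-gap {N} {x} {y} x≤N y≤N (inj₁ le) = inj₂ (reflect x≤N y≤N le)
      where
      reflect : ∀ {x y} → x ≤ N → y ≤ N → x + m ≤ y → N ∸ y + m ≤ N ∸ x
      reflect {x} {y} x≤N y≤N le = m+n≤o⇒m≤o∸n (N ∸ y + m) (begin
        N ∸ y + m + x      ≡⟨ +-assoc (N ∸ y) m x ⟩
        N ∸ y + (m + x)    ≤⟨ +-monoʳ-≤ (N ∸ y) (subst (_≤ y) (+-comm x m) le) ⟩
        N ∸ y + y          ≡⟨ m∸n+n≡m y≤N ⟩
        N                  ∎)
        where open ≤-Reasoning
    complement-gap {N} {x} {y} x≤N y≤N (inj₂ le) = inj₁ (m+n≤o⇒m≤o∸n (N ∸ x + m) (begin
        N ∸ x + m + y      ≡⟨ +-assoc (N ∸ x) m y ⟩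
        N ∸ x + (m + y)    ≤⟨ +-monoʳ-≤ (N ∸ x) (≤-trans (n≤1+n (m + y)) (subst (_≤ x) (+-comm y (suc m)) le)) ⟩
        N ∸ x + x          ≡⟨ m∸n+n≡m x≤N ⟩
        N                  ∎))
      where open ≤-Reasoning

    -- The lower bound, applied to the reflected numbers N - x.
    gaps-sum-≤ : ∀ {N n} xs → length xs ≡ n → All (_≤ N) xs → AllPairs (Gap (suc m)) xs → sum xs + m * (n C 2) ≤ n * N
    gaps-sum-≤ {N} {n} xs refl le gs = begin
      sum xs + m * (n C 2)            ≤⟨ +-monoʳ-≤ (sum xs) (gaps-sum-≥ ≤-refl n (map (N ∸_) xs) (length-map _ xs) (complement le gs)) ⟩
      sum xs + sum (map (N ∸_) xs)    ≡⟨ total le ⟩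
      n * N                           ∎
      where
      open ≤-Reasoning
      complement : ∀ {xs} → All (_≤ N) xs → AllPairs (Gap (suc m)) xs → AllPairs (Gap m) (map (N ∸_) xs)
      complement [] [] = []
      complement (p ∷ ps) (g ∷ gs) = row p ps g ∷ complement ps gs
        where
        row : ∀ {x ys} → x ≤ N → All (_≤ N) ys → All (Gap (suc m) x) ys → All (Gap m (N ∸ x)) (map (N ∸_) ys)
        row p [] [] = []
        row p (q ∷ qs) (g ∷ gs) = complement-gap p q g ∷ row p qs gs
      total : ∀ {xs} → All (_≤ N) xs → sum xs + sum (map (N ∸_) xs) ≡ length xs * N
      total [] = refl
      total {x ∷ xs} (p ∷ ps) = begin-equality
        x + sum xs + (N ∸ x + sum (map (N ∸_) xs))
          ≡⟨ solve 4 (λ x s y t → x :+ s :+ (y :+ t) := (x :+ y) :+ (s :+ t)) refl x (sum xs) (N ∸ x) (sum (map (N ∸_) xs)) ⟩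
        x + (N ∸ x) + (sum xs + sum (map (N ∸_) xs))
          ≡⟨ cong₂ _+_ (m+[n∸m]≡n p) (total ps) ⟩
        N + length xs * N ∎
        where open +-*-Solver

    sum-progression : ∀ a n → sum (progression a n) ≡ n * a + m * (n C 2)
    sum-progression a zero = sym (*-zeroʳ m)
    sum-progression a (suc n) = begin-equality
      a + sum (progression (a + m) n)       ≡⟨ cong (a +_) (sum-progression (a + m) n) ⟩
      a + (n * (a + m) + m * (n C 2))       ≡⟨ solve 4 (λ a n m t → a :+ (n :* (a :+ m) :+ t) := a :+ n :* a :+ (n :* m :+ t)) refl a n m (m * (n C 2)) ⟩
      suc n * a + (n * m + m * (n C 2))     ≡⟨ cong (suc n * a +_) (triangle n) ⟨
      suc n * a + m * (suc n C 2)           ∎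
      where
      open ≤-Reasoning
      open +-*-Solver

-- The mixed difference on the grid, carried by a single point.

module GridEvaluation where

  open FiniteDifferences
  open SeparatedNumbers

  open import Data.Integer using (+_; _+_; _*_; _-_; -_)
  open import Data.Integer.Solver using (module +-*-Solver)
  open import Data.List.Relation.Unary.AllPairs using (AllPairs)
  open import Data.Nat.ListAction using (sum)
  import Data.Nat.Solver as ℕ-Solver
  open import Relation.Binary.PropositionalEquality using (refl; sym; trans; cong; cong₂)

  open Ops ℤ.+-*-commutativeRing using (ι; ff; sgn; ∏)
  open Assembly ℤ.+-*-commutativeRing using (run-powers; falling∏)
  open Antisymmetry ℤ.+-*-commutativeRing using (diff; ffs; run; monic; Δ^)
  open Signs ℤ.+-*-commutativeRing using (sgn-+; sgn-2*; ∏-suc; ∏-last)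
  open +-*-Solver using (solve; _:=_; _:+_; _:*_; :-_; _:-_; con)
  open ≡.≡-Reasoning

  length-upper : ∀ n → List.length (upper n) ≡ n C 2
  length-upper zero = refl
  length-upper (suc n) = begin
    List.length (firstRow n ++ List.map (both suc) (upper n))
      ≡⟨ List.length-++ (firstRow n) ⟩
    List.length (firstRow n) ℕ.+ List.length (List.map (both suc) (upper n))
      ≡⟨ cong₂ ℕ._+_ (trans (List.length-map _ (allFin n)) (List.length-tabulate {n = n} id)) (trans (List.length-map _ (upper n)) (length-upper n)) ⟩
    n ℕ.+ n C 2
      ≡⟨ [1+n]C2 n ⟨
    suc n C 2 ∎

  sum-toList : ∀ {n} (v : Vec ℕ n) → Vec.sum v ≡ sum (toList v)
  sum-toList [] = refl
  sum-toList (k ∷ v) = cong (k ℕ.+_) (sum-toList v)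

  -- The weight of a grid point in the difference of order (N,…,N).
  weight : ∀ {n} → ℕ → Vec ℕ n → ℤ
  weight N [] = + 1
  weight N (c ∷ w) = sgn (N ℕ.+ c) * + (N C c) * weight N w

  Λ-vanish : ∀ {n} N (F : Vec ℕ n → ℤ) → (∀ c → All (ℕ._≤ N) (toList c) → F c ≡ + 0) →
    Λ (Vec.replicate n N) F ≡ + 0
  Λ-vanish {zero} N F F0 = F0 [] []
  Λ-vanish {suc n} N F F0 = trans (D-local N (λ {c} le → Λ-vanish N (F ∘ (c ∷_)) (λ cs les → F0 (c ∷ cs) (le ∷ les)))) (D-0 N)

  -- `D-single` in each coordinate. If an entry of `w` exceeds N, the point is off the grid and the
  -- binomial coefficient in `weight` is 0 as well.
  Λ-single : ∀ {n} N (w : Vec ℕ n) (F : Vec ℕ n → ℤ) →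
    (∀ c → All (ℕ._≤ N) (toList c) → c ≢ w → F c ≡ + 0) → Λ (Vec.replicate n N) F ≡ weight N w * F w
  Λ-single N [] F F0 = sym (ℤ.*-identityˡ (F []))
  Λ-single {suc n} N (c₀ ∷ w) F F0 = trans (D-single N c₀ f vanish) (first (c₀ ℕ.≤? N))
    where
    f : ℕ → ℤ
    f c = Λ (Vec.replicate n N) (F ∘ (c ∷_))
    vanish : ∀ {c} → c ℕ.≤ N → c ≢ c₀ → f c ≡ + 0
    vanish {c} le ne = Λ-vanish N (F ∘ (c ∷_)) (λ cs les → F0 (c ∷ cs) (le ∷ les) (ne ∘ Vec.∷-injectiveˡ))
    first : Dec (c₀ ℕ.≤ N) → sgn (N ℕ.+ c₀) * + (N C c₀) * f c₀ ≡ weight N (c₀ ∷ w) * F (c₀ ∷ w)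
    first (yes le) = trans
      (cong (sgn (N ℕ.+ c₀) * + (N C c₀) *_) (Λ-single N w (F ∘ (c₀ ∷_)) (λ cs les ne → F0 (c₀ ∷ cs) (le ∷ les) (ne ∘ Vec.∷-injectiveʳ))))
      (sym (ℤ.*-assoc (sgn (N ℕ.+ c₀) * + (N C c₀)) (weight N w) _))
    first (no ≰) = begin
      sgn (N ℕ.+ c₀) * + (N C c₀) * f c₀                          ≡⟨ cong (λ b → sgn (N ℕ.+ c₀) * + b * f c₀) none ⟩
      sgn (N ℕ.+ c₀) * + 0 * f c₀
        ≡⟨ solve 4 (λ s f w g → s :* con (+ 0) :* f := s :* con (+ 0) :* w :* g) refl (sgn (N ℕ.+ c₀)) (f c₀) (weight N w) (F (c₀ ∷ w)) ⟩
      sgn (N ℕ.+ c₀) * + 0 * weight N w * F (c₀ ∷ w)              ≡⟨ cong (λ b → sgn (N ℕ.+ c₀) * + b * weight N w * F (c₀ ∷ w)) none ⟨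
      weight N (c₀ ∷ w) * F (c₀ ∷ w)                              ∎
      where none = k>n⇒nCk≡0 (ℕ.≰⇒> ≰)

  ∏ᵛ : ∀ {n} → (ℕ → ℤ) → Vec ℕ n → ℤ
  ∏ᵛ G [] = + 1
  ∏ᵛ G (c ∷ w) = G c * ∏ᵛ G w

  -- Clearing the denominators of the binomials C(N,c) leaves (N)_c; at the surviving point these
  -- are the (x)_{rm} of the theorem.
  weight-! : ∀ {n} N (w : Vec ℕ n) →
    weight N w * ∏ᵛ (λ c → + (c !)) w ≡ sgn (n ℕ.* N ℕ.+ Vec.sum w) * ∏ᵛ (ff (+ N)) w
  weight-! N [] = refl
  weight-! {suc n} N (c ∷ w) = begin
    sgn (N ℕ.+ c) * + (N C c) * weight N w * (+ (c !) * ∏ᵛ (λ c → + (c !)) w)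
      ≡⟨ solve 5 (λ s b w f p → s :* b :* w :* (f :* p) := s :* (b :* f) :* (w :* p)) refl
           (sgn (N ℕ.+ c)) (+ (N C c)) (weight N w) (+ (c !)) (∏ᵛ (λ c → + (c !)) w) ⟩
    sgn (N ℕ.+ c) * (+ (N C c) * + (c !)) * (weight N w * ∏ᵛ (λ c → + (c !)) w)
      ≡⟨ cong₂ (λ x y → sgn (N ℕ.+ c) * x * y) (binomial-! N c) (weight-! N w) ⟩
    sgn (N ℕ.+ c) * ff (+ N) c * (sgn (n ℕ.* N ℕ.+ Vec.sum w) * ∏ᵛ (ff (+ N)) w)
      ≡⟨ solve 4 (λ s f t p → s :* f :* (t :* p) := s :* t :* (f :* p)) refl
           (sgn (N ℕ.+ c)) (ff (+ N) c) (sgn (n ℕ.* N ℕ.+ Vec.sum w)) (∏ᵛ (ff (+ N)) w) ⟩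
    sgn (N ℕ.+ c) * sgn (n ℕ.* N ℕ.+ Vec.sum w) * ∏ᵛ (ff (+ N)) (c ∷ w)
      ≡⟨ cong (_* ∏ᵛ (ff (+ N)) (c ∷ w)) (trans (sym (sgn-+ (N ℕ.+ c) _)) (cong sgn rearrange)) ⟩
    sgn (suc n ℕ.* N ℕ.+ Vec.sum (c ∷ w)) * ∏ᵛ (ff (+ N)) (c ∷ w) ∎
    where
    rearrange : N ℕ.+ c ℕ.+ (n ℕ.* N ℕ.+ Vec.sum w) ≡ N ℕ.+ n ℕ.* N ℕ.+ (c ℕ.+ Vec.sum w)
    rearrange = ℕ+ 4 (λ a b c d → a :+ₙ b :+ₙ (c :+ₙ d) :=ₙ a :+ₙ c :+ₙ (b :+ₙ d)) refl N c (n ℕ.* N) (Vec.sum w)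
      where open ℕ-Solver.+-*-Solver renaming (solve to ℕ+; _:+_ to _:+ₙ_; _:=_ to _:=ₙ_)

  ∏ᵛ-!≢0 : ∀ {n} (w : Vec ℕ n) → ∏ᵛ (λ c → + (c !)) w ≢ + 0
  ∏ᵛ-!≢0 [] ()
  ∏ᵛ-!≢0 (c ∷ w) e with ℤ.i*j≡0⇒i≡0∨j≡0 (+ (c !)) e
  ... | inj₁ e′ = contradiction (ℤ.+-injective e′) (ℕ.≢-nonZero⁻¹ (c !) {{ℕ._!≢0 c}})
  ... | inj₂ e′ = ∏ᵛ-!≢0 w e′

  module Grid (m : ℕ) (1≤m : 1 ℕ.≤ m) where
    open Gaps m

    -- Nonzero only if y ≥ x + m or x > y + m; the asymmetry forces separated points of minimal sum to increase.
    θ : ℕ → ℕ → ℤ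
    θ x y = ff (+ y - + x + + m) (2 ℕ.* m)

    -- The argument y - x + m lies among 0, ..., 2m - 1, the zeros of the falling factorial.
    θ-vanish : ∀ {x y} → y ℕ.< x ℕ.+ m → x ℕ.≤ y ℕ.+ m → θ x y ≡ + 0
    θ-vanish {x} {y} y<x+m x≤y+m = trans (cong (λ z → ff z (2 ℕ.* m)) eq) (ff-vanish bound)
      where
      eq : + y - + x + + m ≡ + (y ℕ.+ m ℕ.∸ x)
      eq = begin
        + y - + x + + m         ≡⟨ solve 3 (λ y x m → y :- x :+ m := (y :+ m) :- x) refl (+ y) (+ x) (+ m) ⟩
        + (y ℕ.+ m) - + x       ≡⟨ ℤ.m-n≡m⊖n (y ℕ.+ m) x ⟩
        (y ℕ.+ m) ℤ.⊖ x         ≡⟨ ℤ.⊖-≥ x≤y+m ⟩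
        + (y ℕ.+ m ℕ.∸ x)       ∎
      bound : y ℕ.+ m ℕ.∸ x ℕ.< 2 ℕ.* m
      bound = ℕ.+-cancelʳ-< x _ _ (≡.subst₂ ℕ._<_ (sym (ℕ.m∸n+n≡m x≤y+m)) twice (ℕ.+-monoˡ-< m y<x+m))
        where
        twice : x ℕ.+ m ℕ.+ m ≡ 2 ℕ.* m ℕ.+ x
        twice = ℕ+ 2 (λ x m → x :+ₙ m :+ₙ m :=ₙ (m :+ₙ (m :+ₙ conₙ 0)) :+ₙ x) refl x m
          where open ℕ-Solver.+-*-Solver renaming (solve to ℕ+; _:+_ to _:+ₙ_; _:=_ to _:=ₙ_; con to conₙ)

    θ-gap : ∀ x y → θ x y ≡ + 0 ⊎ Gap (suc m) x y
    θ-gap x y with x ℕ.+ m ℕ.≤? y | y ℕ.+ suc m ℕ.≤? x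
    ... | yes le | _ = inj₂ (inj₁ le)
    ... | no _ | yes le = inj₂ (inj₂ le)
    ... | no ≰₁ | no ≰₂ = inj₁ (θ-vanish (ℕ.≰⇒> ≰₁) (ℕ.s≤s⁻¹ (≡.subst (x ℕ.<_) (ℕ.+-suc y m) (ℕ.≰⇒> ≰₂))))

    row : ℕ → List ℕ → ℤ
    row x [] = + 1
    row x (y ∷ ys) = θ x y * row x ys

    table : List ℕ → ℤ
    table [] = + 1
    table (x ∷ xs) = row x xs * table xs

    row-gaps : ∀ x ys → row x ys ≡ + 0 ⊎ All (Gap (suc m) x) ys
    row-gaps x [] = inj₂ []
    row-gaps x (y ∷ ys) with θ-gap x y | row-gaps x ys
    ... | inj₁ e | _ = inj₁ (cong (_* row x ys) e)
    ... | inj₂ _ | inj₁ e = inj₁ (trans (cong (θ x y *_) e) (ℤ.*-zeroʳ (θ x y)))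
    ... | inj₂ g | inj₂ gs = inj₂ (g ∷ gs)

    table-gaps : ∀ xs → table xs ≡ + 0 ⊎ AllPairs (Gap (suc m)) xs
    table-gaps [] = inj₂ []
    table-gaps (x ∷ xs) with row-gaps x xs | table-gaps xs
    ... | inj₁ e | _ = inj₁ (cong (_* table xs) e)
    ... | inj₂ _ | inj₁ e = inj₁ (trans (cong (row x xs *_) e) (ℤ.*-zeroʳ (row x xs)))
    ... | inj₂ g | inj₂ gs = inj₂ (g ∷ gs)

    -- For r = 2m these are the affine factors of `θ`, all with the leading form x_j - x_i of the
    -- pair.
    block : ∀ {n} → Pair n → ℕ → List (Pair n × ℤ)
    block p zero = []
    block p (suc r) = (p , + m - ι r) ∷ block p r

    blocks : ∀ {n} → List (Pair n) → List (Pair n × ℤ)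
    blocks = concatMap (λ p → block p (2 ℕ.* m))

    affines-block : ∀ {n} (p : Pair n) r L F c → affines (block p r ++ L) F c
      ≡ ff (+ lookup c (proj₂ p) - + lookup c (proj₁ p) + + m) r * affines L F c
    affines-block p zero L F c = sym (ℤ.*-identityˡ _)
    affines-block p@(i , j) (suc r) L F c = begin
      affine p (+ m - ι r) c * affines (block p r ++ L) F c
        ≡⟨ cong (affine p (+ m - ι r) c *_) (affines-block p r L F c) ⟩
      (z + (+ m - ι r)) * (ff (z + + m) r * affines L F c)
        ≡⟨ solve 5 (λ z m r f a → (z :+ (m :- r)) :* (f :* a) := f :* (z :+ m :- r) :* a) refl z (+ m) (ι r) (ff (z + + m) r) (affines L F c) ⟩
      ff (z + + m) (suc r) * affines L F c ∎
      where z = + lookup c j - + lookup c i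

    ∏θ : ∀ {n} → List (Pair n) → Vec ℕ n → ℤ
    ∏θ P c = List.foldr (λ p z → θ (lookup c (proj₁ p)) (lookup c (proj₂ p)) * z) (+ 1) P

    affines-blocks : ∀ {n} (P : List (Pair n)) F c → affines (blocks P) F c ≡ ∏θ P c * F c
    affines-blocks [] F c = sym (ℤ.*-identityˡ (F c))
    affines-blocks (p ∷ P) F c = trans (affines-block p (2 ℕ.* m) (blocks P) F c)
      (trans (cong (θ (lookup c (proj₁ p)) (lookup c (proj₂ p)) *_) (affines-blocks P F c)) (sym (ℤ.*-assoc (θ (lookup c (proj₁ p)) (lookup c (proj₂ p))) _ _)))

    ∏θ-++ : ∀ {n} (P Q : List (Pair n)) c → ∏θ (P ++ Q) c ≡ ∏θ P c * ∏θ Q c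
    ∏θ-++ [] Q c = sym (ℤ.*-identityˡ (∏θ Q c))
    ∏θ-++ (p ∷ P) Q c = trans (cong (t *_) (∏θ-++ P Q c)) (sym (ℤ.*-assoc t (∏θ P c) (∏θ Q c)))
      where t = θ (lookup c (proj₁ p)) (lookup c (proj₂ p))

    ∏θ-row : ∀ {n} (js : List (Fin n)) x c → ∏θ (List.map (λ j → zero , suc j) js) (x ∷ c) ≡ row x (List.map (lookup c) js)
    ∏θ-row [] x c = refl
    ∏θ-row (j ∷ js) x c = cong (θ x (lookup c j) *_) (∏θ-row js x c)

    ∏θ-both-suc : ∀ {n} (P : List (Pair n)) x c → ∏θ (List.map (both suc) P) (x ∷ c) ≡ ∏θ P c
    ∏θ-both-suc [] x c = refl
    ∏θ-both-suc (p ∷ P) x c = cong (θ (lookup c (proj₁ p)) (lookup c (proj₂ p)) *_) (∏θ-both-suc P x c)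

    ∏θ-upper : ∀ {n} (c : Vec ℕ n) → ∏θ (upper n) c ≡ table (toList c)
    ∏θ-upper [] = refl
    ∏θ-upper {suc n} (x ∷ c) = begin
      ∏θ (firstRow n ++ List.map (both suc) (upper n)) (x ∷ c)
        ≡⟨ ∏θ-++ (firstRow n) _ (x ∷ c) ⟩
      ∏θ (firstRow n) (x ∷ c) * ∏θ (List.map (both suc) (upper n)) (x ∷ c)
        ≡⟨ cong₂ _*_ (trans (∏θ-row (allFin n) x c) (cong (row x) (toList-lookup c))) (trans (∏θ-both-suc (upper n) x c) (∏θ-upper c)) ⟩
      table (toList (x ∷ c)) ∎

    length-blocks : ∀ {n} (P : List (Pair n)) → List.length (blocks P) ≡ List.length P ℕ.* (2 ℕ.* m)
    length-blocks [] = refl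
    length-blocks (p ∷ P) = trans (List.length-++ (block p (2 ℕ.* m))) (cong₂ ℕ._+_ (len (2 ℕ.* m)) (length-blocks P))
      where
      len : ∀ r → List.length (block p r) ≡ r
      len zero = refl
      len (suc r) = cong suc (len r)

    forms-blocks : ∀ {n} (P : List (Pair n)) →
      List.map monic (List.map proj₁ (blocks P)) ≡ concatMap (λ p → List.replicate (2 ℕ.* m) (monic p)) P
    forms-blocks P = begin
      List.map monic (List.map proj₁ (blocks P))
        ≡⟨ List.map-∘ (blocks P) ⟨
      List.map (monic ∘ proj₁) (blocks P)
        ≡⟨ List.map-concatMap (monic ∘ proj₁) (λ p → block p (2 ℕ.* m)) P ⟩
      concatMap (λ p → List.map (monic ∘ proj₁) (block p (2 ℕ.* m))) P
        ≡⟨ List.concatMap-cong (λ p → const p (2 ℕ.* m)) P ⟩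
      concatMap (λ p → List.replicate (2 ℕ.* m) (monic p)) P ∎
      where
      const : ∀ {n} (p : Pair n) r → List.map (monic ∘ proj₁) (block p r) ≡ List.replicate r (monic p)
      const p zero = refl
      const p (suc r) = cong (monic p ∷_) (const p r)

    progressionᵛ : ℕ → ∀ n → Vec ℕ n
    progressionᵛ a zero = []
    progressionᵛ a (suc n) = a ∷ progressionᵛ (a ℕ.+ m) n

    toList-progression : ∀ a n → toList (progressionᵛ a n) ≡ progression a n
    toList-progression a zero = refl
    toList-progression a (suc n) = cong (a ∷_) (toList-progression (a ℕ.+ m) n)

    ∏ᵛ-progression : ∀ G a n → ∏ᵛ G (progressionᵛ a n) ≡ ∏ (List.map (λ r → G (a ℕ.+ toℕ r ℕ.* m)) (allFin n))
    ∏ᵛ-progression G a zero = refl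
    ∏ᵛ-progression G a (suc n) = begin
      G a * ∏ᵛ G (progressionᵛ (a ℕ.+ m) n)
        ≡⟨ cong₂ _*_ (cong G (sym (ℕ.+-identityʳ a))) (∏ᵛ-progression G (a ℕ.+ m) n) ⟩
      G (a ℕ.+ 0) * ∏ (List.map (λ r → G (a ℕ.+ m ℕ.+ toℕ r ℕ.* m)) (allFin n))
        ≡⟨ cong (λ l → G (a ℕ.+ 0) * ∏ l) (List.map-cong (λ r → cong G (ℕ.+-assoc a m (toℕ r ℕ.* m))) (allFin n)) ⟩
      G (a ℕ.+ 0) * ∏ (List.map (λ r → G (a ℕ.+ suc (toℕ r) ℕ.* m)) (allFin n))
        ≡⟨ ∏-suc (λ k → G (a ℕ.+ k ℕ.* m)) n ⟨
      ∏ (List.map (λ r → G (a ℕ.+ toℕ r ℕ.* m)) (allFin (suc n))) ∎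

    fact : ℕ → ℤ
    fact k = + ((k ℕ.* m) !)

    -- Telescoping: the factor at distance d m is ((d+1) m)! / ((d−1) m)!.
    row-progression : ∀ x a n → row x (progression (x ℕ.+ suc a ℕ.* m) n) * (fact (suc a) * fact a)
      ≡ fact (suc a ℕ.+ n) * fact (a ℕ.+ n)
    row-progression x a zero = trans (ℤ.*-identityˡ _)
      (cong₂ (λ k l → fact k * fact l) (sym (ℕ.+-identityʳ (suc a))) (sym (ℕ.+-identityʳ a)))
    row-progression x a (suc n) = begin
      θ x y * row x (progression (y ℕ.+ m) n) * (fact (suc a) * fact a)
        ≡⟨ cong (λ z → θ x y * row x (progression z n) * (fact (suc a) * fact a)) next ⟩
      θ x y * R * (fact (suc a) * fact a)
        ≡⟨ solve 4 (λ t r b a → t :* r :* (b :* a) := r :* (t :* a :* b)) refl (θ x y) R (fact (suc a)) (fact a) ⟩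
      R * (θ x y * fact a * fact (suc a))
        ≡⟨ cong (λ z → R * (z * fact (suc a))) θ-fact ⟩
      R * (fact (suc (suc a)) * fact (suc a))
        ≡⟨ row-progression x (suc a) n ⟩
      fact (suc (suc a) ℕ.+ n) * fact (suc a ℕ.+ n)
        ≡⟨ cong₂ (λ k l → fact k * fact l) (sym (ℕ.+-suc (suc a) n)) (sym (ℕ.+-suc a n)) ⟩
      fact (suc a ℕ.+ suc n) * fact (a ℕ.+ suc n) ∎
      where
      y = x ℕ.+ suc a ℕ.* m
      R = row x (progression (x ℕ.+ suc (suc a) ℕ.* m) n)
      next : y ℕ.+ m ≡ x ℕ.+ suc (suc a) ℕ.* m
      next = trans (ℕ.+-assoc x (suc a ℕ.* m) m) (cong (x ℕ.+_) (ℕ.+-comm (suc a ℕ.* m) m))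
      2+a : 2 ℕ.* m ℕ.+ a ℕ.* m ≡ suc (suc a) ℕ.* m
      2+a = sym (ℕ.*-distribʳ-+ m 2 a)
      argument : + y - + x + + m ≡ + (2 ℕ.* m ℕ.+ a ℕ.* m)
      argument = begin
        + x + + (suc a ℕ.* m) - + x + + m
          ≡⟨ solve 3 (λ x a m → x :+ a :- x :+ m := m :+ a) refl (+ x) (+ (suc a ℕ.* m)) (+ m) ⟩
        + (suc (suc a) ℕ.* m)
          ≡⟨ cong +_ 2+a ⟨
        + (2 ℕ.* m ℕ.+ a ℕ.* m) ∎
      θ-fact : θ x y * fact a ≡ fact (suc (suc a))
      θ-fact = begin
        θ x y * fact a                                                    ≡⟨ cong (λ z → ff z (2 ℕ.* m) * fact a) argument ⟩
        ff (+ (2 ℕ.* m ℕ.+ a ℕ.* m)) (2 ℕ.* m) * + ((a ℕ.* m) !)          ≡⟨ ff-! (2 ℕ.* m) (a ℕ.* m) ⟩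
        + ((2 ℕ.* m ℕ.+ a ℕ.* m) !)                                       ≡⟨ cong (λ k → + (k !)) 2+a ⟩
        fact (suc (suc a))                                                ∎

    numerator : ℕ → ℤ
    numerator n = ∏ (List.map (λ k → fact (suc (toℕ k))) (allFin n))

    low : ℕ → ℤ
    low n = ∏ (List.map (λ k → fact (toℕ k)) (allFin n))

    -- The row of the head contributes ((n+1)m)! (nm)! / m!. The larger factorials collect into the
    -- constant of the theorem, the smaller ones into `low`, which is ∏ c! over the progression and
    -- cancels against the binomial weights.
    table-progression : ∀ x n → table (progression x n) * + ((m !) ℕ.^ n) ≡ numerator n * low n
    table-progression x zero = refl
    table-progression x (suc n) = begin
      r * table (progression (x ℕ.+ m) n) * + ((m !) ℕ.* (m !) ℕ.^ n)
        ≡⟨ cong (r * table (progression (x ℕ.+ m) n) *_) (ℤ.pos-* (m !) ((m !) ℕ.^ n)) ⟩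
      r * table (progression (x ℕ.+ m) n) * (+ (m !) * + ((m !) ℕ.^ n))
        ≡⟨ solve 4 (λ r t f p → r :* t :* (f :* p) := r :* (f :* con (+ 1)) :* (t :* p)) refl r (table (progression (x ℕ.+ m) n)) (+ (m !)) (+ ((m !) ℕ.^ n)) ⟩
      r * (+ (m !) * + 1) * (table (progression (x ℕ.+ m) n) * + ((m !) ℕ.^ n))
        ≡⟨ cong₂ _*_ first (table-progression (x ℕ.+ m) n) ⟩
      fact (suc n) * fact n * (numerator n * low n)
        ≡⟨ solve 4 (λ a b c d → a :* b :* (c :* d) := (c :* a) :* (d :* b)) refl (fact (suc n)) (fact n) (numerator n) (low n) ⟩
      (numerator n * fact (suc n)) * (low n * fact n)
        ≡⟨ cong₂ _*_ (∏-last (fact ∘ suc) n) (∏-last fact n) ⟨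
      numerator (suc n) * low (suc n) ∎
      where
      r = row x (progression (x ℕ.+ m) n)
      first : r * (+ (m !) * + 1) ≡ fact (suc n) * fact n
      first = ≡.subst (λ k → row x (progression (x ℕ.+ k) n) * (+ (k !) * + 1) ≡ fact (suc n) * fact n)
        (ℕ.+-identityʳ m) (row-progression x 0 n)

    ι-numConst : ∀ n → ι (numConst m n) ≡ numerator n
    ι-numConst n = trans (ι≡+ (numConst m n)) (product (allFin n))
      where
      product : ∀ {n} (ks : List (Fin n)) →
        + ∏ℕ (List.map (λ k → (suc (toℕ k) ℕ.* m) !) ks) ≡ ∏ (List.map (λ k → fact (suc (toℕ k))) ks)
      product [] = refl
      product (k ∷ ks) = trans (ℤ.pos-* ((suc (toℕ k) ℕ.* m) !) _) (cong (fact (suc (toℕ k)) *_) (product ks))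

    -- K is the degree left for the power of the sum when the total degree is nN.
    module _ (n N K : ℕ) (size : K ℕ.+ 2 ℕ.* (m ℕ.* (n C 2)) ≡ n ℕ.* N) where

      private
        s₀ = m ℕ.* (n C 2)
        -- With this shift `φ` is zero at the sums s₀ + 1, ..., s₀ + K, and at the sum s₀ it equals
        -- (-1)_K, which is nonzero.
        open LeadingForm N K (+ suc s₀)
        w = progressionᵛ 0 n
        L = blocks (upper n)

        F : Vec ℕ n → ℤ
        F c = table (toList c) * φ c

        affines≡F : ∀ c → affines L φ c ≡ F c
        affines≡F c = trans (affines-blocks (upper n) φ c) (cong (_* φ c) (∏θ-upper c))

        sum-w : Vec.sum w ≡ s₀
        sum-w = begin
          Vec.sum w                 ≡⟨ sum-toList w ⟩
          sum (toList w)            ≡⟨ cong sum (toList-progression 0 n) ⟩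
          sum (progression 0 n)     ≡⟨ sum-progression 0 n ⟩
          n ℕ.* 0 ℕ.+ s₀            ≡⟨ cong (ℕ._+ s₀) (ℕ.*-zeroʳ n) ⟩
          s₀                        ∎

        -- Separated points have coordinate sum between s₀ and s₀ + K.
        φ-vanish : ∀ (c : Vec ℕ n) → suc s₀ ℕ.≤ Vec.sum c → Vec.sum c ℕ.+ s₀ ℕ.≤ n ℕ.* N → φ c ≡ + 0
        φ-vanish c lo hi = trans (cong (λ z → ff z K) (trans (ℤ.m-n≡m⊖n (Vec.sum c) (suc s₀)) (ℤ.⊖-≥ lo)))
          (ff-vanish (ℕ.+-cancelʳ-< (suc s₀) _ _ (≡.subst (ℕ._< K ℕ.+ suc s₀) (sym (ℕ.m∸n+n≡m lo))
            (≡.subst (Vec.sum c ℕ.<_) (sym (ℕ.+-suc K s₀)) (ℕ.s≤s (ℕ.+-cancelʳ-≤ s₀ _ _ (≡.subst (Vec.sum c ℕ.+ s₀ ℕ.≤_) total hi)))))))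
          where
          total : n ℕ.* N ≡ K ℕ.+ s₀ ℕ.+ s₀
          total = trans (sym size) (trans (cong (λ k → K ℕ.+ (s₀ ℕ.+ k)) (ℕ.+-identityʳ s₀)) (sym (ℕ.+-assoc K s₀ s₀)))

        F-vanish : ∀ c → All (ℕ._≤ N) (toList c) → c ≢ w → F c ≡ + 0
        F-vanish c le ne with table-gaps (toList c)
        ... | inj₁ e = cong (_* φ c) e
        ... | inj₂ gaps = trans (cong (table (toList c) *_) (φ-vanish c above below)) (ℤ.*-zeroʳ (table (toList c)))
          where
          below : Vec.sum c ℕ.+ s₀ ℕ.≤ n ℕ.* N
          below = ≡.subst (λ k → k ℕ.+ s₀ ℕ.≤ n ℕ.* N) (sym (sum-toList c)) (gaps-sum-≤ (toList c) (Vec.length-toList c) le gaps)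
          above : suc s₀ ℕ.≤ Vec.sum c
          above = ℕ.≤∧≢⇒< (≡.subst (s₀ ℕ.≤_) (sym (sum-toList c)) (gaps-sum-≥ (ℕ.n≤1+n m) n (toList c) (Vec.length-toList c) gaps))
            λ e → ne (trans (sym (Vec.cast-is-id refl c)) (Vec.toList-injective refl c w
              (trans (gaps-sum-≡ 1≤m n (toList c) (Vec.length-toList c) gaps (trans (sym (sum-toList c)) (sym e))) (sym (toList-progression 0 n)))))

        φ-w : φ w ≡ sgn K * + (K !)
        φ-w = trans (cong (λ z → ff z K) (begin
          + Vec.sum w - + suc s₀     ≡⟨ cong (λ k → + k - + suc s₀) sum-w ⟩
          + s₀ - + suc s₀            ≡⟨ solve 1 (λ s → s :- (con (+ 1) :+ s) := :- con (+ 1)) refl (+ s₀) ⟩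
          - (+ 1)                    ∎)) (ff-neg1 K)

        order : Vec.sum (rest (zeros {n})) ≡ List.length L ℕ.+ K
        order = begin
          Vec.sum (rest (zeros {n}))              ≡⟨ cong Vec.sum (Vec.map-replicate (N ℕ.∸_) 0 n) ⟩
          Vec.sum (Vec.replicate n N)             ≡⟨ sum-replicate n ⟩
          n ℕ.* N                                 ≡⟨ size ⟨
          K ℕ.+ 2 ℕ.* (m ℕ.* (n C 2))
            ≡⟨ ℕ+ 3 (λ K m t → K :+ₙ conₙ 2 :*ₙ (m :*ₙ t) :=ₙ t :*ₙ (conₙ 2 :*ₙ m) :+ₙ K) refl K m (n C 2) ⟩
          (n C 2) ℕ.* (2 ℕ.* m) ℕ.+ K             ≡⟨ cong (λ k → k ℕ.* (2 ℕ.* m) ℕ.+ K) (length-upper n) ⟨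
          List.length (upper n) ℕ.* (2 ℕ.* m) ℕ.+ K ≡⟨ cong (ℕ._+ K) (length-blocks (upper n)) ⟨
          List.length L ℕ.+ K                     ∎
          where
          open ℕ-Solver.+-*-Solver renaming (solve to ℕ+; _:+_ to _:+ₙ_; _:*_ to _:*ₙ_; _:=_ to _:=ₙ_; con to conₙ)
          sum-replicate : ∀ n → Vec.sum (Vec.replicate n N) ≡ n ℕ.* N
          sum-replicate zero = refl
          sum-replicate (suc n) = cong (N ℕ.+_) (sum-replicate n)

        g-zeros : ∀ n → g (zeros {n}) ≡ + 1
        g-zeros zero = refl
        g-zeros (suc n) = trans (ℤ.*-identityˡ _) (g-zeros n)

        V = Δ^ {n} (2 ℕ.* m) g zeros

        K!V : + (K !) * V ≡ weight N w * F w
        K!V = begin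
          + (K !) * V                                         ≡⟨ cong ((+ (K !)) *_) (run-powers (2 ℕ.* m) g zeros) ⟨
          + (K !) * run (concatMap (λ p → List.replicate (2 ℕ.* m) (monic p)) (upper n)) g zeros
            ≡⟨ cong (λ l → + (K !) * run l g zeros) (forms-blocks (upper n)) ⟨
          + (K !) * diff (List.map proj₁ L) g zeros           ≡⟨ Λ-leading L zeros order ⟨
          g (zeros {n}) * Λ (rest zeros) (affines L φ)        ≡⟨ cong₂ _*_ (g-zeros n) (trans (cong (λ M → Λ M (affines L φ)) (Vec.map-replicate (N ℕ.∸_) 0 n)) (Λ-cong (Vec.replicate n N) affines≡F)) ⟩
          + 1 * Λ (Vec.replicate n N) F                       ≡⟨ ℤ.*-identityˡ _ ⟩
          Λ (Vec.replicate n N) F                             ≡⟨ Λ-single N w F F-vanish ⟩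
          weight N w * F w                                    ∎

        -- nN + K = 2(K + s₀) is even.
        sign : sgn (n ℕ.* N ℕ.+ s₀) * sgn K ≡ sgn s₀
        sign = begin
          sgn (n ℕ.* N ℕ.+ s₀) * sgn K              ≡⟨ sgn-+ (n ℕ.* N ℕ.+ s₀) K ⟨
          sgn (n ℕ.* N ℕ.+ s₀ ℕ.+ K)                ≡⟨ cong (λ k → sgn (k ℕ.+ s₀ ℕ.+ K)) size ⟨
          sgn (K ℕ.+ 2 ℕ.* s₀ ℕ.+ s₀ ℕ.+ K)
            ≡⟨ cong sgn (ℕ+ 2 (λ K s → K :+ₙ conₙ 2 :*ₙ s :+ₙ s :+ₙ K :=ₙ conₙ 2 :*ₙ (K :+ₙ s) :+ₙ s) refl K s₀) ⟩
          sgn (2 ℕ.* (K ℕ.+ s₀) ℕ.+ s₀)             ≡⟨ sgn-+ (2 ℕ.* (K ℕ.+ s₀)) s₀ ⟩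
          sgn (2 ℕ.* (K ℕ.+ s₀)) * sgn s₀           ≡⟨ cong (_* sgn s₀) (sgn-2* (K ℕ.+ s₀)) ⟩
          + 1 * sgn s₀                              ≡⟨ ℤ.*-identityˡ _ ⟩
          sgn s₀                                    ∎
          where open ℕ-Solver.+-*-Solver renaming (solve to ℕ+; _:+_ to _:+ₙ_; _:*_ to _:*ₙ_; _:=_ to _:=ₙ_; con to conₙ)

        low≡ : ∏ᵛ (λ c → + (c !)) w ≡ low n
        low≡ = ∏ᵛ-progression (λ c → + (c !)) 0 n

        P = + ((m !) ℕ.^ n)

        -- K! comes from the mixed difference and again from (-1)_K, `low n` from the binomials and
        -- again from the table; both are cancelled afterwards, as ℤ is a domain.
        scaled-up : (+ (K !) * low n) * (P * V) ≡ (+ (K !) * low n) * (sgn s₀ * numerator n * falling∏ m n (+ N))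
        scaled-up = begin
          (+ (K !) * low n) * (P * V)
            ≡⟨ solve 4 (λ k l p v → (k :* l) :* (p :* v) := (k :* v) :* (l :* p)) refl (+ (K !)) (low n) P V ⟩
          (+ (K !) * V) * (low n * P)
            ≡⟨ cong (_* (low n * P)) (trans K!V (cong₂ (λ t f → weight N w * (t * f)) (cong table (toList-progression 0 n)) φ-w)) ⟩
          weight N w * (table (progression 0 n) * (sgn K * + (K !))) * (low n * P)
            ≡⟨ solve 6 (λ w t s k l p → w :* (t :* (s :* k)) :* (l :* p) := (w :* l) :* (t :* p) :* (s :* k)) refl
                 (weight N w) (table (progression 0 n)) (sgn K) (+ (K !)) (low n) P ⟩
          (weight N w * low n) * (table (progression 0 n) * P) * (sgn K * + (K !))
            ≡⟨ cong₂ (λ x y → x * y * (sgn K * + (K !))) weighted (table-progression 0 n) ⟩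
          (sgn (n ℕ.* N ℕ.+ s₀) * falling∏ m n (+ N)) * (numerator n * low n) * (sgn K * + (K !))
            ≡⟨ solve 6 (λ s f a l t k → (s :* f) :* (a :* l) :* (t :* k) := (k :* l) :* ((s :* t) :* a :* f)) refl
                 (sgn (n ℕ.* N ℕ.+ s₀)) (falling∏ m n (+ N)) (numerator n) (low n) (sgn K) (+ (K !)) ⟩
          (+ (K !) * low n) * (sgn (n ℕ.* N ℕ.+ s₀) * sgn K * numerator n * falling∏ m n (+ N))
            ≡⟨ cong (λ s → (+ (K !) * low n) * (s * numerator n * falling∏ m n (+ N))) sign ⟩
          (+ (K !) * low n) * (sgn s₀ * numerator n * falling∏ m n (+ N)) ∎
          where
          weighted : weight N w * low n ≡ sgn (n ℕ.* N ℕ.+ s₀) * falling∏ m n (+ N)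
          weighted = begin
            weight N w * low n                            ≡⟨ cong (weight N w *_) low≡ ⟨
            weight N w * ∏ᵛ (λ c → + (c !)) w             ≡⟨ weight-! N w ⟩
            sgn (n ℕ.* N ℕ.+ Vec.sum w) * ∏ᵛ (ff (+ N)) w ≡⟨ cong₂ (λ k p → sgn (n ℕ.* N ℕ.+ k) * p) sum-w (∏ᵛ-progression (ff (+ N)) 0 n) ⟩
            sgn (n ℕ.* N ℕ.+ s₀) * falling∏ m n (+ N)     ∎

        nonzero : + (K !) * low n ≢ + 0
        nonzero e with ℤ.i*j≡0⇒i≡0∨j≡0 (+ (K !)) e
        ... | inj₁ e′ = contradiction (ℤ.+-injective e′) (ℕ.≢-nonZero⁻¹ (K !) {{ℕ._!≢0 K}})
        ... | inj₂ e′ = ∏ᵛ-!≢0 w (trans low≡ e′)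

      core-at : ι ((m !) ℕ.^ n) * Δ^ {n} (2 ℕ.* m) (ffs (λ _ → + N)) zeros
        ≡ sgn (m ℕ.* (n C 2)) * ι (numConst m n) * falling∏ m n (+ N)
      core-at = begin
        ι ((m !) ℕ.^ n) * V                                      ≡⟨ cong (_* V) (ι≡+ ((m !) ℕ.^ n)) ⟩
        P * V                                                    ≡⟨ ℤ.*-cancelˡ-≡ (+ (K !) * low n) _ _ {{ℤ.≢-nonZero nonzero}} scaled-up ⟩
        sgn s₀ * numerator n * falling∏ m n (+ N)                ≡⟨ cong (λ z → sgn s₀ * z * falling∏ m n (+ N)) (ι-numConst n) ⟨
        sgn s₀ * ι (numConst m n) * falling∏ m n (+ N)           ∎

-- Transfer of polynomial identities from the integers to any commutative ring.

open FiniteDifferences using (ι≡+)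
open GridEvaluation using (module Grid)
open import Data.Integer using (+_; -[1+_])

_+ₗ_ : List ℤ → List ℤ → List ℤ
[] +ₗ q = q
(c ∷ p) +ₗ [] = c ∷ p
(c ∷ p) +ₗ (d ∷ q) = (c ℤ.+ d) ∷ (p +ₗ q)

scaleₗ : ℤ → List ℤ → List ℤ
scaleₗ a = List.map (a ℤ.*_)

_*ₗ_ : List ℤ → List ℤ → List ℤ
[] *ₗ q = []
(c ∷ p) *ₗ q = scaleₗ c q +ₗ (+ 0 ∷ (p *ₗ q))

module Evaluation {c ℓ : Level} (R : CommutativeRing c ℓ) where
  open CommutativeRing R hiding (zero)
  open IntegerImage R
  open import Relation.Binary.Reasoning.Setoid setoid

  eval : List ℤ → Carrier → Carrier
  eval [] x = 0#
  eval (c ∷ p) x = ⟦ c ⟧ℤ + x * eval p x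

  eval-+ : ∀ p q x → eval (p +ₗ q) x ≈ eval p x + eval q x
  eval-+ [] q x = sym (+-identityˡ _)
  eval-+ (c ∷ p) [] x = sym (+-identityʳ _)
  eval-+ (c ∷ p) (d ∷ q) x = trans (+-cong (⟦⟧-+ c d) (*-congˡ (eval-+ p q x)))
    (solve 5 (λ c d x p q → (c :+ d) :+ x :* (p :+ q) := (c :+ x :* p) :+ (d :+ x :* q)) refl _ _ _ _ _)

  eval-scale : ∀ a p x → eval (scaleₗ a p) x ≈ ⟦ a ⟧ℤ * eval p x
  eval-scale a [] x = sym (zeroʳ _)
  eval-scale a (c ∷ p) x = trans (+-cong (⟦⟧-* a c) (*-congˡ (eval-scale a p x)))
    (solve 4 (λ a c x p → a :* c :+ x :* (a :* p) := a :* (c :+ x :* p)) refl _ _ _ _)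

  eval-* : ∀ p q x → eval (p *ₗ q) x ≈ eval p x * eval q x
  eval-* [] q x = sym (zeroˡ _)
  eval-* (c ∷ p) q x = begin
    eval (scaleₗ c q +ₗ (+ 0 ∷ (p *ₗ q))) x              ≈⟨ eval-+ (scaleₗ c q) (+ 0 ∷ (p *ₗ q)) x ⟩
    eval (scaleₗ c q) x + (0# + x * eval (p *ₗ q) x)     ≈⟨ +-cong (eval-scale c q x) (trans (+-identityˡ _) (*-congˡ (eval-* p q x))) ⟩
    ⟦ c ⟧ℤ * eval q x + x * (eval p x * eval q x)
      ≈⟨ solve 4 (λ c q x p → c :* q :+ x :* (p :* q) := (c :+ x :* p) :* q) refl _ _ _ _ ⟩
    eval (c ∷ p) x * eval q x                            ∎

open Evaluation ℤ.+-*-commutativeRing using () renaming (eval to evalℤ)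
open IntegerImage ℤ.+-*-commutativeRing using () renaming (⟦_⟧ℤ to ⟦_⟧ᶻ)

⟦⟧ᶻ-id : ∀ z → ⟦ z ⟧ᶻ ≡ z
⟦⟧ᶻ-id (+ n) = ι≡+ n
⟦⟧ᶻ-id -[1+ n ] = ≡.cong ℤ.-_ (ι≡+ (suc n))

-- Synthetic division by x - a: the coefficients are the values at a of the successive tails.
quotient : ℤ → List ℤ → List ℤ
quotient a [] = []
quotient a (c ∷ []) = []
quotient a (c ∷ d ∷ p) = evalℤ (d ∷ p) a ∷ quotient a (d ∷ p)

length-quotient : ∀ a c p → List.length (quotient a (c ∷ p)) ≡ List.length p
length-quotient a c [] = ≡.refl
length-quotient a c (d ∷ p) = ≡.cong suc (length-quotient a d p)

module Transfer {c ℓ : Level} (R : CommutativeRing c ℓ) where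
  open CommutativeRing R hiding (zero)
  open IntegerImage R
  open Evaluation R
  open import Relation.Binary.Reasoning.Setoid setoid

  -- The divisor x - a is monic, so quotient and remainder have integer coefficients and the
  -- division can be read in every ring.
  eval-quotient : ∀ a p x → eval p x ≈ ⟦ evalℤ p a ⟧ℤ + (x - ⟦ a ⟧ℤ) * eval (quotient a p) x
  eval-quotient a [] x = sym (trans (+-identityˡ _) (zeroʳ _))
  eval-quotient a (c ∷ []) x = begin
    ⟦ c ⟧ℤ + x * 0#                                      ≈⟨ +-cong (reflexive (≡.cong ⟦_⟧ℤ (≡.sym constant))) (trans (zeroʳ _) (sym (zeroʳ _))) ⟩
    ⟦ evalℤ (c ∷ []) a ⟧ℤ + (x - ⟦ a ⟧ℤ) * 0#            ∎
    where
    constant : evalℤ (c ∷ []) a ≡ c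
    constant = ≡.trans (≡.cong₂ ℤ._+_ (⟦⟧ᶻ-id c) (ℤ.*-zeroʳ a)) (ℤ.+-identityʳ c)
  eval-quotient a (c ∷ p@(_ ∷ _)) x = begin
    ⟦ c ⟧ℤ + x * eval p x
      ≈⟨ +-congˡ (*-congˡ (eval-quotient a p x)) ⟩
    ⟦ c ⟧ℤ + x * (e + (x - ⟦ a ⟧ℤ) * q)
      ≈⟨ solve 5 (λ c x e a q → c :+ x :* (e :+ (x :- a) :* q) := (c :+ a :* e) :+ (x :- a) :* (e :+ x :* q)) refl _ _ _ _ _ ⟩
    (⟦ c ⟧ℤ + ⟦ a ⟧ℤ * e) + (x - ⟦ a ⟧ℤ) * (e + x * q)
      ≈⟨ +-congʳ value ⟨
    ⟦ evalℤ (c ∷ p) a ⟧ℤ + (x - ⟦ a ⟧ℤ) * (e + x * q) ∎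
    where
    e = ⟦ evalℤ p a ⟧ℤ
    q = eval (quotient a p) x
    value : ⟦ evalℤ (c ∷ p) a ⟧ℤ ≈ ⟦ c ⟧ℤ + ⟦ a ⟧ℤ * e
    value = begin
      ⟦ ⟦ c ⟧ᶻ ℤ.+ a ℤ.* evalℤ p a ⟧ℤ      ≡⟨ ≡.cong (λ z → ⟦ z ℤ.+ a ℤ.* evalℤ p a ⟧ℤ) (⟦⟧ᶻ-id c) ⟩
      ⟦ c ℤ.+ a ℤ.* evalℤ p a ⟧ℤ           ≈⟨ ⟦⟧-+ c (a ℤ.* evalℤ p a) ⟩
      ⟦ c ⟧ℤ + ⟦ a ℤ.* evalℤ p a ⟧ℤ        ≈⟨ +-congˡ (⟦⟧-* a (evalℤ p a)) ⟩
      ⟦ c ⟧ℤ + ⟦ a ⟧ℤ * e                  ∎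

evalℤ-quotient : ∀ a p z → evalℤ p z ≡ evalℤ p a ℤ.+ (z ℤ.- a) ℤ.* evalℤ (quotient a p) z
evalℤ-quotient a p z = ≡.trans (Transfer.eval-quotient ℤ.+-*-commutativeRing a p z)
  (≡.cong₂ (λ e b → e ℤ.+ (z ℤ.- b) ℤ.* evalℤ (quotient a p) z) (⟦⟧ᶻ-id (evalℤ p a)) (⟦⟧ᶻ-id a))

VanishesFrom : ℕ → (ℤ → ℤ) → Set
VanishesFrom N₀ f = ∀ N → N₀ ℕ.≤ N → f (+ N) ≡ + 0

-- For N > N₀ the factor N - N₀ is nonzero and ℤ has no zero divisors.
quotient-vanishes : ∀ p N₀ → VanishesFrom N₀ (evalℤ p) → VanishesFrom (suc N₀) (evalℤ (quotient (+ N₀) p))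
quotient-vanishes p N₀ p0 N N₀<N with ℤ.i*j≡0⇒i≡0∨j≡0 (+ N ℤ.- + N₀) product
  where
  product : (+ N ℤ.- + N₀) ℤ.* evalℤ (quotient (+ N₀) p) (+ N) ≡ + 0
  product = begin
    (+ N ℤ.- + N₀) ℤ.* evalℤ (quotient (+ N₀) p) (+ N)                          ≡⟨ ℤ.+-identityˡ _ ⟨
    + 0 ℤ.+ (+ N ℤ.- + N₀) ℤ.* evalℤ (quotient (+ N₀) p) (+ N)                  ≡⟨ ≡.cong (λ e → e ℤ.+ (+ N ℤ.- + N₀) ℤ.* evalℤ (quotient (+ N₀) p) (+ N)) (p0 N₀ ℕ.≤-refl) ⟨
    evalℤ p (+ N₀) ℤ.+ (+ N ℤ.- + N₀) ℤ.* evalℤ (quotient (+ N₀) p) (+ N)       ≡⟨ evalℤ-quotient (+ N₀) p (+ N) ⟨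
    evalℤ p (+ N)                                                              ≡⟨ p0 N (ℕ.<⇒≤ N₀<N) ⟩
    + 0                                                                        ∎
    where open ≡.≡-Reasoning
... | inj₁ e = contradiction (ℤ.+-injective (ℤ.i-j≡0⇒i≡j (+ N) (+ N₀) e)) (ℕ.>⇒≢ N₀<N)
... | inj₂ e = e

module Specialisation {c ℓ : Level} (R : CommutativeRing c ℓ) where
  open CommutativeRing R hiding (zero)
  open Ops R
  open IntegerImage R
  open Evaluation R
  open Transfer R using (eval-quotient)
  open Assembly R using (falling∏)
  open Antisymmetry R using (Functional; diff; Δ^; ffs)
  open import Algebra.Properties.Ring ring
  open import Relation.Binary.Reasoning.Setoid setoid
  private
    module ℤO = Ops ℤ.+-*-commutativeRing
    module ℤA = Assembly ℤ.+-*-commutativeRing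
    module ℤΔ = Antisymmetry ℤ.+-*-commutativeRing
    module ℤE = Evaluation ℤ.+-*-commutativeRing

  -- The roots N₀, N₀ + 1, ... are divided out over ℤ one by one; each division shortens the list,
  -- until nothing is left. No division takes place in `R`.
  eval-vanishes : ∀ k p → List.length p ≡ k → ∀ N₀ → VanishesFrom N₀ (evalℤ p) → ∀ x → eval p x ≈ 0#
  eval-vanishes k [] e N₀ p0 x = refl
  eval-vanishes (suc k) (c ∷ p) e N₀ p0 x = begin
    eval (c ∷ p) x
      ≈⟨ eval-quotient (+ N₀) (c ∷ p) x ⟩
    ⟦ evalℤ (c ∷ p) (+ N₀) ⟧ℤ + (x - ι N₀) * eval q x
      ≈⟨ +-cong (reflexive (≡.cong ⟦_⟧ℤ (p0 N₀ ℕ.≤-refl)))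
           (*-congˡ (eval-vanishes k q (≡.trans (length-quotient (+ N₀) c p) (ℕ.suc-injective e)) (suc N₀) (quotient-vanishes (c ∷ p) N₀ p0) x)) ⟩
    0# + (x - ι N₀) * 0#
      ≈⟨ trans (+-identityˡ _) (zeroʳ _) ⟩
    0# ∎
    where q = quotient (+ N₀) (c ∷ p)

  -- One expression, read in ℤ and in `R`, is given in both readings by the same polynomial with
  -- integer coefficients.
  SamePolynomial : (ℤ → ℤ) → (Carrier → Carrier) → Set (c ⊔ ℓ)
  SamePolynomial fᶻ f = ∃[ p ] (∀ z → evalℤ p z ≡ fᶻ z) × (∀ x → eval p x ≈ f x)

  same-ι : ∀ n → SamePolynomial (λ _ → ℤO.ι n) (λ _ → ι n)
  same-ι n = + n ∷ [] , (λ z → ≡.trans (≡.cong (λ u → ℤO.ι n ℤ.+ u) (ℤ.*-zeroʳ z)) (ℤ.+-identityʳ _))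
    , (λ x → trans (+-congˡ (zeroʳ x)) (+-identityʳ _))

  same-1 : SamePolynomial (λ _ → + 1) (λ _ → 1#)
  same-1 with same-ι 1
  ... | p , s , t = p , s , λ x → trans (t x) (+-identityʳ 1#)

  same-x : SamePolynomial id id
  same-x = + 0 ∷ + 1 ∷ []
    , (λ z → ≡.trans (ℤ.+-identityˡ _) (≡.trans (≡.cong (λ u → z ℤ.* (+ 1 ℤ.+ u)) (ℤ.*-zeroʳ z)) (ℤ.*-identityʳ z)))
    , (λ x → trans (+-identityˡ _) (trans (*-congˡ (trans (+-cong (+-identityʳ 1#) (zeroʳ x)) (+-identityʳ 1#))) (*-identityʳ x)))

  same-* : ∀ {fᶻ gᶻ f g} → SamePolynomial fᶻ f → SamePolynomial gᶻ g →
    SamePolynomial (λ z → fᶻ z ℤ.* gᶻ z) (λ x → f x * g x)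
  same-* (p , s , t) (q , s′ , t′) = p *ₗ q
    , (λ z → ≡.trans (ℤE.eval-* p q z) (≡.cong₂ ℤ._*_ (s z) (s′ z)))
    , (λ x → trans (eval-* p q x) (*-cong (t x) (t′ x)))

  same-neg : ∀ {fᶻ f} → SamePolynomial fᶻ f → SamePolynomial (λ z → ℤ.- fᶻ z) (λ x → - f x)
  same-neg (p , s , t) = scaleₗ (ℤ.- + 1) p
    , (λ z → ≡.trans (ℤE.eval-scale (ℤ.- + 1) p z) (≡.trans (ℤ.-1*i≡-i (evalℤ p z)) (≡.cong ℤ.-_ (s z))))
    , (λ x → trans (eval-scale (ℤ.- + 1) p x) (trans (*-congʳ (-‿cong (+-identityʳ 1#))) (trans (-1*x≈-x _) (-‿cong (t x)))))

  same-- : ∀ {fᶻ gᶻ f g} → SamePolynomial fᶻ f → SamePolynomial gᶻ g →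
    SamePolynomial (λ z → fᶻ z ℤ.- gᶻ z) (λ x → f x - g x)
  same-- (p , s , t) g-same with same-neg g-same
  ... | q , s′ , t′ = p +ₗ q
    , (λ z → ≡.trans (ℤE.eval-+ p q z) (≡.cong₂ ℤ._+_ (s z) (s′ z)))
    , (λ x → trans (eval-+ p q x) (+-cong (t x) (t′ x)))

  same-sgn : ∀ k → SamePolynomial (λ _ → ℤO.sgn k) (λ _ → sgn k)
  same-sgn zero = same-1
  same-sgn (suc k) = same-neg (same-sgn k)

  same-ff : ∀ r → SamePolynomial (λ z → ℤO.ff z r) (λ x → ff x r)
  same-ff zero = same-1
  same-ff (suc r) = same-* (same-ff r) (same-- same-x (same-ι r))

  same-ffs : ∀ {n} (v : Vec ℕ n) → SamePolynomial (λ z → ℤΔ.ffs (λ _ → z) v) (λ x → ffs (λ _ → x) v)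
  same-ffs [] = same-1
  same-ffs (k ∷ v) = same-* (same-ff k) (same-ffs v)

  same-diff : ∀ {n} (L : List (Pair n)) {gᶻ : ℤ → ℤΔ.Functional n} {g : Carrier → Functional n} →
    (∀ v → SamePolynomial (λ z → gᶻ z v) (λ x → g x v)) →
    ∀ v → SamePolynomial (λ z → ℤΔ.diff L (gᶻ z) v) (λ x → diff L (g x) v)
  same-diff [] same v = same v
  same-diff ((i , j) ∷ L) same v = same--
    (same-* same-1 (same-diff L same (inc j v))) (same-* same-1 (same-diff L same (inc i v)))

  same-Δ^ : ∀ {n} k (v : Vec ℕ n) →
    SamePolynomial (λ z → ℤΔ.Δ^ k (ℤΔ.ffs (λ _ → z)) v) (λ x → Δ^ k (ffs (λ _ → x)) v)
  same-Δ^ zero v = same-ffs v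
  same-Δ^ {n} (suc k) v = same-diff (upper n) (same-Δ^ k) v

  same-falling∏ : ∀ m n → SamePolynomial (ℤA.falling∏ m n) (falling∏ m n)
  same-falling∏ m n = product (allFin n)
    where
    product : (rs : List (Fin n)) → SamePolynomial
      (λ z → ℤO.∏ (List.map (λ r → ℤO.ff z (toℕ r ℕ.* m)) rs))
      (λ x → ∏ (List.map (λ r → ff x (toℕ r ℕ.* m)) rs))
    product [] = same-1
    product (r ∷ rs) = same-* (same-ff (toℕ r ℕ.* m)) (product rs)

  same-equal : ∀ {fᶻ gᶻ f g} → SamePolynomial fᶻ f → SamePolynomial gᶻ g →
    ∀ N₀ → (∀ N → N₀ ℕ.≤ N → fᶻ (+ N) ≡ gᶻ (+ N)) → ∀ x → f x ≈ g x
  same-equal f-same g-same N₀ e x with same-- f-same g-same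
  ... | p , s , t = x∙y⁻¹≈ε⇒x≈y _ _ (trans (sym (t x))
    (eval-vanishes _ p ≡.refl N₀ (λ N le → ≡.trans (s (+ N)) (ℤ.i≡j⇒i-j≡0 (e N le))) x))

  core : ∀ m n → 1 ℕ.≤ m → ∀ x → ι ((m !) ℕ.^ n) * Δ^ {n} (2 ℕ.* m) (ffs (λ _ → x)) zeros
    ≈ sgn (m ℕ.* (n C 2)) * ι (numConst m n) * falling∏ m n x
  core m n 1≤m = same-equal
    (same-* (same-ι ((m !) ℕ.^ n)) (same-Δ^ (2 ℕ.* m) zeros))
    (same-* (same-* (same-sgn (m ℕ.* (n C 2))) (same-ι (numConst m n))) (same-falling∏ m n))
    -- From this N on the subtraction that defines K is not truncated: for n ≥ 1 since nN ≥ N, for n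
    -- = 0 since C(0,2) = 0.
    (2 ℕ.* (m ℕ.* (n C 2)))
    (λ N le → Grid.core-at m 1≤m n N (n ℕ.* N ℕ.∸ 2 ℕ.* (m ℕ.* (n C 2))) (ℕ.m∸n+n≡m (enough n le)))
    where
    enough : ∀ n {N} → 2 ℕ.* (m ℕ.* (n C 2)) ℕ.≤ N → 2 ℕ.* (m ℕ.* (n C 2)) ℕ.≤ n ℕ.* N
    enough zero le = ℕ.≤-reflexive (≡.cong (2 ℕ.*_) (ℕ.*-zeroʳ m))
    enough (suc n) {N} le = ℕ.≤-trans le (ℕ.m≤m+n N (n ℕ.* N))

theorem2p2 : ∀ {c ℓ : Level} (R : CommutativeRing c ℓ) (m n : ℕ) → 1 ≤ m →
    let open CommutativeRing R
        open Ops R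
    in (∀ (x : Carrier) →
          ι (denConst m n) * ∏ (map (λ r → ff x (toℕ r)) (allFin n))
            * star n (Qpoly m n) (λ i → x - ι (n ∸ 1 ∸ toℕ i))
          ≈ sgn ((m ∸ 1) *ℕ (n C 2)) * ι (numConst m n)
            * ∏ (map (λ r → ff x (toℕ r *ℕ m)) (allFin n)))
     × (∀ (a : Fin n → Carrier) (x : Carrier) →
          ι (denConst m n) * star n (Rpoly m n a) (λ _ → x)
          ≈ sgn (m *ℕ (n C 2)) * ι (numConst m n)
            * per (λ i j → pow (a j) (toℕ i))
            * ∏ (map (λ r → ff x (toℕ r *ℕ m)) (allFin n)))
theorem2p2 R m n 1≤m =
    (λ x → Q-identity m n 1≤m x (core m n 1≤m x))
  , (λ a x → R-identity m n 1≤m x (core m n 1≤m x) a)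
  where
  open Assembly R
  open Specialisation R
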